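{- The worst-case running time of the algorithm MRSD_Multipartition, run on a weighted complete graph $G=(V,E)$ with $n=|V|$ vertices whose edge weights satisfy the triangle inequality and an integer $k$ with $3\le k\le n$, is $O(n^3)$.
   Context: Running time is measured in the usual unit-cost RAM model (arithmetic operations on and comparisons of weights take constant time), with the high-level steps of the algorithm implemented by suitable standard algorithms and data structures. A weighted complete graph $G=(V,E)$ is a finite simple undirected complete graph in which each edge $(u,v)$ carries a positive weight $d(u,v)=d(v,u)>0$; put $d(u,u)=0$. The triangle inequality means $d(u,v)\le d(u,w)+d(v,w)$ for all $u,v,w\in V$. A partition of $V$ into $k$ clusters is a family $P=\{C_1,\dots,C_k\}$ of non-empty pairwise disjoint sets with union $V$. The split of $P$ is $s(P)=\min_i s(C_i)$, where $s(C_i)=\min\{d(p,q): p\in C_i,\ q\in C_j,\ j\neq i\}$. The diameter of $P$ is $d(P)=\max_i d(C_i)$, where $d(C)=\max_{p,q\in C}d(p,q)$. If $d(P)=0$, the ratio $s(P)/d(P)$ is read as $+\infty$. Merging two vertices $u,v$ of a weighted complete graph means replacing them by one new vertex (a supervertex) whose edge to any remaining vertex $x$ has weight $\max\{d(u,x),d(v,x)\}$; all other edges and weights are unchanged and the edge $(u,v)$ is removed. If $G'$ is obtained from $G$ by successive merges, each vertex of $G'$ corresponds to the set of vertices of $G$ merged into it, and a partition $P'$ of the vertices of $G'$ induces a partition $P$ of $V$ by replacing each supervertex by the vertices of $G$ merged into it. Algorithm MRSD_Multipartition. Input: $G$ and $k$. Set $Cost:=0$, $solution:=\emptyset$. Construct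 a minimum spanning tree $T_{min}$ of $G$; let $L$ be the list of its edges in ascending order of weight; set $G'=(V',E'):=G$. While $|L|\ge k-1$ do: (1) choose an arbitrary vertex of $V'$ and let $S$ consist of this vertex; while $|S|<k$, add to $S$ a vertex $p\in V'\setminus S$ maximizing $\min_{q\in S}d(p,q)$ (distances in $G'$); (2) assign each vertex of $V'$ to a nearest element of $S$ in $G'$ (each element of $S$ being assigned to itself), giving a partition $P'$ of $V'$ into $k$ clusters; let $P$ be the partition of $V$ induced by $P'$; (3) if $s(P)/d(P)>Cost$ (with $s,d$ computed in $G$), set $Cost:=s(P)/d(P)$ and $solution:=P$; (4) while $|L|\ge k-1$ and the first edge $(p,q)$ of $L$ satisfies $d(p,q)\le s(P)$: merge the two vertices of $G'$ that contain $p$ and $q$ respectively, and remove $(p,q)$ from $L$. Return $solution$. -}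

module Defs where

open import Level using (Lift; 0ℓ) renaming (_⊔_ to _⊔ˡ_; suc to lsuc)
open import Algebra.Core using (Op₁; Op₂)
open import Algebra.Structures using (IsCommutativeRing)
import Algebra.Construct.NaturalChoice.Max as Max
open import Data.Bool using (Bool; true; false; not; _∧_; if_then_else_)
open import Data.Fin as Fin using (Fin; toℕ)
open import Data.Fin.Subset using (Subset; _∈_; _∉_; ⊤; _-_)
open import Data.List using (List; []; _∷_; _∷ʳ_; foldr; length)
import Data.List as List
open import Data.List.Membership.Propositional using () renaming (_∈_ to _∈ᴸ_)
open import Data.List.Relation.Binary.Permutation.Propositional using (_↭_)
open import Data.List.Relation.Unary.All using (All)
open import Data.List.Relation.Unary.Linked using (Linked)
open import Data.List.Relation.Unary.Unique.Propositional using (Unique)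
open import Data.Maybe using (Maybe; just; nothing)
open import Data.Nat using (ℕ; suc; _+_; _*_; _∸_; _≤_; _≤?_; _<?_; _≟_)
open import Data.Product using (∃-syntax; _×_; _,_; proj₁; proj₂; uncurry)
open import Data.Sum using (_⊎_)
open import Data.Vec using (Vec; []; _∷_; lookup)
open import Data.Vec.Membership.Propositional using () renaming (_∈_ to _∈ⱽ_; _∉_ to _∉ⱽ_)
open import Function using (_∘_; id)
open import Relation.Binary.Bundles using (DecTotalOrder)
open import Relation.Binary.Core using (Rel)
open import Relation.Binary.Structures using (IsDecTotalOrder)
open import Relation.Binary.Construct.Closure.ReflexiveTransitive using (Star)
import Relation.Binary.Construct.NonStrictToStrict as ToStrict
import Relation.Binary.Construct.Add.Supremum.Strict as WithInfinity
open import Relation.Binary.PropositionalEquality using (_≡_; _≢_)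
open import Relation.Nullary using (¬_; does; yes; no)
open import Relation.Nullary.Construct.Add.Supremum using (_⁺; ⊤⁺; [_])

-- Weights live in an arbitrary ordered field with decidable order; (classical)
-- ℝ is the intended instance.  As usual, _⁻¹ is total and unspecified at 0#.
record OrderedField c ℓ : Set (lsuc (c ⊔ˡ ℓ)) where
  infix  8 _⁻¹
  infixl 7 _*ᶠ_ _/ᶠ_
  infixl 6 _+ᶠ_ _-ᶠ_
  infix  4 _≤ᶠ_
  field
    Carrier           : Set c
    _≤ᶠ_              : Rel Carrier ℓ
    _+ᶠ_ _*ᶠ_         : Op₂ Carrier
    -ᶠ_ _⁻¹           : Op₁ Carrier
    0# 1#             : Carrier
    isCommutativeRing : IsCommutativeRing _≡_ _+ᶠ_ _*ᶠ_ -ᶠ_ 0# 1#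
    isDecTotalOrder   : IsDecTotalOrder _≡_ _≤ᶠ_
    0≢1               : 0# ≢ 1#
    ⁻¹-inverse        : ∀ {x} → x ≢ 0# → x *ᶠ x ⁻¹ ≡ 1#
    +-monoˡ-≤         : ∀ {x y} z → x ≤ᶠ y → x +ᶠ z ≤ᶠ y +ᶠ z
    *-nonneg          : ∀ {x y} → 0# ≤ᶠ x → 0# ≤ᶠ y → 0# ≤ᶠ x *ᶠ y

  decTotalOrder : DecTotalOrder c c ℓ
  decTotalOrder = record { isDecTotalOrder = isDecTotalOrder }

  open IsDecTotalOrder isDecTotalOrder public
    using () renaming (_≟_ to _≟ᶠ_; _≤?_ to _≤ᶠ?_)
  open ToStrict _≡_ _≤ᶠ_ public using () renaming (_<_ to _<ᶠ_)
  open Max (DecTotalOrder.totalOrder decTotalOrder) public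
    using () renaming (_⊔_ to _⊔ᶠ_)
  open WithInfinity _<ᶠ_ public using (_<⁺_)

  _-ᶠ_ _/ᶠ_ : Op₂ Carrier
  x -ᶠ y = x +ᶠ (-ᶠ y)
  x /ᶠ y = x *ᶠ y ⁻¹

------------------------------------------------------------------------
-- A unit-cost RAM with structured control flow.  Memory consists of
-- unbounded arrays of naturals and unbounded arrays of weights.  Arrays are
-- named by literals, so a program uses only finitely many of them; cells are
-- addressed by computed indices.

infixl 6 _⊕_ _⊖_
infixl 7 _⊗_ _⊘_

data NatExp : Set where
  con         : ℕ → NatExp
  at          : (array : ℕ) → NatExp → NatExp
  _⊕_ _⊖_ _⊗_ : NatExp → NatExp → NatExp          -- _⊖_ is truncated

data WeightExp : Set where
  zeroʷ               : WeightExp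
  at                  : (array : ℕ) → NatExp → WeightExp
  _⊕_ _⊖_ _⊗_ _⊘_     : WeightExp → WeightExp → WeightExp

data Test : Set where
  _≤ᴺ_ _≡ᴺ_ : NatExp → NatExp → Test
  _≤ᵂ_      : WeightExp → WeightExp → Test
  notᵗ      : Test → Test
  _andᵗ_    : Test → Test → Test

data Com : Set where
  skip     : Com
  _⟨_⟩≔ᴺ_  : (array : ℕ) → NatExp → NatExp → Com
  _⟨_⟩≔ᵂ_  : (array : ℕ) → NatExp → WeightExp → Com
  _⨾_      : Com → Com → Com
  if       : Test → Com → Com → Com
  while    : Test → Com → Com

infixr 5 _⨾_

-- One time unit per constant, memory access, arithmetic operation, comparison
-- and Boolean connective.
costᴺ : NatExp → ℕ
costᴺ (con _)  = 1
costᴺ (at _ e) = 1 + costᴺ e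
costᴺ (e ⊕ f)  = 1 + costᴺ e + costᴺ f
costᴺ (e ⊖ f)  = 1 + costᴺ e + costᴺ f
costᴺ (e ⊗ f)  = 1 + costᴺ e + costᴺ f

costᵂ : WeightExp → ℕ
costᵂ zeroʷ    = 1
costᵂ (at _ e) = 1 + costᴺ e
costᵂ (e ⊕ f)  = 1 + costᵂ e + costᵂ f
costᵂ (e ⊖ f)  = 1 + costᵂ e + costᵂ f
costᵂ (e ⊗ f)  = 1 + costᵂ e + costᵂ f
costᵂ (e ⊘ f)  = 1 + costᵂ e + costᵂ f

costᵗ : Test → ℕ
costᵗ (e ≤ᴺ f)   = 1 + costᴺ e + costᴺ f
costᵗ (e ≡ᴺ f)   = 1 + costᴺ e + costᴺ f
costᵗ (e ≤ᵂ f)   = 1 + costᵂ e + costᵂ f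
costᵗ (notᵗ b)   = 1 + costᵗ b
costᵗ (b andᵗ c) = 1 + costᵗ b + costᵗ c

-- One piece of code for each high-level step of the algorithm.
record Implementation : Set where
  field
    initialise : Com
    continue   : Test
    select     : Com
    assign     : Com
    evaluate   : Com
    contract   : Com

  program : Com
  program = initialise ⨾ while continue (select ⨾ assign ⨾ evaluate ⨾ contract)

module RAM {c ℓ} (𝔽 : OrderedField c ℓ) where
  open OrderedField 𝔽

  record Memory : Set c where
    field
      nat    : (array index : ℕ) → ℕ
      weight : (array index : ℕ) → Carrier

  open Memory public

  write : ∀ {a} {A : Set a} → (ℕ → ℕ → A) → ℕ → ℕ → A → ℕ → ℕ → A
  write f a i x b j = if does (a ≟ b) ∧ does (i ≟ j) then x else f b j

  evalᴺ : NatExp → Memory → ℕ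
  evalᴺ (con x)  m = x
  evalᴺ (at a e) m = nat m a (evalᴺ e m)
  evalᴺ (e ⊕ f)  m = evalᴺ e m + evalᴺ f m
  evalᴺ (e ⊖ f)  m = evalᴺ e m ∸ evalᴺ f m
  evalᴺ (e ⊗ f)  m = evalᴺ e m * evalᴺ f m

  evalᵂ : WeightExp → Memory → Carrier
  evalᵂ zeroʷ    m = 0#
  evalᵂ (at a e) m = weight m a (evalᴺ e m)
  evalᵂ (e ⊕ f)  m = evalᵂ e m +ᶠ evalᵂ f m
  evalᵂ (e ⊖ f)  m = evalᵂ e m -ᶠ evalᵂ f m
  evalᵂ (e ⊗ f)  m = evalᵂ e m *ᶠ evalᵂ f m
  evalᵂ (e ⊘ f)  m = evalᵂ e m /ᶠ evalᵂ f m

  evalᵗ : Test → Memory → Bool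
  evalᵗ (e ≤ᴺ f)   m = does (evalᴺ e m ≤? evalᴺ f m)
  evalᵗ (e ≡ᴺ f)   m = does (evalᴺ e m ≟ evalᴺ f m)
  evalᵗ (e ≤ᵂ f)   m = does (evalᵂ e m ≤ᶠ? evalᵂ f m)
  evalᵗ (notᵗ b)   m = not (evalᵗ b m)
  evalᵗ (b andᵗ c) m = evalᵗ b m ∧ evalᵗ c m

  infix 3 _/_⇓_[_]

  -- c / m ⇓ m′ [ t ]: started on m, c halts with memory m′ after t time units.
  data _/_⇓_[_] : Com → Memory → Memory → ℕ → Set c where
    skip : ∀ {m} → skip / m ⇓ m [ 1 ]
    assignᴺ : ∀ {m a i e} →
      a ⟨ i ⟩≔ᴺ e / m
        ⇓ record m { nat = write (nat m) a (evalᴺ i m) (evalᴺ e m) }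
        [ 1 + costᴺ i + costᴺ e ]
    assignᵂ : ∀ {m a i e} →
      a ⟨ i ⟩≔ᵂ e / m
        ⇓ record m { weight = write (weight m) a (evalᴺ i m) (evalᵂ e m) }
        [ 1 + costᴺ i + costᵂ e ]
    seq : ∀ {p q m₀ m₁ m₂ t u} →
      p / m₀ ⇓ m₁ [ t ] → q / m₁ ⇓ m₂ [ u ] →
      p ⨾ q / m₀ ⇓ m₂ [ t + u ]
    if-true : ∀ {b p q m m′ t} →
      evalᵗ b m ≡ true → p / m ⇓ m′ [ t ] →
      if b p q / m ⇓ m′ [ 1 + costᵗ b + t ]
    if-false : ∀ {b p q m m′ t} →
      evalᵗ b m ≡ false → q / m ⇓ m′ [ t ] →
      if b p q / m ⇓ m′ [ 1 + costᵗ b + t ]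
    while-true : ∀ {b p m₀ m₁ m₂ t u} →
      evalᵗ b m₀ ≡ true → p / m₀ ⇓ m₁ [ t ] → while b p / m₁ ⇓ m₂ [ u ] →
      while b p / m₀ ⇓ m₂ [ 1 + costᵗ b + (t + u) ]
    while-false : ∀ {b p m} →
      evalᵗ b m ≡ false →
      while b p / m ⇓ m [ 1 + costᵗ b ]

------------------------------------------------------------------------

module MRSD {c ℓ} (𝔽 : OrderedField c ℓ) where
  open OrderedField 𝔽
  open RAM 𝔽

  IsLeast IsGreatest : (Carrier → Set c) → Carrier → Set (c ⊔ˡ ℓ)
  IsLeast    A x = A x × (∀ y → A y → x ≤ᶠ y)
  IsGreatest A x = A x × (∀ y → A y → y ≤ᶠ x)

  record WeightedCompleteGraph (n : ℕ) : Set (c ⊔ˡ ℓ) where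
    field
      d     : Fin n → Fin n → Carrier
      d-sym : ∀ u v → d u v ≡ d v u
      d-uu  : ∀ u → d u u ≡ 0#
      d-pos : ∀ {u v} → u ≢ v → 0# <ᶠ d u v

  open WeightedCompleteGraph

  TriangleInequality : ∀ {n} → WeightedCompleteGraph n → Set ℓ
  TriangleInequality G = ∀ u v w → d G u v ≤ᶠ d G u w +ᶠ d G v w

  -- An undirected edge {u , v} is written (u , v) with u < v.
  Edge : ℕ → Set
  Edge n = Fin n × Fin n

  Adjacent : ∀ {n} → List (Edge n) → Rel (Fin n) 0ℓ
  Adjacent T u v = (u , v) ∈ᴸ T ⊎ (v , u) ∈ᴸ T

  -- v ∷ vs ∷ʳ v is the closed walk along a cycle of length ≥ 3.
  Acyclic : ∀ {n} → List (Edge n) → Set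
  Acyclic T = ∀ v vs → Linked (Adjacent T) (v ∷ vs ∷ʳ v) → Unique (v ∷ vs) →
              ¬ (2 ≤ length vs)

  record IsSpanningTree {n} (T : List (Edge n)) : Set where
    field
      oriented  : All (uncurry Fin._<_) T
      distinct  : Unique T
      connected : ∀ u v → Star (Adjacent T) u v
      acyclic   : Acyclic T

  -- V is partitioned into the classes of a map to Fin k; every class of a map
  -- occurring below is non-empty because it contains its centre.
  Partition : ℕ → ℕ → Set
  Partition n k = Fin n → Fin k

  -- G′: the vertices of G′ are represented by elements of V, and home v is the
  -- vertex of G′ into which v has been merged.  The weights w are meaningful
  -- between vertices of G′ only.
  record Contraction (n : ℕ) : Set c where
    field
      verts : Subset n
      home  : Fin n → Fin n
      w     : Fin n → Fin n → Carrier

  open Contraction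

  uncontracted : ∀ {n} → WeightedCompleteGraph n → Contraction n
  uncontracted G = record { verts = ⊤ ; home = id ; w = d G }

  -- The supervertex replacing u and v is again called u.
  merge : ∀ {n} → Fin n → Fin n → Contraction n → Contraction n
  merge {n} u v H = record { verts = verts H - v ; home = home′ ; w = w′ }
    where
    home′ : Fin n → Fin n
    home′ x with home H x Fin.≟ v
    ... | yes _ = u
    ... | no  _ = home H x

    w′ : Fin n → Fin n → Carrier
    w′ x y with x Fin.≟ u | y Fin.≟ u
    ... | yes _ | yes _ = 0#
    ... | yes _ | no  _ = w H u y ⊔ᶠ w H v y
    ... | no  _ | yes _ = w H x u ⊔ᶠ w H x v
    ... | no  _ | no  _ = w H x y

  -- Step (1).  Vec lists the centres latest first.
  module _ {n} (H : Contraction n) where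

    DistanceTo : ∀ {j} → Vec (Fin n) j → Fin n → Carrier → Set (c ⊔ˡ ℓ)
    DistanceTo S p = IsLeast (λ x → ∃[ q ] q ∈ⱽ S × x ≡ w H p q)

    data FarthestFirst : ∀ {j} → Vec (Fin n) j → Set (c ⊔ˡ ℓ) where
      start : ∀ {v} → v ∈ verts H → FarthestFirst (v ∷ [])
      add   : ∀ {j} {S : Vec (Fin n) j} {p x} → FarthestFirst S →
              p ∈ verts H → p ∉ⱽ S → DistanceTo S p x →
              (∀ q y → q ∈ verts H → q ∉ⱽ S → DistanceTo S q y → y ≤ᶠ x) →
              FarthestFirst (p ∷ S)

  -- Step (2).  Only the values of a at vertices of G′ matter.
  record NearestAssignment {n k} (H : Contraction n) (S : Vec (Fin n) k)
                           (a : Fin n → Fin k) : Set ℓ where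
    field
      centre  : ∀ j → a (lookup S j) ≡ j
      nearest : ∀ v → v ∈ verts H → ∀ j →
                w H v (lookup S (a v)) ≤ᶠ w H v (lookup S j)

  -- The algorithm on a fixed input.
  module Algorithm {n : ℕ} (k : ℕ) (G : WeightedCompleteGraph n) where

    length-of : Edge n → Carrier
    length-of (u , v) = d G u v

    total : List (Edge n) → Carrier
    total = foldr (λ e x → length-of e +ᶠ x) 0#

    IsMinimumSpanningTree : List (Edge n) → Set ℓ
    IsMinimumSpanningTree T =
      IsSpanningTree T × (∀ T′ → IsSpanningTree T′ → total T ≤ᶠ total T′)

    module _ (P : Partition n k) where

      IsClusterSplit IsClusterDiameter : Fin k → Carrier → Set (c ⊔ˡ ℓ)
      IsClusterSplit i =
        IsLeast (λ x → ∃[ p ] ∃[ q ] P p ≡ i × P q ≢ i × x ≡ d G p q)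
      IsClusterDiameter i =
        IsGreatest (λ x → ∃[ p ] ∃[ q ] P p ≡ i × P q ≡ i × x ≡ d G p q)

    IsSplit IsDiameter : Partition n k → Carrier → Set (c ⊔ˡ ℓ)
    IsSplit P s =
      (∃[ i ] IsClusterSplit P i s) ×
      (∀ i x → IsClusterSplit P i x → s ≤ᶠ x)
    IsDiameter P δ =
      (∃[ i ] IsClusterDiameter P i δ) ×
      (∀ i x → IsClusterDiameter P i x → x ≤ᶠ δ)

    ratio : Carrier → Carrier → Carrier ⁺
    ratio s δ with δ ≟ᶠ 0#
    ... | yes _ = ⊤⁺
    ... | no  _ = [ s /ᶠ δ ]

    record State : Set c where
      constructor ⟪_,_,_,_⟫
      field
        G′       : Contraction n
        L        : List (Edge n)
        cost     : Carrier ⁺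
        solution : Maybe (Partition n k)

    open State

    Long : List (Edge n) → Set
    Long L = k ∸ 1 ≤ length L

    -- Step (4).
    data Contract (s : Carrier) : Contraction n → List (Edge n) →
                                  Contraction n → List (Edge n) → Set (c ⊔ˡ ℓ) where
      short : ∀ {H L} → ¬ Long L → Contract s H L H L
      heavy : ∀ {H e L} → Long (e ∷ L) → ¬ (length-of e ≤ᶠ s) →
              Contract s H (e ∷ L) H (e ∷ L)
      step  : ∀ {H p q L H′ L′} → Long ((p , q) ∷ L) → d G p q ≤ᶠ s →
              Contract s (merge (home H p) (home H q) H) L H′ L′ →
              Contract s H ((p , q) ∷ L) H′ L′

    -- The control points of the algorithm.
    data Config : Set c where
      input     : Config
      loop      : State → Config
      body      : State → Config
      selected  : State → Vec (Fin n) k → Config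
      assigned  : State → Partition n k → Config
      evaluated : State → (s : Carrier) → Config
      output    : Maybe (Partition n k) → Config

    infix 3 _⟶_

    -- One constructor per way of performing a high-level step; every choice
    -- the algorithm leaves open is left open here.
    data _⟶_ : Config → Config → Set (c ⊔ˡ ℓ) where
      initialise : ∀ {T L} → IsMinimumSpanningTree T → L ↭ T →
        Linked (λ e f → length-of e ≤ᶠ length-of f) L →
        input ⟶ loop ⟪ uncontracted G , L , [ 0# ] , nothing ⟫
      enter : ∀ {σ} → Long (L σ) → loop σ ⟶ body σ
      exit  : ∀ {σ} → ¬ Long (L σ) → loop σ ⟶ output (solution σ)
      select : ∀ {σ S} → FarthestFirst (G′ σ) S → body σ ⟶ selected σ S
      assign : ∀ {σ S a} → NearestAssignment (G′ σ) S a →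
        selected σ S ⟶ assigned σ (a ∘ home (G′ σ))
      improve : ∀ {σ P s δ} → IsSplit P s → IsDiameter P δ →
        cost σ <⁺ ratio s δ →
        assigned σ P ⟶
          evaluated (record σ { cost = ratio s δ ; solution = just P }) s
      keep : ∀ {σ P s δ} → IsSplit P s → IsDiameter P δ →
        ¬ (cost σ <⁺ ratio s δ) →
        assigned σ P ⟶ evaluated σ s
      contract : ∀ {σ s H L′} → Contract s (G′ σ) (L σ) H L′ →
        evaluated σ s ⟶ loop (record σ { G′ = H ; L = L′ })

    -- How the variables of the algorithm are laid out in memory.  A cost of +∞
    -- and the presence of a solution are flagged in cells 4 and 5 of natural
    -- array 0.  Cells not mentioned, including in the input, may contain
    -- anything.
    record HoldsInput (m : Memory) : Set c where
      field
        n-cell : nat m 0 0 ≡ n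
        k-cell : nat m 0 1 ≡ k
        d-cell : ∀ u v → weight m 0 (toℕ u * n + toℕ v) ≡ d G u v

    record HoldsContraction (H : Contraction n) (m : Memory) : Set c where
      field
        alive : ∀ v → v ∈ verts H → nat m 1 (toℕ v) ≡ 1
        dead  : ∀ v → v ∉ verts H → nat m 1 (toℕ v) ≡ 0
        homes : ∀ v → nat m 2 (toℕ v) ≡ toℕ (home H v)
        dists : ∀ u v → u ∈ verts H → v ∈ verts H →
                weight m 1 (toℕ u * n + toℕ v) ≡ w H u v

    -- Natural arrays 3 and 4 hold the end points of a sorted list of edges, of
    -- which the first (cell 2 of array 0) have already been removed.
    record HoldsEdges (L : List (Edge n)) (m : Memory) : Set where
      field
        size  : nat m 0 3 ≡ length L
        ends₁ : ∀ i → nat m 3 (nat m 0 2 + toℕ i) ≡ toℕ (proj₁ (List.lookup L i))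
        ends₂ : ∀ i → nat m 4 (nat m 0 2 + toℕ i) ≡ toℕ (proj₂ (List.lookup L i))

    HoldsCost : Carrier ⁺ → Memory → Set c
    HoldsCost [ x ] m = nat m 0 4 ≡ 0 × weight m 2 2 ≡ x
    HoldsCost ⊤⁺    m = Lift c (nat m 0 4 ≡ 1)

    HoldsPartition : (array : ℕ) → Partition n k → Memory → Set
    HoldsPartition a P m = ∀ v → nat m a (toℕ v) ≡ toℕ (P v)

    HoldsSolution : Maybe (Partition n k) → Memory → Set
    HoldsSolution nothing  m = nat m 0 5 ≡ 0
    HoldsSolution (just P) m = nat m 0 5 ≡ 1 × HoldsPartition 7 P m

    record HoldsState (σ : State) (m : Memory) : Set c where
      field
        inputs      : HoldsInput m
        contraction : HoldsContraction (G′ σ) m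
        edges       : HoldsEdges (L σ) m
        costs       : HoldsCost (cost σ) m
        solutions   : HoldsSolution (solution σ) m

    Holds : Config → Memory → Set c
    Holds input           m = HoldsInput m
    Holds (loop σ)        m = HoldsState σ m
    Holds (body σ)        m = HoldsState σ m
    Holds (selected σ S)  m =
      HoldsState σ m × (∀ j → nat m 5 (toℕ j) ≡ toℕ (lookup S j))
    Holds (assigned σ P)  m = HoldsState σ m × HoldsPartition 6 P m
    Holds (evaluated σ s) m = HoldsState σ m × weight m 2 1 ≡ s
    Holds (output P)      m = Lift c (HoldsSolution P m)

    module _ (I : Implementation) where
      private module I = Implementation I

      -- Executing the code of I belonging to a control point: it turns memory
      -- m into m′ in t time units and leads to the control point of γ′.
      data Execute : Config → Memory → Config → Memory → ℕ → Set c where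
        initialise : ∀ {m σ m′ t} → I.initialise / m ⇓ m′ [ t ] →
          Execute input m (loop σ) m′ t
        enter : ∀ {σ m} → evalᵗ I.continue m ≡ true →
          Execute (loop σ) m (body σ) m (1 + costᵗ I.continue)
        exit : ∀ {σ P m} → evalᵗ I.continue m ≡ false →
          Execute (loop σ) m (output P) m (1 + costᵗ I.continue)
        select : ∀ {σ S m m′ t} → I.select / m ⇓ m′ [ t ] →
          Execute (body σ) m (selected σ S) m′ t
        assign : ∀ {σ S P m m′ t} → I.assign / m ⇓ m′ [ t ] →
          Execute (selected σ S) m (assigned σ P) m′ t
        evaluate : ∀ {σ σ′ P s m m′ t} → I.evaluate / m ⇓ m′ [ t ] →
          Execute (assigned σ P) m (evaluated σ′ s) m′ t
        contract : ∀ {σ σ′ s m m′ t} → I.contract / m ⇓ m′ [ t ] →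
          Execute (evaluated σ s) m (loop σ′) m′ t

      -- In every memory holding γ, the code of I carries out a step of the
      -- algorithm from γ within t time units.
      StepWithin : Config → ℕ → Set (c ⊔ˡ ℓ)
      StepWithin γ t =
        ∀ m → Holds γ m →
        ∃[ γ′ ] ∃[ m′ ] ∃[ u ]
          (γ ⟶ γ′) × Execute γ m γ′ m′ u × Holds γ′ m′ × u ≤ t

      -- The worst-case cost of completing the algorithm from γ is at most b.
      -- All successors of γ are considered, not only the one chosen by I, so
      -- the bound does not depend on how choices are resolved.
      data CompletesWithin : Config → ℕ → Set (c ⊔ˡ ℓ) where
        done : ∀ {P b} → CompletesWithin (output P) b
        next : ∀ {γ t b b′} → StepWithin γ t →
               (∀ γ′ → γ ⟶ γ′ → CompletesWithin γ′ b) →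
               t + b ≤ b′ → CompletesWithin γ b′

      record RunsWithin (b : ℕ) : Set (c ⊔ˡ ℓ) where
        field
          steps : CompletesWithin input b
          whole : ∀ m → HoldsInput m →
                  ∃[ P ] ∃[ m′ ] ∃[ t ]
                    Star _⟶_ input (output P) ×
                    (I.program / m ⇓ m′ [ t ]) ×
                    HoldsSolution P m′ × t ≤ b

{-# OPTIONS --safe #-}
module Submission where

-- Every iteration contracts at least one edge of the minimum spanning tree T,
-- so there are fewer than n of them, and each takes O(n²) time.  Indeed the
-- vertices of G′ are the components of the forest of contracted edges.  The
-- split of P is the weight of an edge pq of G joining two of these components,
-- and the path of T from p to q contains an edge e, not yet contracted, whose
-- removal separates p from q.  Exchanging e for pq gives a spanning tree, so
-- d(e) ≤ d(p,q) = s(P) by minimality, and the first edge of L is no heavier.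
--
-- T itself is found in O(n³) time by rounds of Kruskal's algorithm that each
-- scan all pairs, which also yields its edges in ascending order.  All code
-- consists of loops over 0, …, n − 1, so its running time is read off the
-- nesting depth.

open import Defs
import Algebra.Construct.NaturalChoice.Max as Max
open import Algebra.Structures using (IsCommutativeRing)
open import Data.Bool using (Bool; true; false; not; _∧_; if_then_else_)
import Data.Bool.Properties as Boolₚ
open import Data.Empty using (⊥; ⊥-elim)
open import Data.Fin as Fin using (Fin; toℕ; fromℕ<)
import Data.Fin.Properties as Finₚ
open import Data.Fin.Subset as Subset using (Subset; ∣_∣; _-_) renaming (_∈_ to _∈ˢ_; _∉_ to _∉ˢ_)
import Data.Fin.Subset.Properties as Subsetₚ
open import Data.List as List using (List; []; _∷_; _++_; _∷ʳ_; length)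
import Data.List.Properties as Listₚ
open import Data.List.Membership.Propositional using (_∈_)
open import Data.List.Membership.Propositional.Properties using (∈-∃++; ∈-++⁺ʳ)
open import Data.List.Relation.Binary.Permutation.Propositional as ↭
  using (_↭_; ↭-refl; ↭-sym; ↭-trans; prep; swap)
import Data.List.Relation.Binary.Permutation.Propositional.Properties as ↭ₚ
open import Data.List.Relation.Unary.All as All using (All; []; _∷_)
import Data.List.Relation.Unary.All.Properties as Allₚ
open import Data.List.Relation.Unary.AllPairs as AllPairs using ([]; _∷_)
open import Data.List.Relation.Unary.Any as Any using (here; there)
open import Data.List.Relation.Unary.Linked as Linked using (Linked; []; [-]; _∷_)
import Data.List.Relation.Unary.Linked.Properties as Linkedₚ
open import Data.List.Relation.Unary.Unique.Propositional using (Unique)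
open import Data.Maybe using (just; nothing)
open import Data.Nat as ℕ
  using (ℕ; zero; suc; _+_; _*_; _∸_; _^_; _⊔_; _≤_; _<_; z≤n; s≤s; _≤?_; _≟_; NonZero)
import Data.Nat.Properties as ℕₚ
open import Data.Nat.Tactic.RingSolver using (solve-∀)
open import Data.Product using (∃-syntax; _×_; _,_; proj₁; proj₂; uncurry)
open import Data.Sum using (_⊎_; inj₁; inj₂; [_,_]′)
open import Data.Unit.Polymorphic using (⊤; tt)
open import Data.Vec using (Vec; []; _∷_; lookup; here; there)
open import Data.Vec.Membership.Propositional using () renaming (_∈_ to _∈ⱽ_; _∉_ to _∉ⱽ_)
open import Data.Vec.Membership.Propositional.Properties using (∈-lookup)
open import Data.Vec.Relation.Unary.Any using (here; there)
open import Function using (_∘_; id)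
open import Level using (lift) renaming (_⊔_ to _⊔ˡ_)
open import Relation.Binary.Bundles using (DecTotalOrder)
open import Relation.Binary.Construct.Add.Supremum.Strict using ([_]; [_]<⊤⁺)
open import Relation.Binary.Construct.Closure.ReflexiveTransitive using (Star; ε; _◅_; _◅◅_)
open import Relation.Binary.Definitions using (tri<; tri≈; tri>)
open import Relation.Binary.PropositionalEquality
open import Relation.Binary.Structures using (IsDecTotalOrder)
open import Relation.Nullary
open import Relation.Nullary.Construct.Add.Supremum using (⊤⁺; [_])
open import Relation.Nullary.Decidable using (dec-true; dec-false; decidable-stable; ¬?; _×-dec_)

-- The bound is demanded for every resolution of the algorithm's choices, among them the tree and
-- the order of its edges. The argument for progress is therefore an invariant of the step relation,
-- `Consistent`, that does not mention the code; the code is shown separately to perform some step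
-- from each state satisfying it. Acyclicity is specified through closed walks, whereas the exchange
-- arguments rest on a connectedness relation defined by recursion on the edge list. Two
-- translations link the notions: `NoCycle⇒Forest` for trees that are given, `Forest⇒NoCycle` for
-- trees built by exchange or by Kruskal's algorithm. Quadratic time per iteration takes two
-- savings. Step (1) keeps, for each vertex, its distance to the centres chosen so far instead of
-- minimising over them anew. Step (4) spends linear time on a merge, and fewer than n merges are
-- possible.

-- Cardinalities of finite subsets

∣p-x∣ : ∀ {m} {p : Subset m} {x} → x ∈ˢ p → suc ∣ p - x ∣ ≡ ∣ p ∣
∣p-x∣ {p = _ ∷ p} here = cong (suc ∘ ∣_∣) (Subsetₚ.p─⊥≡p p)
∣p-x∣ {p = Subset.inside ∷ p} (there x∈p) = cong suc (∣p-x∣ x∈p)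
∣p-x∣ {p = Subset.outside ∷ p} (there x∈p) = ∣p-x∣ x∈p

∈⇒0<∣∣ : ∀ {m} {p : Subset m} {x} → x ∈ˢ p → 0 < ∣ p ∣
∈⇒0<∣∣ x∈p = ℕₚ.≤-trans (s≤s z≤n) (ℕₚ.≤-reflexive (∣p-x∣ x∈p))

x∉p-x : ∀ {m} (p : Subset m) x → x ∉ˢ p - x
x∉p-x (Subset.outside ∷ p) Fin.zero ()
x∉p-x (Subset.inside ∷ p) Fin.zero ()
x∉p-x (s ∷ p) (Fin.suc x) (there x∈) = x∉p-x p x x∈

∣p∣≤1+∣p-x∣ : ∀ {m} (p : Subset m) x → ∣ p ∣ ≤ suc ∣ p - x ∣
∣p∣≤1+∣p-x∣ (Subset.outside ∷ p) Fin.zero = ℕₚ.m≤n⇒m≤1+n (ℕₚ.≤-reflexive (sym (cong ∣_∣ (Subsetₚ.p─⊥≡p p))))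
∣p∣≤1+∣p-x∣ (Subset.inside ∷ p)  Fin.zero = s≤s (ℕₚ.≤-reflexive (sym (cong ∣_∣ (Subsetₚ.p─⊥≡p p))))
∣p∣≤1+∣p-x∣ (Subset.outside ∷ p) (Fin.suc x) = ∣p∣≤1+∣p-x∣ p x
∣p∣≤1+∣p-x∣ (Subset.inside ∷ p)  (Fin.suc x) = s≤s (∣p∣≤1+∣p-x∣ p x)

0<∣p∣⇒∃ : ∀ {m} (p : Subset m) → 0 < ∣ p ∣ → ∃[ x ] x ∈ˢ p
0<∣p∣⇒∃ (Subset.inside ∷ p)  _  = Fin.zero , here
0<∣p∣⇒∃ (Subset.outside ∷ p) lt with 0<∣p∣⇒∃ p lt
... | x , x∈p = Fin.suc x , there x∈p

-- Pigeonhole: deleting the entries of `S` from `p` one after the other loses at most one element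
-- each time.
∃-outside : ∀ {m t} (S : Vec (Fin m) t) (p : Subset m) → t < ∣ p ∣ → ∃[ x ] x ∈ˢ p × x ∉ⱽ S
∃-outside []      p lt with 0<∣p∣⇒∃ p lt
... | x , x∈p = x , x∈p , λ ()
∃-outside (y ∷ S) p lt with ∃-outside S (p - y) (ℕₚ.≤-pred (ℕₚ.≤-trans lt (∣p∣≤1+∣p-x∣ p y)))
... | x , x∈ , x∉S = x , Subsetₚ.p─q⊆p p _ x∈ , λ
  { (here refl) → x∉p-x p y x∈
  ; (there x∈S) → x∉S x∈S }

-- Forests

module Forests {n : ℕ} where

  Edges : Set
  Edges = List (Fin n × Fin n)

  -- Connectedness, by recursion on the edges so that it is decidable.
  Conn : Edges → Fin n → Fin n → Set
  Conn []            x y = x ≡ y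
  Conn ((a , b) ∷ R) x y =
    Conn R x y ⊎ (Conn R x a × Conn R b y) ⊎ (Conn R x b × Conn R a y)

  Conn? : ∀ R x y → Dec (Conn R x y)
  Conn? []            x y = x Fin.≟ y
  Conn? ((a , b) ∷ R) x y =
    Conn? R x y ⊎-dec (Conn? R x a ×-dec Conn? R b y) ⊎-dec (Conn? R x b ×-dec Conn? R a y)

  Conn-refl : ∀ R {x} → Conn R x x
  Conn-refl []      = refl
  Conn-refl (_ ∷ R) = inj₁ (Conn-refl R)

  Conn-sym : ∀ R {x y} → Conn R x y → Conn R y x
  Conn-sym []      p                     = sym p
  Conn-sym (_ ∷ R) (inj₁ p)              = inj₁ (Conn-sym R p)
  Conn-sym (_ ∷ R) (inj₂ (inj₁ (p , q))) = inj₂ (inj₂ (Conn-sym R q , Conn-sym R p))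
  Conn-sym (_ ∷ R) (inj₂ (inj₂ (p , q))) = inj₂ (inj₁ (Conn-sym R q , Conn-sym R p))

  Conn-trans : ∀ R {x y z} → Conn R x y → Conn R y z → Conn R x z
  Conn-trans []      p        q        = trans p q
  Conn-trans (_ ∷ R) (inj₁ p) (inj₁ q) = inj₁ (Conn-trans R p q)
  Conn-trans (_ ∷ R) (inj₁ p) (inj₂ (inj₁ (q , r))) = inj₂ (inj₁ (Conn-trans R p q , r))
  Conn-trans (_ ∷ R) (inj₁ p) (inj₂ (inj₂ (q , r))) = inj₂ (inj₂ (Conn-trans R p q , r))
  Conn-trans (_ ∷ R) (inj₂ (inj₁ (p , q))) (inj₁ r) = inj₂ (inj₁ (p , Conn-trans R q r))
  Conn-trans (_ ∷ R) (inj₂ (inj₂ (p , q))) (inj₁ r) = inj₂ (inj₂ (p , Conn-trans R q r))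
  -- Both connections cross the new edge. Two crossings in the same direction are shortened to one
  -- by dropping the part between them; two in opposite directions cancel.
  Conn-trans (_ ∷ R) (inj₂ (inj₁ (p , _))) (inj₂ (inj₁ (_ , r))) = inj₂ (inj₁ (p , r))
  Conn-trans (_ ∷ R) (inj₂ (inj₁ (p , _))) (inj₂ (inj₂ (_ , r))) = inj₁ (Conn-trans R p r)
  Conn-trans (_ ∷ R) (inj₂ (inj₂ (p , _))) (inj₂ (inj₁ (_ , r))) = inj₁ (Conn-trans R p r)
  Conn-trans (_ ∷ R) (inj₂ (inj₂ (p , _))) (inj₂ (inj₂ (_ , r))) = inj₂ (inj₂ (p , r))

  Conn-here : ∀ {a b} R → Conn ((a , b) ∷ R) a b
  Conn-here R = inj₂ (inj₁ (Conn-refl R , Conn-refl R))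

  Conn-∈ : ∀ {R a b} → (a , b) ∈ R → Conn R a b
  Conn-∈ {R = _ ∷ R} (here refl) = Conn-here R
  Conn-∈             (there e∈R) = inj₁ (Conn-∈ e∈R)

  -- The edges of `R` need only be connected in `R′`, not belong to it, so that a single edge can be
  -- replaced by a detour, as the exchange arguments require.
  Conn-mono : ∀ R {R′} → (∀ {a b} → (a , b) ∈ R → Conn R′ a b) →
              ∀ {x y} → Conn R x y → Conn R′ x y
  Conn-mono []      {R′} _ refl     = Conn-refl R′
  Conn-mono (_ ∷ R) f (inj₁ p) = Conn-mono R (f ∘ there) p
  Conn-mono (_ ∷ R) {R′} f (inj₂ (inj₁ (p , q))) =
    Conn-trans R′ (Conn-mono R (f ∘ there) p)
      (Conn-trans R′ (f (here refl)) (Conn-mono R (f ∘ there) q))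
  Conn-mono (_ ∷ R) {R′} f (inj₂ (inj₂ (p , q))) =
    Conn-trans R′ (Conn-mono R (f ∘ there) p)
      (Conn-trans R′ (Conn-sym R′ (f (here refl))) (Conn-mono R (f ∘ there) q))

  Conn-⊆ : ∀ {R R′} → (∀ {e} → e ∈ R → e ∈ R′) → ∀ {x y} → Conn R x y → Conn R′ x y
  Conn-⊆ {R} R⊆R′ = Conn-mono R (Conn-∈ ∘ R⊆R′)

  Conn-↭ : ∀ {R R′} → R ↭ R′ → ∀ {x y} → Conn R x y → Conn R′ x y
  Conn-↭ R↭R′ = Conn-⊆ (↭ₚ.∈-resp-↭ R↭R′)

  -- A connection of `p` and `q` that `B` alone does not provide crosses the edge `f₁ f₂`. Its two
  -- remaining pieces, joined by the edge `p q`, connect `f₁` and `f₂`.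
  Conn-swap : ∀ B {f₁ f₂ p q} → ¬ Conn B p q →
              Conn ((f₁ , f₂) ∷ B) p q → Conn ((p , q) ∷ B) f₁ f₂
  Conn-swap B ¬pq (inj₁ pq) = contradiction pq ¬pq
  Conn-swap B ¬pq (inj₂ (inj₁ (p~f₁ , f₂~q))) =
    inj₂ (inj₁ (Conn-sym B p~f₁ , Conn-sym B f₂~q))
  Conn-swap B ¬pq (inj₂ (inj₂ (p~f₂ , f₁~q))) = inj₂ (inj₂ (f₁~q , p~f₂))

  -- Acyclicity as Kruskal's algorithm tests it, without mention of cycles. It refers to the order
  -- of the edges, but does not depend on it by `Forest-↭`.
  Forest : Edges → Set
  Forest []            = ⊤
  Forest ((a , b) ∷ R) = ¬ Conn R a b × Forest R

  -- Only the exchange of two neighbours has content. If the edge moved to the front were redundant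
  -- given the other one, `Conn-swap` would make that other one redundant in the original order.
  Forest-↭ : ∀ {R R′} → R ↭ R′ → Forest R → Forest R′
  Forest-↭ ↭.refl         f        = f
  Forest-↭ (prep _ π)     (¬c , f) = ¬c ∘ Conn-↭ (↭-sym π) , Forest-↭ π f
  Forest-↭ {R = _ ∷ _ ∷ R} {R′ = _ ∷ _ ∷ R′} (swap _ _ π) (¬c , ¬d , f) =
      (λ d → ¬c (Conn-swap R ¬d (Conn-↭ (prep _ (↭-sym π)) d)))
    , ¬c ∘ inj₁ ∘ Conn-↭ (↭-sym π)
    , Forest-↭ π f
  Forest-↭ (↭.trans π ρ)  f        = Forest-↭ ρ (Forest-↭ π f)

  Spanning : Edges → Set
  Spanning T = Forest T × (∀ x y → Conn T x y)

  Spanning-↭ : ∀ {R R′} → R ↭ R′ → Spanning R → Spanning R′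
  Spanning-↭ π (f , c) = Forest-↭ π f , λ x y → Conn-↭ π (c x y)

  Spanning-swap : ∀ {f₁ f₂ p q B} → Spanning ((f₁ , f₂) ∷ B) → ¬ Conn B p q →
                  Spanning ((p , q) ∷ B)
  Spanning-swap {B = B} ((_ , forest) , conn) ¬pq =
      (¬pq , forest)
    , λ x y → Conn-mono _ (λ { (here refl) → Conn-swap B ¬pq (conn _ _)
                             ; (there e∈B) → inj₁ (Conn-∈ e∈B) }) (conn x y)

  -- If `p` and `q` fall apart without `r`, then `r` is the edge. Otherwise the edge `f` found in
  -- the rest still works: if `r` restored the connection once `f` is gone, `Conn-swap` would
  -- connect the ends of `r` through `p q`, and replacing `p q` by its connection avoiding `r` would
  -- make `r` close a cycle.
  cut-edge : ∀ R F {p q} → Forest (R ++ F) → Conn (R ++ F) p q → ¬ Conn F p q →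
             ∃[ f ] ∃[ R′ ] R ↭ f ∷ R′ × ¬ Conn (R′ ++ F) p q
  cut-edge []      F _ pq ¬pq = contradiction pq ¬pq
  cut-edge (r ∷ R) F {p} {q} (¬r , forest) pq ¬pq with Conn? (R ++ F) p q
  ... | no  ¬pq′ = r , R , ↭-refl , ¬pq′
  ... | yes pq′  with cut-edge R F forest pq′ ¬pq
  ...   | f , R′ , π , ¬c =
    f , r ∷ R′ , ↭-trans (prep r π) (swap r f ↭-refl) , λ c →
      ¬r (Conn-↭ (↭-sym π′)
        (Conn-mono _ (λ { (here refl) → Conn-↭ π′ pq′
                        ; (there e∈) → Conn-∈ (there e∈) })
          (Conn-swap (R′ ++ F) ¬c c)))
    where
    π′ : R ++ F ↭ f ∷ R′ ++ F
    π′ = ↭ₚ.++⁺ʳ F π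

  -- The edge given up is taken from `R`, never from `F`. In `cheapest` the protected edges are
  -- those already contracted, in `Promising-step` those already chosen by Kruskal's algorithm.
  exchange : ∀ R F {p q} → Spanning (R ++ F) → ¬ Conn F p q →
             ∃[ f ] ∃[ R′ ] R ↭ f ∷ R′ × Spanning ((p , q) ∷ R′ ++ F)
  exchange R F {p} {q} (forest , conn) ¬pq
    with cut-edge R F forest (conn p q) ¬pq
  ... | f , R′ , π , ¬c =
    f , R′ , π , Spanning-swap (Spanning-↭ (↭ₚ.++⁺ʳ F π) (forest , conn)) ¬c

  Forest-Unique : ∀ R → Forest R → Unique R
  Forest-Unique []      _        = []
  Forest-Unique (_ ∷ R) (¬c , f) =
    Allₚ.¬Any⇒All¬ R (¬c ∘ Conn-∈) ∷ Forest-Unique R f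

  Adj : Edges → Fin n → Fin n → Set
  Adj T u v = (u , v) ∈ T ⊎ (v , u) ∈ T

  Adj⇒Conn : ∀ {R x y} → Adj R x y → Conn R x y
  Adj⇒Conn     (inj₁ e) = Conn-∈ e
  Adj⇒Conn {R} (inj₂ e) = Conn-sym R (Conn-∈ e)

  Star⇒Conn : ∀ R {x y} → Star (Adj R) x y → Conn R x y
  Star⇒Conn R ε       = Conn-refl R
  Star⇒Conn R (e ◅ p) = Conn-trans R (Adj⇒Conn e) (Star⇒Conn R p)

  data Path (R : Edges) : Fin n → List (Fin n) → Fin n → Set where
    stop : ∀ {x} → Path R x [] x
    step : ∀ {x y z ws} → Adj R x y → Path R y ws z → Path R x (y ∷ ws) z

  SimplePath : Edges → Fin n → Fin n → Set
  SimplePath R x y = ∃[ ws ] Path R x ws y × Unique (x ∷ ws)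

  suffix : ∀ {R x y z ws} → x ∈ y ∷ ws → Path R y ws z → Unique (y ∷ ws) → SimplePath R x z
  suffix (here refl) p          u       = _ , p , u
  suffix (there x∈)  (step _ p) (_ ∷ u) = suffix x∈ p u

  -- Loop erasure: if the simplified remainder visits the start again, only the part from that visit
  -- on is kept.
  simplify : ∀ {R x y} → Star (Adj R) x y → SimplePath R x y
  simplify ε = [] , stop , [] ∷ []
  simplify {x = x} (_◅_ {j = x′} e s) with simplify s
  ... | ws , p , u with Any.any? (x Fin.≟_) (x′ ∷ ws)
  ...   | yes x∈ = suffix x∈ p u
  ...   | no  x∉ = x′ ∷ ws , step e p , Allₚ.¬Any⇒All¬ _ x∉ ∷ u

  weaken : ∀ {R e x y} → Star (Adj R) x y → Star (Adj (e ∷ R)) x y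
  weaken ε             = ε
  weaken (inj₁ e∈ ◅ s) = inj₁ (there e∈) ◅ weaken s
  weaken (inj₂ e∈ ◅ s) = inj₂ (there e∈) ◅ weaken s

  Conn⇒Star : ∀ R {x y} → Conn R x y → Star (Adj R) x y
  Conn⇒Star []      refl     = ε
  Conn⇒Star (_ ∷ R) (inj₁ p) = weaken (Conn⇒Star R p)
  Conn⇒Star (_ ∷ R) (inj₂ (inj₁ (p , q))) =
    weaken (Conn⇒Star R p) ◅◅ inj₁ (here refl) ◅ weaken (Conn⇒Star R q)
  Conn⇒Star (_ ∷ R) (inj₂ (inj₂ (p , q))) =
    weaken (Conn⇒Star R p) ◅◅ inj₂ (here refl) ◅ weaken (Conn⇒Star R q)

  NoCycle : Edges → Set
  NoCycle T = ∀ v vs → Linked (Adj T) (v ∷ vs ∷ʳ v) → Unique (v ∷ vs) → ¬ (2 ≤ length vs)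

  close : ∀ {R x y v ws} → Path R x ws y → Adj R y v → Linked (Adj R) (x ∷ ws ∷ʳ v)
  close stop       e′ = e′ ∷ [-]
  close (step e p) e′ = e ∷ close p e′

  -- A simple path in `R` between the ends of the first edge closes up to a cycle. Paths with at
  -- most one edge are too short for `NoCycle`; orientation excludes the empty path and the reversed
  -- edge, distinctness the edge itself.
  NoCycle⇒Forest : ∀ T → All (uncurry Fin._<_) T → Unique T → NoCycle T → Forest T
  NoCycle⇒Forest []            _         _         _  = tt
  NoCycle⇒Forest ((a , b) ∷ R) (a<b ∷ o) (e∉R ∷ u) nc =
      ¬conn
    , NoCycle⇒Forest R o u λ v vs l → nc v vs (Linked.map [ inj₁ ∘ there , inj₂ ∘ there ]′ l)
    where
    ¬conn : ¬ Conn R a b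
    ¬conn c with simplify (Conn⇒Star R c)
    ... | [] , stop , _ = Finₚ.<-irrefl refl a<b
    ... | _ ∷ [] , step (inj₁ e) stop , _ = All.lookup e∉R e refl
    ... | _ ∷ [] , step (inj₂ e) stop , _ = Finₚ.<-asym a<b (All.lookup o e)
    ... | ws@(_ ∷ _ ∷ _) , p , uniq =
      nc a ws (close (shiftP p) (inj₂ (here refl))) uniq (s≤s (s≤s z≤n))
      where
      shiftP : ∀ {x ws y} → Path R x ws y → Path ((a , b) ∷ R) x ws y
      shiftP stop              = stop
      shiftP (step (inj₁ e) p) = step (inj₁ (there e)) (shiftP p)
      shiftP (step (inj₂ e) p) = step (inj₂ (there e)) (shiftP p)

  -- A cycle v w x … v is cut by removing its edge vw: each of its other edges
  -- has an end point off {v , w}.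
  Forest⇒NoCycle : ∀ T → Forest T → NoCycle T
  Forest⇒NoCycle T forest v (w ∷ x ∷ us) (vw ∷ wx ∷ l)
      ((v≢w ∷ v≢x ∷ v≢us) ∷ (w≢x ∷ w≢us) ∷ _) (s≤s (s≤s z≤n)) =
    [ (λ e → cut e (inj₁ (refl , refl))) , (λ e → cut e (inj₂ (refl , refl))) ]′ vw
    where
    Off : Fin n → Set
    Off y = v ≢ y × w ≢ y

    cut : ∀ {p q} → (p , q) ∈ T → (p ≡ v × q ≡ w) ⊎ (p ≡ w × q ≡ v) → ⊥
    cut {p} {q} e pq with ∈-∃++ e
    -- With the removed edge moved to the front, `Forest` says outright that the others do not
    -- connect its ends.
    ... | ys , zs , T≡ = proj₁ (Forest-↭ π forest) (ends pq)
      where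
      R : Edges
      R = ys ++ zs

      π : T ↭ (p , q) ∷ R
      π = subst (_↭ (p , q) ∷ R) (sym T≡) (↭ₚ.shift (p , q) ys zs)

      off : ∀ {y} → Off y → y ≢ p × y ≢ q
      off (v≢y , w≢y) = [ (λ (p≡v , q≡w) → (λ e → v≢y (trans (sym p≡v) (sym e))) ,
          (λ e → w≢y (trans (sym q≡w) (sym e))))
                        , (λ (p≡w , q≡v) → (λ e → w≢y (trans (sym p≡w) (sym e))) ,
                            (λ e → v≢y (trans (sym q≡v) (sym e)))) ]′ pq

      survives : ∀ {y z} → (y , z) ∈ T → Off y ⊎ Off z → (y , z) ∈ R
      survives e o with ↭ₚ.∈-resp-↭ π e
      ... | there e∈R = e∈R
      ... | here refl = contradiction refl
        ([ (λ o → proj₁ (off o)) , (λ o → ⊥-elim (proj₂ (off o) refl)) ]′ o)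

      keep : ∀ {y z} → Adj T y z → Off y ⊎ Off z → Conn R y z
      keep (inj₁ e) o        = Conn-∈ (survives e o)
      keep (inj₂ e) (inj₁ o) = Conn-sym R (Conn-∈ (survives e (inj₂ o)))
      keep (inj₂ e) (inj₂ o) = Conn-sym R (Conn-∈ (survives e (inj₁ o)))

      walk : ∀ {y} us → Off y → All Off us → Linked (Adj T) (y ∷ us ∷ʳ v) → Conn R y v
      walk []       o _        (e ∷ _) = keep e (inj₁ o)
      walk (_ ∷ us) o (o′ ∷ os) (e ∷ l) = Conn-trans R (keep e (inj₁ o)) (walk us o′ os l)

      around : Conn R w v
      around = Conn-trans R (keep wx (inj₂ (v≢x , w≢x)))
        (walk us (v≢x , w≢x) (All.zip (v≢us , w≢us)) l)

      ends : (p ≡ v × q ≡ w) ⊎ (p ≡ w × q ≡ v) → Conn R p q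
      ends (inj₁ (p≡v , q≡w)) = subst₂ (Conn R) (sym p≡v) (sym q≡w) (Conn-sym R around)
      ends (inj₂ (p≡w , q≡v)) = subst₂ (Conn R) (sym p≡w) (sym q≡v) around
  Forest⇒NoCycle T forest v (w ∷ []) _ _ (s≤s ())
  Forest⇒NoCycle T forest v [] _ _ ()

  -- h sends each vertex to a representative, in V, of its component under R.
  record Tracks (V : Subset n) (h : Fin n → Fin n) (R : Edges) : Set where
    field
      home∈ : ∀ x → h x ∈ˢ V
      fixed : ∀ {v} → v ∈ˢ V → h v ≡ v
      same  : ∀ x y → h x ≡ h y → Conn R x y
      conn  : ∀ x y → Conn R x y → h x ≡ h y
      size  : ∣ V ∣ + length R ≡ n

  -- A relation instead of a function, since it has to be met both by the `home` of `merge` and by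
  -- the component labels of Kruskal's algorithm.
  Relabels : (u v : Fin n) (h h′ : Fin n → Fin n) → Set
  Relabels u v h h′ = ∀ x → (h x ≡ v × h′ x ≡ u) ⊎ (h x ≢ v × h′ x ≡ h x)

  relabel : (u v : Fin n) (h : Fin n → Fin n) → ∃[ h′ ] Relabels u v h h′
  relabel u v h = (λ x → proj₁ (choose x)) , λ x → proj₂ (choose x)
    where
    choose : ∀ x → ∃[ y ] ((h x ≡ v × y ≡ u) ⊎ (h x ≢ v × y ≡ h x))
    choose x with h x Fin.≟ v
    ... | yes eq = u , inj₁ (eq , refl)
    ... | no neq = h x , inj₂ (neq , refl)

  module _ {h h′ : Fin n → Fin n} {R : Edges} {p q : Fin n} (rel : Relabels (h p) (h q) h h′)
           (same : ∀ x y → h x ≡ h y → Conn R x y) (conn : ∀ x y → Conn R x y → h x ≡ h y) where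

    -- Resting on `same` and `conn` alone, this and `relabel-same` serve contractions in
    -- `Tracks-merge` and the labels of Kruskal's algorithm in `Partial-∷ʳ`, which come without a
    -- set of representatives.
    relabel-conn : ∀ x y → Conn ((p , q) ∷ R) x y → h′ x ≡ h′ y
    relabel-conn x y (inj₁ c) with conn x y c | rel x | rel y
    ... | hx≡hy | inj₁ (_ , a)  | inj₁ (_ , b)  = trans a (sym b)
    ... | hx≡hy | inj₁ (a , _)  | inj₂ (b , _)  = contradiction (trans (sym hx≡hy) a) b
    ... | hx≡hy | inj₂ (a , _)  | inj₁ (b , _)  = contradiction (trans hx≡hy b) a
    ... | hx≡hy | inj₂ (_ , a)  | inj₂ (_ , b)  = trans a (trans hx≡hy (sym b))
    relabel-conn x y (inj₂ (inj₁ (x~p , q~y))) with conn x p x~p | conn q y q~y | rel x | rel y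
    ... | hx≡hp | hq≡hy | r | inj₂ (b , _) = contradiction (sym hq≡hy) b
    ... | hx≡hp | hq≡hy | inj₁ (_ , a) | inj₁ (_ , b) = trans a (sym b)
    ... | hx≡hp | hq≡hy | inj₂ (_ , a) | inj₁ (_ , b) = trans a (trans hx≡hp (sym b))
    relabel-conn x y (inj₂ (inj₂ (x~q , p~y))) with conn x q x~q | conn p y p~y | rel x | rel y
    ... | hx≡hq | hp≡hy | inj₂ (b , _) | r = contradiction hx≡hq b
    ... | hx≡hq | hp≡hy | inj₁ (_ , a) | inj₁ (_ , b) = trans a (sym b)
    ... | hx≡hq | hp≡hy | inj₁ (_ , a) | inj₂ (_ , b) = trans a (trans hp≡hy (sym b))

    relabel-same : ∀ x y → h′ x ≡ h′ y → Conn ((p , q) ∷ R) x y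
    relabel-same x y eq with rel x | rel y
    ... | inj₁ (a , _) | inj₁ (b , _) = inj₁ (same x y (trans a (sym b)))
    ... | inj₁ (a , a′) | inj₂ (_ , b′) =
      inj₂ (inj₂ (same x q a , same p y (trans (sym a′) (trans eq b′))))
    ... | inj₂ (_ , a′) | inj₁ (b , b′) =
      inj₂ (inj₁ (same x p (trans (sym a′) (trans eq b′)) , same q y (sym b)))
    ... | inj₂ (_ , a′) | inj₂ (_ , b′) = inj₁ (same x y (trans (sym a′) (trans eq b′)))

  Tracks-start : Tracks Subset.⊤ id []
  Tracks-start = record
    { home∈ = λ _ → Subsetₚ.∈⊤
    ; fixed = λ _ → refl
    ; same  = λ _ _ → id
    ; conn  = λ _ _ → id
    ; size  = trans (ℕₚ.+-identityʳ _) (Subsetₚ.∣⊤∣≡n n)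
    }

  Tracks-merge : ∀ {V h h′ R p q} → Tracks V h R → h p ≢ h q → Relabels (h p) (h q) h h′ →
                 Tracks (V - h q) h′ ((p , q) ∷ R)
  Tracks-merge {V} {h} {h′} {R} {p} {q} tr hp≢hq rel = record
    { home∈ = home∈′
    ; fixed = fixed′
    ; same  = relabel-same rel same conn
    ; conn  = relabel-conn rel same conn
    ; size  = trans (ℕₚ.+-suc ∣ V - h q ∣ (length R))
                (trans (cong (_+ length R) (∣p-x∣ (home∈ q))) size)
    }
    where
    open Tracks tr
    home∈′ : ∀ x → h′ x ∈ˢ V - h q
    home∈′ x with rel x
    ... | inj₁ (_ , eq)  = subst (_∈ˢ V - h q) (sym eq) (Subsetₚ.x∈p∧x≢y⇒x∈p-y (home∈ p) hp≢hq)
    ... | inj₂ (neq , eq) = subst (_∈ˢ V - h q) (sym eq) (Subsetₚ.x∈p∧x≢y⇒x∈p-y (home∈ x) neq)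

    fixed′ : ∀ {v} → v ∈ˢ V - h q → h′ v ≡ v
    fixed′ {v} v∈ with rel v | fixed (Subsetₚ.p─q⊆p V _ v∈)
    ... | inj₂ (_ , eq)  | hv≡v = trans eq hv≡v
    ... | inj₁ (eq , _)  | hv≡v = contradiction v∈
      (subst (λ z → v ∉ˢ V - z) (trans (sym hv≡v) eq) (x∉p-x V v))

  Forest-tracked : ∀ R → Forest R → ∃[ V ] ∃[ h ] Tracks V h R
  Forest-tracked []            _        = Subset.⊤ , id , Tracks-start
  Forest-tracked ((p , q) ∷ R) (¬c , f) with Forest-tracked R f
  ... | V , h , tr =
    _ , _ , Tracks-merge tr (¬c ∘ Tracks.same tr p q) (proj₂ (relabel (h p) (h q) h))

  -- Contracting all edges leaves `n` minus `length R` representatives, and the home of `v` is one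
  -- of them.
  Forest-size : ∀ R → Forest R → Fin n → length R < n
  Forest-size R f v with Forest-tracked R f
  ... | V , h , tr = ℕₚ.≤-trans (ℕₚ.+-monoˡ-≤ (length R) (∈⇒0<∣∣ (Tracks.home∈ tr v)))
                       (ℕₚ.≤-reflexive (Tracks.size tr))

-- Arithmetic in ordered fields

module Ordered {c ℓ} (𝔽 : OrderedField c ℓ) where
  open OrderedField 𝔽
  open IsDecTotalOrder isDecTotalOrder public using ()
    renaming (refl to ≤ᶠ-refl; reflexive to ≤ᶠ-reflexive; trans to ≤ᶠ-trans;
              antisym to ≤ᶠ-antisym; total to ≤ᶠ-total)
  open Max (DecTotalOrder.totalOrder decTotalOrder) public using ()
    renaming (x≤y⇒x⊔y≈y to ⊔ᶠ-right; x≤y⇒y⊔x≈y to ⊔ᶠ-left; x≤x⊔y to x≤x⊔ᶠy)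
  private module R = IsCommutativeRing isCommutativeRing

  ≰⇒≥ᶠ : ∀ {x y} → ¬ (x ≤ᶠ y) → y ≤ᶠ x
  ≰⇒≥ᶠ {x} {y} x≰y = [ (λ x≤y → contradiction x≤y x≰y) , id ]′ (≤ᶠ-total x y)

  +ᶠ-cancelʳ-≤ : ∀ {x y} z → x +ᶠ z ≤ᶠ y +ᶠ z → x ≤ᶠ y
  +ᶠ-cancelʳ-≤ {x} {y} z le = subst₂ _≤ᶠ_ (drop x) (drop y) (+-monoˡ-≤ (-ᶠ z) le)
    where
    drop : ∀ x → (x +ᶠ z) +ᶠ (-ᶠ z) ≡ x
    drop x = trans (R.+-assoc x z (-ᶠ z)) (trans (cong (x +ᶠ_) (R.-‿inverseʳ z)) (R.+-identityʳ x))

  +ᶠ-swap : ∀ x y z → x +ᶠ (y +ᶠ z) ≡ y +ᶠ (x +ᶠ z)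
  +ᶠ-swap x y z = trans (sym (R.+-assoc x y z)) (trans (cong (_+ᶠ z) (R.+-comm x y)) (R.+-assoc y x z))

-- Minimum spanning trees, Kruskal's invariant and contractions

module Trees {c ℓ} (𝔽 : OrderedField c ℓ) {n : ℕ} (k : ℕ) (G : MRSD.WeightedCompleteGraph 𝔽 n) where
  open OrderedField 𝔽
  open Ordered 𝔽
  open MRSD 𝔽
  open WeightedCompleteGraph G
  open Algorithm k G
  open Forests {n}
  open Contraction

  Oriented : List (Edge n) → Set
  Oriented = All (uncurry Fin._<_)

  total-↭ : ∀ {T T′} → T ↭ T′ → total T ≡ total T′
  total-↭ ↭.refl          = refl
  total-↭ (prep e π)      = cong (length-of e +ᶠ_) (total-↭ π)
  total-↭ (swap e f π)    =
      trans (+ᶠ-swap _ _ _) (cong (λ x → length-of f +ᶠ (length-of e +ᶠ x)) (total-↭ π))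
  total-↭ (↭.trans π ρ)   = trans (total-↭ π) (total-↭ ρ)

  spanning : ∀ {T} → IsSpanningTree T → Spanning T
  spanning {T} t = NoCycle⇒Forest T oriented distinct acyclic , λ x y → Star⇒Conn T (connected x y)
    where open IsSpanningTree t

  spanningTree : ∀ {T} → Oriented T → Spanning T → IsSpanningTree T
  spanningTree {T} o (f , c) = record
    { oriented  = o
    ; distinct  = Forest-Unique T f
    ; connected = λ u v → Conn⇒Star T (c u v)
    ; acyclic   = Forest⇒NoCycle T f
    }

  -- Exchange delivers the new edge in either direction, while spanning trees list the smaller end
  -- first; by symmetry of `d` turning it round changes no weight.
  orient : ∀ {p q B} → p ≢ q → Spanning ((p , q) ∷ B) →
           ∃[ e ] uncurry Fin._<_ e × Spanning (e ∷ B) × length-of e ≡ d p q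
  orient {p} {q} {B} p≢q s@((¬c , f) , c) with Finₚ.<-cmp p q
  ... | tri< p<q _ _ = (p , q) , p<q , s , refl
  ... | tri≈ _ p≡q _ = contradiction p≡q p≢q
  ... | tri> _ _ q<p = (q , p) , q<p , flipped , d-sym q p
    where
    flipped : Spanning ((q , p) ∷ B)
    flipped = (¬c ∘ Conn-sym B , f) , λ x y →
      Conn-mono _ (λ { (here refl) → Conn-sym ((q , p) ∷ B) (Conn-here B)
                     ; (there e)   → inj₁ (Conn-∈ e) }) (c x y)

  cheapest : ∀ {T L R p q} → IsMinimumSpanningTree T → T ↭ L ++ R → ¬ Conn R p q →
             ∃[ f ] f ∈ L × length-of f ≤ᶠ d p q
  cheapest {T} {L} {R} {p} {q} (t , least) π ¬pq with exchange L R (Spanning-↭ π (spanning t)) ¬pq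
  ... | f , L′ , ρ , s with orient (λ { refl → ¬pq (Conn-refl R) }) s
  ... | e , o , s′ , de≡ =
    f , ↭ₚ.∈-resp-↭ (↭-sym ρ) (here refl) ,
    +ᶠ-cancelʳ-≤ (total (L′ ++ R))
      (subst₂ _≤ᶠ_ (total-↭ π′) (cong (_+ᶠ total (L′ ++ R)) de≡) (least _ (spanningTree (o ∷ o′) s′)))
    where
    π′ : T ↭ f ∷ L′ ++ R
    π′ = ↭-trans π (↭ₚ.++⁺ʳ R ρ)
    o′ : Oriented (L′ ++ R)
    o′ = All.tail (↭ₚ.All-resp-↭ π′ (IsSpanningTree.oriented t))

  -- Kruskal's invariant.
  Promising : List (Edge n) → Set ℓ
  Promising F = ∀ T′ → IsSpanningTree T′ →
    ∃[ R ] Oriented R × Spanning (R ++ F) × total (R ++ F) ≤ᶠ total T′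

  Promising-[] : Promising []
  Promising-[] T t = T , IsSpanningTree.oriented t , Spanning-↭ (↭-sym ++[]) (spanning t) ,
    ≤ᶠ-reflexive (total-↭ ++[])
    where
    ++[] : T ++ [] ↭ T
    ++[] = ↭.↭-reflexive (Listₚ.++-identityʳ T)

  Promising-↭ : ∀ {F F′} → F ↭ F′ → Promising F → Promising F′
  Promising-↭ {F} {F′} π pr T t with pr T t
  ... | R , o , s , le = R , o , Spanning-↭ (↭ₚ.++⁺ˡ R π) s ,
                         subst (_≤ᶠ total T) (total-↭ (↭ₚ.++⁺ˡ R π)) le

  -- The completion of `F` belonging to a tree gives up an edge `f` for `p q`. As `f` lies in a
  -- forest together with `F`, it joins two components of `F`, so it is at least as heavy as `p q`.
  Promising-step : ∀ {F p q} → Promising F → ¬ Conn F p q →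
    (∀ u v → u Fin.< v → ¬ Conn F u v → d p q ≤ᶠ d u v) → Promising ((p , q) ∷ F)
  Promising-step {F} {p} {q} pr ¬pq min T t with pr T t
  ... | R , o , s , le with exchange R F s ¬pq
  ... | f@(u , v) , R′ , ρ , s′ with ↭ₚ.All-resp-↭ ρ o
  ... | u<v ∷ o′ = R′ , o′ , Spanning-↭ (↭-sym π) s′ ,
      ≤ᶠ-trans (≤ᶠ-reflexive (total-↭ π))
        (≤ᶠ-trans (+-monoˡ-≤ (total (R′ ++ F)) (min u v u<v ¬uv))
          (subst (_≤ᶠ total T) (total-↭ (↭ₚ.++⁺ʳ F ρ)) le))
    where
    π : R′ ++ (p , q) ∷ F ↭ (p , q) ∷ R′ ++ F
    π = ↭ₚ.shift (p , q) R′ F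
    ¬uv : ¬ Conn F u v
    ¬uv c = proj₁ (Forest-↭ (↭ₚ.++⁺ʳ F ρ) (proj₁ s)) (Conn-⊆ (∈-++⁺ʳ R′) c)

  -- `Promising` compares with each spanning tree separately, so minimality follows without first
  -- knowing that a minimum exists. The completion of a spanning `F` is empty, as any further edge
  -- would close a cycle.
  Promising-final : ∀ {F} → Oriented F → Spanning F → Promising F → IsMinimumSpanningTree F
  Promising-final {F} o s pr = spanningTree o s , least
    where
    least : ∀ T → IsSpanningTree T → total F ≤ᶠ total T
    least T t with pr T t
    ... | [] , _ , _ , le = le
    ... | r ∷ R , _ , ((¬r , _) , _) , _ = contradiction (Conn-⊆ (∈-++⁺ʳ R) (proj₂ s _ _)) ¬r

  Sorted : List (Edge n) → Set ℓ
  Sorted = Linked (λ e f → length-of e ≤ᶠ length-of f)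

  Sorted-first : ∀ {e f L} → Sorted (e ∷ L) → f ∈ e ∷ L → length-of e ≤ᶠ length-of f
  Sorted-first sorted (here refl) = ≤ᶠ-refl
  Sorted-first sorted (there f∈L) = All.lookup (AllPairs.head (Linkedₚ.Linked⇒AllPairs ≤ᶠ-trans sorted)) f∈L

  Sorted-∷ʳ : ∀ {e} L → Sorted L → All (λ f → length-of f ≤ᶠ length-of e) L → Sorted (L ∷ʳ e)
  Sorted-∷ʳ []          _       _        = [-]
  Sorted-∷ʳ (_ ∷ [])    _       (p ∷ _)  = p ∷ [-]
  Sorted-∷ʳ (_ ∷ _ ∷ L) (q ∷ s) (_ ∷ ps) = q ∷ Sorted-∷ʳ (_ ∷ L) s ps

  -- R lists the edges already contracted.
  record Consistent (H : Contraction n) (L : List (Edge n)) : Set (c ⊔ˡ ℓ) where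
    field
      {T R}    : List (Edge n)
      minimum  : IsMinimumSpanningTree T
      split    : T ↭ L ++ R
      sorted   : Sorted L
      tracks   : Tracks (verts H) (home H) R
      w-refl   : ∀ u → w H u u ≡ 0#
      w-nonneg : ∀ u v → 0# ≤ᶠ w H u v
    open Tracks tracks public

    forest : Forest (L ++ R)
    forest = Forest-↭ split (proj₁ (spanning (proj₁ minimum)))

    -- The remaining and the contracted edges together form a forest, hence number fewer than `n`,
    -- whereas the vertices of G′ and the contracted edges add up to `n`. With k - 1 edges left
    -- there are thus k vertices to choose centres from.
    enough : Fin n → suc (length L) ≤ ∣ verts H ∣
    enough v = ℕₚ.+-cancelʳ-≤ (length R) (suc (length L)) ∣ verts H ∣
      (ℕₚ.≤-trans (s≤s (ℕₚ.≤-reflexive (sym (Listₚ.length-++ L))))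
        (ℕₚ.≤-trans (Forest-size (L ++ R) forest v) (ℕₚ.≤-reflexive (sym size))))

  open Consistent

  Consistent-start : ∀ {T L} → IsMinimumSpanningTree T → L ↭ T → Sorted L →
                     Consistent (uncontracted G) L
  Consistent-start {T} {L} mst π sorted = record
    { minimum  = mst
    ; split    = ↭-trans (↭-sym π) (↭.↭-reflexive (sym (Listₚ.++-identityʳ L)))
    ; sorted   = sorted
    ; tracks   = Tracks-start
    ; w-refl   = d-uu
    ; w-nonneg = nonneg
    }
    where
    nonneg : ∀ u v → 0# ≤ᶠ d u v
    nonneg u v with u Fin.≟ v
    ... | yes refl = ≤ᶠ-reflexive (sym (d-uu u))
    ... | no u≢v   = proj₁ (d-pos u≢v)

  -- Were the ends already merged, contracted edges would connect them and the edge would close a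
  -- cycle in the tree.
  home-distinct : ∀ {H p q L} → Consistent H ((p , q) ∷ L) → home H p ≢ home H q
  home-distinct {L = L} C eq = proj₁ (forest C) (Conn-⊆ (∈-++⁺ʳ L) (same C _ _ eq))

  merge-relabels : ∀ u v H → Relabels u v (home H) (home (merge u v H))
  merge-relabels u v H x with home H x Fin.≟ v
  ... | yes eq = inj₁ (eq , refl)
  ... | no neq = inj₂ (neq , refl)

  Consistent-merge : ∀ {H p q L} → Consistent H ((p , q) ∷ L) →
                     Consistent (merge (home H p) (home H q) H) L
  Consistent-merge {H} {p} {q} {L} C = record
    { minimum  = minimum C
    ; split    = ↭-trans (split C) (↭-sym (↭ₚ.shift (p , q) L (R C)))
    ; sorted   = Linked.tail (sorted C)
    ; tracks   = Tracks-merge (tracks C) (home-distinct C) (merge-relabels _ _ H)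
    ; w-refl   = refl′
    ; w-nonneg = nonneg′
    }
    where
    u v : Fin n
    u = home H p
    v = home H q

    refl′ : ∀ x → w (merge u v H) x x ≡ 0#
    refl′ x with x Fin.≟ u
    ... | yes _ = refl
    ... | no  _ = w-refl C x

    nonneg′ : ∀ x y → 0# ≤ᶠ w (merge u v H) x y
    nonneg′ x y with x Fin.≟ u | y Fin.≟ u
    ... | yes _ | yes _ = ≤ᶠ-refl
    ... | yes _ | no  _ = ≤ᶠ-trans (w-nonneg C u y) (x≤x⊔ᶠy _ _)
    ... | no  _ | yes _ = ≤ᶠ-trans (w-nonneg C x u) (x≤x⊔ᶠy _ _)
    ... | no  _ | no  _ = w-nonneg C x y

  first-cheapest : ∀ {H e L p q} → Consistent H (e ∷ L) → home H p ≢ home H q → length-of e ≤ᶠ d p q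
  first-cheapest C neq with cheapest (minimum C) (split C) (neq ∘ conn C _ _)
  ... | f , f∈L , le = ≤ᶠ-trans (Sorted-first (sorted C) f∈L) le

-- Programs all of whose loops run a counter from 0 to n − 1, where n is the
-- value of cell 0 of natural array 0.  The counter is cell 0 of its array.
data Prog : Set where
  skip     : Prog
  _⟨_⟩≔ᴺ_  : ℕ → NatExp → NatExp → Prog
  _⟨_⟩≔ᵂ_  : ℕ → NatExp → WeightExp → Prog
  _⨾_      : Prog → Prog → Prog
  if       : Test → Prog → Prog → Prog
  for      : (counter : ℕ) → Prog → Prog

cell : ℕ → NatExp
cell a = at a (con 0)

increment : ℕ → Com
increment x = x ⟨ con 0 ⟩≔ᴺ (cell x ⊕ con 1)

below : ℕ → Test
below x = notᵗ (cell 0 ≤ᴺ cell x)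

compile : Prog → Com
compile skip           = skip
compile (a ⟨ i ⟩≔ᴺ e)  = a ⟨ i ⟩≔ᴺ e
compile (a ⟨ i ⟩≔ᵂ e)  = a ⟨ i ⟩≔ᵂ e
compile (p ⨾ q)        = compile p ⨾ compile q
compile (if b p q)     = if b (compile p) (compile q)
compile (for x p)      = x ⟨ con 0 ⟩≔ᴺ con 0 ⨾ while (below x) (compile p ⨾ increment x)

-- A computed index is taken to hit every cell.
hits : NatExp → ℕ → Bool
hits (con j) i = does (j ≟ i)
hits _       _ = true

-- Being computed from the syntax, these hold by refl for concrete array names,
-- even at an unknown index.
sparesᴺ sparesᵂ : Prog → (array index : ℕ) → Bool
sparesᴺ skip          b j = true
sparesᴺ (a ⟨ i ⟩≔ᴺ _) b j = not (does (a ≟ b) ∧ hits i j)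
sparesᴺ (a ⟨ i ⟩≔ᵂ _) b j = true
sparesᴺ (p ⨾ q)       b j = sparesᴺ p b j ∧ sparesᴺ q b j
sparesᴺ (if _ p q)    b j = sparesᴺ p b j ∧ sparesᴺ q b j
sparesᴺ (for x p)     b j = not (does (x ≟ b) ∧ does (0 ≟ j)) ∧ sparesᴺ p b j
sparesᵂ skip          b j = true
sparesᵂ (a ⟨ i ⟩≔ᴺ _) b j = true
sparesᵂ (a ⟨ i ⟩≔ᵂ _) b j = not (does (a ≟ b) ∧ hits i j)
sparesᵂ (p ⨾ q)       b j = sparesᵂ p b j ∧ sparesᵂ q b j
sparesᵂ (if _ p q)    b j = sparesᵂ p b j ∧ sparesᵂ q b j
sparesᵂ (for x p)     b j = sparesᵂ p b j

-- Loop bodies leave the counter and n alone.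
wellFormed : Prog → Bool
wellFormed (p ⨾ q)    = (wellFormed p ∧ wellFormed q) ∧ sparesᴺ p 0 0
wellFormed (if _ p q) = wellFormed p ∧ wellFormed q
wellFormed (for x p)  = wellFormed p ∧ sparesᴺ p x 0 ∧ not (does (x ≟ 0)) ∧ sparesᴺ p 0 0
wellFormed _          = true

depth : Prog → ℕ
depth (p ⨾ q)        = depth p ⊔ depth q
depth (if _ p q)     = depth p ⊔ depth q
depth (for _ p)      = suc (depth p)
depth _              = 0

-- Opaque, lest the type checker multiply out the large factors of closed programs.
opaque
  factor : Prog → ℕ
  factor skip          = 1
  factor (a ⟨ i ⟩≔ᴺ e) = 1 + costᴺ i + costᴺ e
  factor (a ⟨ i ⟩≔ᵂ e) = 1 + costᴺ i + costᵂ e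
  factor (p ⨾ q)       = factor p + factor q
  factor (if b p q)    = 1 + costᵗ b + (factor p + factor q)
  -- The two overheads of `for-time`, 10 once and 13 per round: for positive `n` each is absorbed by
  -- the leading power of `n`.
  factor (for x p)     = 23 + factor p

∧-true : ∀ {a b} → a ∧ b ≡ true → a ≡ true × b ≡ true
∧-true {true} {true} refl = refl , refl

not-true : ∀ {a} → not a ≡ true → a ≡ false
not-true {false} refl = refl

-- Semantics, frame conditions and running time of loop programs

module Programs {c ℓ} (𝔽 : OrderedField c ℓ) where
  open OrderedField 𝔽
  open RAM 𝔽

  storeᴺ : ℕ → ℕ → ℕ → Memory → Memory
  storeᴺ a i x m = record m { nat = write (nat m) a i x }

  storeᵂ : ℕ → ℕ → Carrier → Memory → Memory
  storeᵂ a i x m = record m { weight = write (weight m) a i x }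

  repeat : ℕ → (Memory → Memory) → Memory → Memory
  repeat zero    f m = m
  repeat (suc r) f m = repeat r f (f m)

  ⟦_⟧ : Prog → Memory → Memory
  ⟦ skip ⟧          m = m
  ⟦ a ⟨ i ⟩≔ᴺ e ⟧   m = storeᴺ a (evalᴺ i m) (evalᴺ e m) m
  ⟦ a ⟨ i ⟩≔ᵂ e ⟧   m = storeᵂ a (evalᴺ i m) (evalᵂ e m) m
  ⟦ p ⨾ q ⟧         m = ⟦ q ⟧ (⟦ p ⟧ m)
  ⟦ if b p q ⟧      m = if evalᵗ b m then ⟦ p ⟧ m else ⟦ q ⟧ m
  ⟦ for x p ⟧       m = 
    repeat (nat m 0 0) (λ m → storeᴺ x 0 (nat (⟦ p ⟧ m) x 0 + 1) (⟦ p ⟧ m)) (storeᴺ x 0 0 m)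

  write-other : ∀ {a} {A : Set a} (f : ℕ → ℕ → A) a i x b j →
                does (a ≟ b) ∧ does (i ≟ j) ≡ false → write f a i x b j ≡ f b j
  write-other f a i x b j eq rewrite eq = refl

  write-here : ∀ {a} {A : Set a} (f : ℕ → ℕ → A) a i x → write f a i x a i ≡ x
  write-here f a i x rewrite dec-true (a ≟ a) refl | dec-true (i ≟ i) refl = refl

  hits-sound : ∀ i m {j} a b → not (does (a ≟ b) ∧ hits i j) ≡ true →
               does (a ≟ b) ∧ does (evalᴺ i m ≟ j) ≡ false
  hits-sound i m a b eq with does (a ≟ b)
  hits-sound i m a b eq | false = refl
  hits-sound (con x) m a b eq | true = not-true eq

  repeat-inv : ∀ {a} {P : Memory → Set a} {f} → (∀ m → P m → P (f m)) → ∀ r m → P m → P (repeat r f m)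
  repeat-inv step zero    m p = p
  repeat-inv step (suc r) m p = repeat-inv step r _ (step m p)

  frameᴺ : ∀ p m b j → sparesᴺ p b j ≡ true → nat (⟦ p ⟧ m) b j ≡ nat m b j
  frameᴺ skip          m b j eq = refl
  frameᴺ (a ⟨ i ⟩≔ᴺ e) m b j eq = write-other (nat m) a (evalᴺ i m) _ b j (hits-sound i m a b eq)
  frameᴺ (a ⟨ i ⟩≔ᵂ e) m b j eq = refl
  frameᴺ (p ⨾ q)       m b j eq with ∧-true eq
  ... | sp , sq = trans (frameᴺ q (⟦ p ⟧ m) b j sq) (frameᴺ p m b j sp)
  frameᴺ (if t p q)    m b j eq with ∧-true eq | evalᵗ t m
  ... | sp , sq | true  = frameᴺ p m b j sp
  ... | sp , sq | false = frameᴺ q m b j sq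
  frameᴺ (for x p)     m b j eq with ∧-true {not (does (x ≟ b) ∧ does (0 ≟ j))} eq
  ... | sx , sp = repeat-inv {P = λ m′ → nat m′ b j ≡ nat m b j}
    (λ m′ e → trans (write-other (nat (⟦ p ⟧ m′)) x 0 _ b j (not-true sx)) (trans (frameᴺ p m′ b j sp) e))
    (nat m 0 0) _ (write-other (nat m) x 0 0 b j (not-true sx))

  frameᵂ : ∀ p m b j → sparesᵂ p b j ≡ true → weight (⟦ p ⟧ m) b j ≡ weight m b j
  frameᵂ skip          m b j eq = refl
  frameᵂ (a ⟨ i ⟩≔ᴺ e) m b j eq = refl
  frameᵂ (a ⟨ i ⟩≔ᵂ e) m b j eq = write-other (weight m) a (evalᴺ i m) _ b j (hits-sound i m a b eq)
  frameᵂ (p ⨾ q)       m b j eq with ∧-true eq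
  ... | sp , sq = trans (frameᵂ q (⟦ p ⟧ m) b j sq) (frameᵂ p m b j sp)
  frameᵂ (if t p q)    m b j eq with ∧-true eq | evalᵗ t m
  ... | sp , sq | true  = frameᵂ p m b j sp
  ... | sp , sq | false = frameᵂ q m b j sq
  frameᵂ (for x p)     m b j eq = repeat-inv {P = λ m′ → weight m′ b j ≡ weight m b j}
    (λ m′ e → trans (frameᵂ p m′ b j eq) e) (nat m 0 0) _ refl

  -- A relation between two memories rather than a property of a complete run, so that `for-rule`
  -- can supply it in the middle of a loop.
  record Agrees (p : Prog) (m m′ : Memory) : Set c where
    field
      onᴺ : ∀ b j → sparesᴺ p b j ≡ true → nat m′ b j ≡ nat m b j
      onᵂ : ∀ b j → sparesᵂ p b j ≡ true → weight m′ b j ≡ weight m b j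

  agrees : ∀ p m → Agrees p m (⟦ p ⟧ m)
  agrees p m = record { onᴺ = frameᴺ p m ; onᵂ = frameᵂ p m }

  round : ℕ → Prog → Memory → Memory
  round x p m = storeᴺ x 0 (nat (⟦ p ⟧ m) x 0 + 1) (⟦ p ⟧ m)

  module _ (x : ℕ) (p : Prog) (wf : wellFormed (for x p) ≡ true) where
    private
      spares : sparesᴺ p x 0 ≡ true × does (x ≟ 0) ≡ false × sparesᴺ p 0 0 ≡ true
      spares with ∧-true {sparesᴺ p x 0} (proj₂ (∧-true {wellFormed p} wf))
      ... | counter , rest with ∧-true {not (does (x ≟ 0))} rest
      ... | x≢0 , bound = counter , not-true x≢0 , bound

      counter = proj₁ spares
      x≢0     = proj₁ (proj₂ spares)
      bound   = proj₂ (proj₂ spares)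

    round-bound : ∀ m → nat (round x p m) 0 0 ≡ nat m 0 0
    round-bound m = trans (write-other (nat (⟦ p ⟧ m)) x 0 _ 0 0 (trans (Boolₚ.∧-identityʳ _) x≢0))
                         (frameᴺ p m 0 0 bound)

    round-counter : ∀ m → nat (round x p m) x 0 ≡ suc (nat m x 0)
    round-counter m = trans (write-here (nat (⟦ p ⟧ m)) x 0 _)
                       (trans (ℕₚ.+-comm _ 1) (cong suc (frameᴺ p m x 0 counter)))

    start-bound : ∀ m → nat (storeᴺ x 0 0 m) 0 0 ≡ nat m 0 0
    start-bound m = write-other (nat m) x 0 0 0 0 (trans (Boolₚ.∧-identityʳ _) x≢0)

    -- Besides the invariant, each round is told the value of the counter and that all cells spared
    -- by the loop are as before it. Invariants therefore need only describe what the loop changes.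
    for-rule : ∀ {a n} m (I : ℕ → Memory → Set a) → nat m 0 0 ≡ n → I 0 (storeᴺ x 0 0 m) →
      (∀ i m′ → i < n → Agrees (for x p) m m′ → nat m′ x 0 ≡ i → I i m′ → I (suc i) (round x p m′)) →
      I n (⟦ for x p ⟧ m)
    for-rule {n = n} m I refl base step =
      go (nat m 0 0) 0 (storeᴺ x 0 0 m) (ℕₚ.+-identityʳ _) (write-here (nat m) x 0 0)
        (record { onᴺ = λ b j s → write-other (nat m) x 0 0 b j
            (not-true (proj₁ (∧-true {not (does (x ≟ b) ∧ does (0 ≟ j))} s)))
                ; onᵂ = λ _ _ _ → refl }) base
      where
      go : ∀ r i m′ → r + i ≡ n → nat m′ x 0 ≡ i → Agrees (for x p) m m′ → I i m′ →
           I n (repeat r (round x p) m′)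
      go zero    i m′ refl _  _ inv = inv
      go (suc r) i m′ eq   cx A inv =
        go r (suc i) (round x p m′) (trans (ℕₚ.+-suc r i) eq) (trans (round-counter m′) (cong suc cx)) A′
          (step i m′ (ℕₚ.≤-trans (s≤s (ℕₚ.m≤n+m i r)) (ℕₚ.≤-reflexive eq)) A cx inv)
        where
        A′ : Agrees (for x p) m (round x p m′)
        A′ = record
          { onᴺ = λ b j s → let sx , sp = ∧-true {not (does (x ≟ b) ∧ does (0 ≟ j))} s in
              trans (write-other (nat (⟦ p ⟧ m′)) x 0 _ b j (not-true sx))
                (trans (frameᴺ p m′ b j sp) (Agrees.onᴺ A b j s))
          ; onᵂ = λ b j s → trans (frameᵂ p m′ b j s) (Agrees.onᵂ A b j s) }

    -- The failing test costs 7 and the reset of the counter 3, in all 10. Each round adds 7 for the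
    -- successful test and 6 for the increment, in all 13.
    for-time : ∀ {n t} →
      (∀ m → nat m 0 0 ≡ n → ∃[ u ] (compile p / m ⇓ ⟦ p ⟧ m [ u ]) × u ≤ t) →
      ∀ m → nat m 0 0 ≡ n →
      ∃[ u ] (compile (for x p) / m ⇓ ⟦ for x p ⟧ m [ u ]) × u ≤ 10 + n * (13 + t)
    for-time {n} {t} body m refl with go (nat m 0 0) (storeᴺ x 0 0 m) (start-bound m)
      (trans (cong (nat m 0 0 +_) (write-here (nat m) x 0 0)) (ℕₚ.+-identityʳ _))
      where
      go : ∀ r m → nat m 0 0 ≡ n → r + nat m x 0 ≡ n →
           ∃[ u ] (while (below x) (compile p ⨾ increment x) / m ⇓ repeat r (round x p) m [ u ]) ×
                  u ≤ 7 + r * (13 + t)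
      go zero m b eq = _ , while-false
        (cong not (dec-true (nat m 0 0 ≤? nat m x 0) (ℕₚ.≤-reflexive (trans b (sym eq))))) , ℕₚ.≤-refl
      go (suc r) m b eq with body m b | go r (round x p m) (trans (round-bound m) b)
                              (trans (cong (r +_) (round-counter m)) (trans (ℕₚ.+-suc r _) eq))
      ... | u , e , le | u′ , e′ , le′ =
        _ , while-true (cong not (dec-false (nat m 0 0 ≤? nat m x 0) below-n)) (seq e assignᴺ) e′
          , ℕₚ.≤-trans (ℕₚ.+-monoʳ-≤ 7 (ℕₚ.+-mono-≤ (ℕₚ.+-monoˡ-≤ 6 le) le′))
              (ℕₚ.≤-reflexive (arith t (r * (13 + t))))
        where
        below-n : ¬ (nat m 0 0 ≤ nat m x 0)
        below-n le = ℕₚ.<-irrefl refl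
          (ℕₚ.≤-trans (s≤s (ℕₚ.m≤n+m (nat m x 0) r)) (ℕₚ.≤-trans (ℕₚ.≤-reflexive (trans eq (sym b))) le))
        arith : ∀ t s → 7 + (t + 6 + (7 + s)) ≡ 7 + (13 + t + s)
        arith = solve-∀
    ... | u , e , le = _ , seq assignᴺ e , ℕₚ.+-monoʳ-≤ 3 le

  module _ {n : ℕ} {{_ : NonZero n}} where

    1≤n^ : ∀ e → 1 ≤ n ^ e
    1≤n^ e = ℕₚ.m^n>0 n e

    raise : ∀ {u} K {d e} → d ≤ e → u ≤ K * n ^ d → u ≤ K * n ^ e
    raise K d≤e le = ℕₚ.≤-trans le (ℕₚ.*-monoʳ-≤ K (ℕₚ.^-monoʳ-≤ n d≤e))

    constant : ∀ K e → K ≤ K * n ^ e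
    constant K e = ℕₚ.≤-trans (ℕₚ.≤-reflexive (sym (ℕₚ.*-identityʳ K))) (ℕₚ.*-monoʳ-≤ K (1≤n^ e))

    opaque
      unfolding factor

      -- Since `n` is positive, terms of lower degree are raised to the degree `depth p`. In a
      -- sequence, `wellFormed` ensures that the second program still finds `n` in its cell.
      time : ∀ p → wellFormed p ≡ true → ∀ m → nat m 0 0 ≡ n →
             ∃[ u ] (compile p / m ⇓ ⟦ p ⟧ m [ u ]) × u ≤ factor p * n ^ depth p
      time skip          wf m eq = 1 , skip , ℕₚ.≤-refl
      time (a ⟨ i ⟩≔ᴺ e) wf m eq = _ , assignᴺ , constant (1 + costᴺ i + costᴺ e) 0
      time (a ⟨ i ⟩≔ᵂ e) wf m eq = _ , assignᵂ , constant (1 + costᴺ i + costᵂ e) 0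
      time (p ⨾ q)       wf m eq with ∧-true {wellFormed p ∧ wellFormed q} wf
      ... | wfpq , s with ∧-true {wellFormed p} wfpq
      ... | wfp , wfq with time p wfp m eq | time q wfq (⟦ p ⟧ m) (trans (frameᴺ p m 0 0 s) eq)
      ... | u , e , le | u′ , e′ , le′ = u + u′ , seq e e′ ,
        ℕₚ.≤-trans (ℕₚ.+-mono-≤ (raise (factor p) (ℕₚ.m≤m⊔n (depth p) (depth q)) le)
                                (raise (factor q) (ℕₚ.m≤n⊔m (depth p) (depth q)) le′))
          (ℕₚ.≤-reflexive (sym (ℕₚ.*-distribʳ-+ _ (factor p) (factor q))))
      time (if b p q)    wf m eq with ∧-true {wellFormed p} wf
      ... | wfp , wfq with evalᵗ b m in eqb
      ... | true with time p wfp m eq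
      ...   | u , e , le = _ , if-true eqb e , ℕₚ.≤-trans
        (ℕₚ.+-mono-≤ (constant (1 + costᵗ b) (depth p ⊔ depth q))
          (raise (factor p) (ℕₚ.m≤m⊔n (depth p) (depth q)) le))
        (ℕₚ.≤-trans (ℕₚ.≤-reflexive (sym (ℕₚ.*-distribʳ-+ _ (1 + costᵗ b) (factor p))))
          (ℕₚ.*-monoˡ-≤ _ (ℕₚ.+-monoʳ-≤ (1 + costᵗ b) (ℕₚ.m≤m+n (factor p) (factor q)))))
      time (if b p q)    wf m eq | wfp , wfq | false with time q wfq m eq
      ...   | u , e , le = _ , if-false eqb e , ℕₚ.≤-trans
        (ℕₚ.+-mono-≤ (constant (1 + costᵗ b) (depth p ⊔ depth q))
          (raise (factor q) (ℕₚ.m≤n⊔m (depth p) (depth q)) le))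
        (ℕₚ.≤-trans (ℕₚ.≤-reflexive (sym (ℕₚ.*-distribʳ-+ _ (1 + costᵗ b) (factor q))))
          (ℕₚ.*-monoˡ-≤ _ (ℕₚ.+-monoʳ-≤ (1 + costᵗ b) (ℕₚ.m≤n+m (factor q) (factor p)))))
      time (for x p)     wf m eq with for-time x p wf (time p (proj₁ (∧-true {wellFormed p} wf))) m eq
      ... | u , e , le = u , e , ℕₚ.≤-trans le
        (ℕₚ.≤-trans (ℕₚ.+-mono-≤ (constant 10 (suc (depth p)))
            (ℕₚ.*-monoʳ-≤ n (ℕₚ.+-monoˡ-≤ (factor p * n ^ depth p) (constant 13 (depth p)))))
          (ℕₚ.≤-reflexive (arith n (factor p) (n ^ depth p))))
        where
        arith : ∀ n K N → 10 * (n * N) + n * (13 * N + K * N) ≡ (23 + K) * (n * N)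
        arith = solve-∀

data Extremum : Set where
  smallest largest : Extremum

beats : Extremum → WeightExp → WeightExp → Test
beats smallest    e f = e ≤ᵂ f
beats largest e f = f ≤ᵂ e

-- Scratch natural arrays: 8–10 results of a scan, 11, 12 and 17 loop counters,
-- 13 and 14 the two labels being merged, 15 marks of the chosen centres, 16 the
-- assignment of vertices of G′, 18 components during Kruskal's algorithm.
-- Scratch weight arrays: 3 result of a scan, 4 distances to the chosen centres,
-- 5 the diameter.

-- Scanning the index pairs (cell 11 , cell 12) satisfying b for an extremal
-- value of e: cell 8 tells whether there is one, cells 9 and 10 hold the
-- best pair so far and weight cell 3 its value.
take : WeightExp → Prog
take e = 3 ⟨ con 0 ⟩≔ᵂ e ⨾ 8 ⟨ con 0 ⟩≔ᴺ con 1 ⨾ 9 ⟨ con 0 ⟩≔ᴺ cell 11 ⨾ 10 ⟨ con 0 ⟩≔ᴺ cell 12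

takeIfBetter consider : Extremum → WeightExp → Prog
takeIfBetter x e = if (beats x e (at 3 (con 0))) (take e) skip
consider x e = if (cell 8 ≡ᴺ con 0) (take e) (takeIfBetter x e)

visit scanRow scan : Extremum → Test → WeightExp → Prog
visit x b e   = if b (consider x e) skip
scanRow x b e = for 12 (visit x b e)
scan x b e = 8 ⟨ con 0 ⟩≔ᴺ con 0 ⨾ for 11 (scanRow x b e)

relabelCode : ℕ → Prog
relabelCode a = if (at a (cell 11) ≡ᴺ cell 14) (a ⟨ cell 11 ⟩≔ᴺ cell 13) skip

-- Rules for conditionals, scans and array updates

module Loops {c ℓ} (𝔽 : OrderedField c ℓ) where
  open OrderedField 𝔽
  open Ordered 𝔽
  open RAM 𝔽
  open Programs 𝔽

  if-rule : ∀ {a} (Q : Memory → Set a) b p q m {s} {A : Set s} (A? : Dec A) → evalᵗ b m ≡ does A? →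
            (A → Q (⟦ p ⟧ m)) → (¬ A → Q (⟦ q ⟧ m)) → Q (⟦ if b p q ⟧ m)
  if-rule Q b p q m (yes a) eq f g rewrite eq = f a
  if-rule Q b p q m (no ¬a) eq f g rewrite eq = g ¬a

  Preferred : Extremum → Carrier → Carrier → Set ℓ
  Preferred smallest    x y = x ≤ᶠ y
  Preferred largest x y = y ≤ᶠ x

  preferred? : ∀ z x y → Dec (Preferred z x y)
  preferred? smallest    x y = x ≤ᶠ? y
  preferred? largest x y = y ≤ᶠ? x

  beats-does : ∀ z e f m → evalᵗ (beats z e f) m ≡ does (preferred? z (evalᵂ e m) (evalᵂ f m))
  beats-does smallest    e f m = refl
  beats-does largest e f m = refl

  preferred-refl : ∀ z {x} → Preferred z x x
  preferred-refl smallest    = ≤ᶠ-refl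
  preferred-refl largest = ≤ᶠ-refl

  preferred-trans : ∀ z {x y t} → Preferred z x y → Preferred z y t → Preferred z x t
  preferred-trans smallest    p q = ≤ᶠ-trans p q
  preferred-trans largest p q = ≤ᶠ-trans q p

  preferred-total : ∀ z {x y} → ¬ Preferred z x y → Preferred z y x
  preferred-total smallest    = ≰⇒≥ᶠ
  preferred-total largest = ≰⇒≥ᶠ

  module Scan (z : Extremum) (b : Test) (e : WeightExp) {Cand : ℕ → ℕ → Set}
              (cand? : ∀ i j → Dec (Cand i j)) (key : ℕ → ℕ → Carrier) where

    -- Its indices are the values found and not the memory, so that writing a loop counter leaves
    -- the type unchanged by computation. The set `V` of pairs seen so far is arbitrary, which lets
    -- rows and whole squares share `visit-best`.
    data Best (V : ℕ → ℕ → Set) (found i j : ℕ) (x : Carrier) : Set (c ⊔ˡ ℓ) where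
      none : found ≡ 0 → (∀ {i j} → V i j → ¬ Cand i j) → Best V found i j x
      some : found ≡ 1 → x ≡ key i j → V i j → Cand i j →
             (∀ {i′ j′} → V i′ j′ → Cand i′ j′ → Preferred z (key i j) (key i′ j′)) →
             Best V found i j x

    BestIn : (ℕ → ℕ → Set) → Memory → Set (c ⊔ˡ ℓ)
    BestIn V m = Best V (nat m 8 0) (nat m 9 0) (nat m 10 0) (weight m 3 0)

    best-map : ∀ {V V′ f i j x} → (∀ {i j} → V i j → V′ i j) → (∀ {i j} → V′ i j → V i j) →
               Best V f i j x → Best V′ f i j x
    best-map to from (none eq ∄)             = none eq (∄ ∘ from)
    best-map to from (some eq x≡ vis cd opt) = some eq x≡ (to vis) cd (opt ∘ from)

    Spec : ℕ → ℕ → Memory → Set c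
    Spec i j m′ = evalᵗ b m′ ≡ does (cand? i j) × evalᵂ e m′ ≡ key i j

    _∪_,_ : (ℕ → ℕ → Set) → ℕ → ℕ → ℕ → ℕ → Set
    (V ∪ i , j) i′ j′ = V i′ j′ ⊎ (i′ ≡ i × j′ ≡ j)

    visit-best : ∀ {V} m {i j} → nat m 11 0 ≡ i → nat m 12 0 ≡ j → Spec i j m →
                 BestIn V m → BestIn (V ∪ i , j) (⟦ visit z b e ⟧ m)
    visit-best {V} m {i} {j} refl refl (b≡ , e≡) best =
      if-rule Q b (consider z e) skip m (cand? i j) b≡
        (λ cd → if-rule Q (cell 8 ≡ᴺ con 0) (take e) (takeIfBetter z e) m (nat m 8 0 ≟ 0) refl
          (λ f≡0 → new cd (λ { vis cd′ → ⊥-elim (empty best f≡0 vis cd′) }))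
          (λ f≢0 → if-rule Q (beats z e (at 3 (con 0))) (take e) skip m
            (preferred? z (evalᵂ e m) (weight m 3 0)) (beats-does z e (at 3 (con 0)) m)
            (λ pref → new cd (λ vis cd′ → better best f≢0 pref vis cd′))
            (λ ¬pref → old best f≢0 (preferred-total z ¬pref))))
        (skipped best)
      where
      Q : Memory → Set (c ⊔ˡ ℓ)
      Q = BestIn (V ∪ i , j)

      new : Cand i j → (∀ {i′ j′} → V i′ j′ → Cand i′ j′ → Preferred z (key i j) (key i′ j′)) → Q
          (⟦ take e ⟧ m)
      new cd opt = some refl e≡ (inj₂ (refl , refl)) cd
        (λ { (inj₁ vis) cd′ → opt vis cd′ ; (inj₂ (refl , refl)) _ → preferred-refl z })

      empty : BestIn V m → nat m 8 0 ≡ 0 → ∀ {i j} → V i j → ¬ Cand i j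
      empty (none _ ∄)         _   = ∄
      empty (some f≡1 _ _ _ _) f≡0 = contradiction (trans (sym f≡0) f≡1) λ ()

      better : BestIn V m → nat m 8 0 ≢ 0 → Preferred z (evalᵂ e m) (weight m 3 0) →
               ∀ {i′ j′} → V i′ j′ → Cand i′ j′ → Preferred z (key i j) (key i′ j′)
      better (none f≡0 _)        f≢0 _            = contradiction f≡0 f≢0
      better (some _ x≡ _ _ opt) _   pref vis cd =
        preferred-trans z (subst₂ (Preferred z) e≡ x≡ pref) (opt vis cd)

      old : BestIn V m → nat m 8 0 ≢ 0 → Preferred z (weight m 3 0) (evalᵂ e m) → Q m
      old (none f≡0 _)               f≢0 _    = contradiction f≡0 f≢0
      old (some f≡1 x≡ vis cd₀ opt) _   pref = some f≡1 x≡ (inj₁ vis) cd₀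
        (λ { (inj₁ v) cd′ → opt v cd′ ; (inj₂ (refl , refl)) _ → subst₂ (Preferred z) x≡ e≡ pref })

      skipped : BestIn V m → ¬ Cand i j → Q m
      skipped (none f≡0 ∄) ¬cd = none f≡0 (λ { (inj₁ v) → ∄ v ; (inj₂ (refl , refl)) → ¬cd })
      skipped (some f≡1 x≡ vis cd₀ opt) ¬cd = some f≡1 x≡ (inj₁ vis) cd₀
        (λ { (inj₁ v) cd′ → opt v cd′ ; (inj₂ (refl , refl)) cd′ → contradiction cd′ ¬cd })

    -- With `V` the rows already done this is a round of `scan-best`; with `V` empty it is the
    -- search along a single row in steps (1) and (2).
    scanRow-best : ∀ {V n i} m → nat m 0 0 ≡ n → nat m 11 0 ≡ i →
      (∀ j m′ → j < n → Agrees (scanRow z b e) m m′ → nat m′ 12 0 ≡ j → Spec i j m′) →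
      BestIn V m → BestIn (λ i′ j′ → V i′ j′ ⊎ (i′ ≡ i × j′ < n)) (⟦ scanRow z b e ⟧ m)
    scanRow-best {V} {n} {i} m n≡ i≡ spec best = for-rule 12 (visit z b e) refl m
      (λ j m′ → BestIn (λ i′ j′ → V i′ j′ ⊎ (i′ ≡ i × j′ < j)) m′) n≡
      (best-map inj₁ (λ { (inj₁ v) → v }) best)
      (λ j m′ j<n A j≡ bst → best-map grow shrink
        (visit-best m′ (trans (Agrees.onᴺ A 11 0 refl) i≡) j≡ (spec j m′ j<n A j≡) bst))
      where
      grow : ∀ {i j i′ j′} → (V i′ j′ ⊎ (i′ ≡ i × j′ < j)) ⊎ (i′ ≡ i × j′ ≡ j) → V i′ j′ ⊎
          (i′ ≡ i × j′ < suc j)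
      grow (inj₁ (inj₁ v))          = inj₁ v
      grow (inj₁ (inj₂ (eq , j<)))  = inj₂ (eq , ℕₚ.m<n⇒m<1+n j<)
      grow (inj₂ (eq , refl))       = inj₂ (eq , ℕₚ.n<1+n _)
      shrink : ∀ {i j i′ j′} → V i′ j′ ⊎ (i′ ≡ i × j′ < suc j) → (V i′ j′ ⊎ (i′ ≡ i × j′ < j)) ⊎
          (i′ ≡ i × j′ ≡ j)
      shrink (inj₁ v) = inj₁ (inj₁ v)
      shrink (inj₂ (eq , s≤s j′≤j)) with ℕₚ.m≤n⇒m<n∨m≡n j′≤j
      ... | inj₁ j′<j = inj₁ (inj₂ (eq , j′<j))
      ... | inj₂ j′≡j = inj₂ (eq , j′≡j)

    scan-best : ∀ {n} m → nat m 0 0 ≡ n →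
      (∀ i j m′ → i < n → j < n → Agrees (scan z b e) m m′ → nat m′ 11 0 ≡ i → nat m′ 12 0 ≡ j →
          Spec i j m′) →
      BestIn (λ i j → i < n × j < n) (⟦ scan z b e ⟧ m)
    scan-best {n} m n≡ spec = for-rule 11 (scanRow z b e) refl m₁
      (λ i m′ → BestIn (λ i′ j′ → i′ < i × j′ < n) m′) n≡
      (none refl (λ ()))
      (λ i m′ i<n A i≡ bst → best-map grow shrink
        (scanRow-best m′ (trans (Agrees.onᴺ A 0 0 refl) n≡) i≡
          (λ j m″ j<n A′ j≡ → spec i j m″ i<n j<n (both A A′) (trans (Agrees.onᴺ A′ 11 0 refl) i≡) j≡) bst))
      where
      m₁ : Memory
      m₁ = ⟦ 8 ⟨ con 0 ⟩≔ᴺ con 0 ⟧ m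
      both : ∀ {m′ m″} → Agrees (for 11 (scanRow z b e)) m₁ m′ → Agrees (scanRow z b e) m′ m″ →
             Agrees (scan z b e) m m″
      both A A′ = record
        { onᴺ = λ a j s → let s₁ , s₂ = ∧-true {sparesᴺ (8 ⟨ con 0 ⟩≔ᴺ con 0) a j} s
                              s₃ , s₄ = ∧-true {not (does (11 ≟ a) ∧ does (0 ≟ j))} s₂ in
            trans (Agrees.onᴺ A′ a j s₄)
                (trans (Agrees.onᴺ A a j s₂) (frameᴺ (8 ⟨ con 0 ⟩≔ᴺ con 0) m a j s₁))
        ; onᵂ = λ a j s → trans (Agrees.onᵂ A′ a j s) (Agrees.onᵂ A a j s) }
      grow : ∀ {i i′ j′} → (i′ < i × j′ < n) ⊎ (i′ ≡ i × j′ < n) → i′ < suc i × j′ < n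
      grow (inj₁ (i′<i , j<n)) = ℕₚ.m<n⇒m<1+n i′<i , j<n
      grow (inj₂ (refl , j<n)) = ℕₚ.n<1+n _ , j<n
      shrink : ∀ {i i′ j′} → i′ < suc i × j′ < n → (i′ < i × j′ < n) ⊎ (i′ ≡ i × j′ < n)
      shrink (s≤s i′≤i , j<n) with ℕₚ.m≤n⇒m<n∨m≡n i′≤i
      ... | inj₁ i′<i = inj₁ (i′<i , j<n)
      ... | inj₂ i′≡i = inj₂ (i′≡i , j<n)

  -- A loop whose i-th round sets cell ι i of one array to f i; g reads the array.
  module _ (x : ℕ) (p : Prog) (wf : wellFormed (for x p) ≡ true) {a} {A : Set a} (g : Memory → ℕ → A)
           (counter-apart : ∀ y m c → g (storeᴺ x 0 y m) c ≡ g m c) where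

    update-loop : ∀ {n} m (ι : ℕ → ℕ) (f : ℕ → A) → nat m 0 0 ≡ n →
      (∀ {i j} → i < n → j < n → ι i ≡ ι j → i ≡ j) →
      (∀ i m′ → i < n → Agrees (for x p) m m′ → nat m′ x 0 ≡ i → g m′ (ι i) ≡ g m (ι i) →
        (∀ d → (∀ j → j < n → ι j ≢ d) → g m′ d ≡ g m d) →
        g (⟦ p ⟧ m′) (ι i) ≡ f i × (∀ d → d ≢ ι i → g (⟦ p ⟧ m′) d ≡ g m′ d)) →
      (∀ i → i < n → g (⟦ for x p ⟧ m) (ι i) ≡ f i) ×
      (∀ d → (∀ j → j < n → ι j ≢ d) → g (⟦ for x p ⟧ m) d ≡ g m d)
    update-loop {n} m ι f n≡ inj body =
      let done , _ , apart = for-rule x p wf m I n≡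
            ((λ _ _ ()) , (λ j _ _ → counter-apart 0 m (ι j)) , (λ d _ → counter-apart 0 m d)) step
      in (λ i i<n → done i i<n i<n) , apart
      where
      I : ℕ → Memory → Set a
      I i m′ = (∀ j → j < n → j < i → g m′ (ι j) ≡ f j) ×
               (∀ j → j < n → i ≤ j → g m′ (ι j) ≡ g m (ι j)) ×
               (∀ d → (∀ j → j < n → ι j ≢ d) → g m′ d ≡ g m d)
      step : ∀ i m′ → i < n → Agrees (for x p) m m′ → nat m′ x 0 ≡ i → I i m′ → I (suc i) (round x p m′)
      step i m′ i<n A x≡ (done , todo , apart) with body i m′ i<n A x≡ (todo i i<n ℕₚ.≤-refl) apart
      ... | here≡ , there≡ =
          (λ { j j<n (s≤s j≤i) → trans (counter-apart _ _ (ι j)) (done′ j j<n (ℕₚ.m≤n⇒m<n∨m≡n j≤i)) })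
        , (λ j j<n i<j → trans (counter-apart _ _ (ι j))
             (trans (there≡ (ι j) (λ eq → ℕₚ.<⇒≢ i<j (sym (inj j<n i<n eq)))) (todo j j<n (ℕₚ.<⇒≤ i<j))))
        , (λ d d∉ → trans (counter-apart _ _ d) (trans (there≡ d (λ eq → d∉ i i<n (sym eq))) (apart d d∉)))
        where
        done′ : ∀ j → j < n → j < i ⊎ j ≡ i → g (⟦ p ⟧ m′) (ι j) ≡ f j
        done′ j j<n (inj₁ j<i)  = trans (there≡ (ι j) (λ eq → ℕₚ.<⇒≢ j<i (inj j<n i<n eq))) (done j j<n j<i)
        done′ j j<n (inj₂ refl) = here≡

  write-≡ : ∀ {a} {A : Set a} (f : ℕ → ℕ → A) b {i j} x → i ≡ j → write f b i x b j ≡ x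
  write-≡ f b x refl = write-here f b _ x

  write-≢ : ∀ {a} {A : Set a} (f : ℕ → ℕ → A) b {i j} x → i ≢ j → write f b i x b j ≡ f b j
  write-≢ f b {i} {j} x i≢j = write-other f b i x b j
    (trans (cong (does (b ≟ b) ∧_) (dec-false (i ≟ j) i≢j)) (Boolₚ.∧-zeroʳ _))

  -- Writing to a cell the value it is meant to have does no harm, so copying a matrix can do
  -- without asking whether two rounds hit the same cell.
  write-copy : ∀ {a} {A : Set a} (f : ℕ → ℕ → A) b (g : ℕ → A) {i j} → (i ≢ j → f b j ≡ g j) →
               write f b i (g i) b j ≡ g j
  write-copy f b g {i} {j} old with i ≟ j
  ... | yes refl = write-≡ f b (g i) refl
  ... | no  i≢j  = trans (write-≢ f b (g i) i≢j) (old i≢j)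

  module _ {n : ℕ} (a : ℕ) (wf : wellFormed (for 11 (relabelCode a)) ≡ true) (apart : does (11 ≟ a) ≡ false)
           (spares₁₃ : sparesᴺ (for 11 (relabelCode a)) 13 0 ≡ true)
           (spares₁₄ : sparesᴺ (for 11 (relabelCode a)) 14 0 ≡ true) where

    relabel-loop : ∀ m {h h′ : Fin n → Fin n} {u v} → nat m 0 0 ≡ n →
      nat m 13 0 ≡ toℕ u → nat m 14 0 ≡ toℕ v → (∀ x → nat m a (toℕ x) ≡ toℕ (h x)) →
      Forests.Relabels u v h h′ → ∀ x → nat (⟦ for 11 (relabelCode a) ⟧ m) a (toℕ x) ≡ toℕ (h′ x)
    relabel-loop m {h} {h′} {u} {v} n≡ u≡ v≡ holds rel x =
      trans (proj₁ loop (toℕ x) (Finₚ.toℕ<n x)) (trans (cong renamed (holds x)) (renamed≡ (rel x)))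
      where
      renamed : ℕ → ℕ
      renamed i = if does (i ≟ toℕ v) then toℕ u else i

      renamed-v : ∀ {i} → i ≡ toℕ v → renamed i ≡ toℕ u
      renamed-v {i} eq rewrite dec-true (i ≟ toℕ v) eq = refl

      renamed-other : ∀ {i} → i ≢ toℕ v → renamed i ≡ i
      renamed-other {i} neq rewrite dec-false (i ≟ toℕ v) neq = refl

      renamed≡ : ∀ {x} → (h x ≡ v × h′ x ≡ u) ⊎ (h x ≢ v × h′ x ≡ h x) → renamed (toℕ (h x)) ≡ toℕ (h′ x)
      renamed≡ (inj₁ (eq , eq′))  = trans (renamed-v (cong toℕ eq)) (cong toℕ (sym eq′))
      renamed≡ (inj₂ (neq , eq′)) = trans (renamed-other (neq ∘ Finₚ.toℕ-injective)) (cong toℕ (sym eq′))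

      loop : (∀ i → i < n → nat (⟦ for 11 (relabelCode a) ⟧ m) a i ≡ renamed (nat m a i)) × _
      loop = update-loop 11 (relabelCode a) wf (λ m → nat m a)
        (λ y m c → write-other (nat m) 11 0 y a c (cong (_∧ does (0 ≟ c)) apart)) m id
            (λ i → renamed (nat m a i))
        n≡ (λ _ _ eq → eq)
        λ { i m′ _ A refl old _ → if-rule
            (λ m″ → nat m″ a i ≡ renamed (nat m a i) × (∀ d → d ≢ i → nat m″ a d ≡ nat m′ a d))
            (at a (cell 11) ≡ᴺ cell 14) (a ⟨ cell 11 ⟩≔ᴺ cell 13) skip m′ (nat m′ a i ≟ nat m′ 14 0) refl
            (λ eq → trans (write-≡ (nat m′) a (nat m′ 13 0) refl)
                (trans (Agrees.onᴺ A 13 0 spares₁₃)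
                    (trans u≡ (sym (renamed-v (trans (sym old) (trans eq (v≡′ A)))))))
              , λ d d≢ → write-≢ (nat m′) a (nat m′ 13 0) (d≢ ∘ sym))
            (λ neq → trans old (sym (renamed-other (λ eq → neq (trans old (trans eq (sym (v≡′ A)))))))
              , λ _ _ → refl) }
        where
        v≡′ : ∀ {m′} → Agrees (for 11 (relabelCode a)) m m′ → nat m′ 14 0 ≡ toℕ v
        v≡′ A = trans (Agrees.onᴺ A 14 0 spares₁₄) v≡

-- Row-major indices

row-< : ∀ {n i j i′} j′ → i < i′ → j < n → i * n + j < i′ * n + j′
row-< {n} {i} {j} {i′} j′ i<i′ j<n = begin-strict
  i * n + j   <⟨ ℕₚ.+-monoʳ-< (i * n) j<n ⟩
  i * n + n   ≡⟨ ℕₚ.+-comm (i * n) n ⟩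
  suc i * n   ≤⟨ ℕₚ.*-monoˡ-≤ n i<i′ ⟩
  i′ * n      ≤⟨ ℕₚ.m≤m+n _ j′ ⟩
  i′ * n + j′ ∎
  where open ℕₚ.≤-Reasoning

index-injective : ∀ i i′ {n j j′} → j < n → j′ < n → i * n + j ≡ i′ * n + j′ → i ≡ i′ × j ≡ j′
index-injective i i′ {n} {j} {j′} j<n j′<n eq with ℕₚ.<-cmp i i′
... | tri≈ _ refl _ = refl , ℕₚ.+-cancelˡ-≡ (i * n) j j′ eq
... | tri< i<i′ _ _ = contradiction eq (ℕₚ.<⇒≢ (row-< j′ i<i′ j<n))
... | tri> _ _ i′<i = contradiction (sym eq) (ℕₚ.<⇒≢ (row-< j i′<i j′<n))

entry : (row column : NatExp) → NatExp
entry i j = (i ⊗ cell 0) ⊕ j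

-- Memory layout and its preservation

module Layout {c ℓ} (𝔽 : OrderedField c ℓ) {n : ℕ} (k : ℕ) (G : MRSD.WeightedCompleteGraph 𝔽 n) where
  open RAM 𝔽
  open Programs 𝔽
  open MRSD 𝔽
  open Algorithm k G
  open Contraction

  bounded : ∀ {i} → i < n → ∃[ v ] toℕ {n} v ≡ i
  bounded i<n = fromℕ< i<n , Finₚ.toℕ-fromℕ< i<n

  readᴺ : ∀ {p m m′} → Agrees p m m′ → ∀ a {i j} → i ≡ j → sparesᴺ p a j ≡ true → nat m′ a i ≡ nat m a j
  readᴺ A a refl s = Agrees.onᴺ A a _ s

  readᵂ : ∀ {p m m′} → Agrees p m m′ → ∀ a {i j} → i ≡ j → sparesᵂ p a j ≡ true →
      weight m′ a i ≡ weight m a j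
  readᵂ A a refl s = Agrees.onᵂ A a _ s

  module _ {m m′ : Memory} where

    input-frame : nat m′ 0 0 ≡ nat m 0 0 → nat m′ 0 1 ≡ nat m 0 1 →
      (∀ i → weight m′ 0 i ≡ weight m 0 i) → HoldsInput m → HoldsInput m′
    input-frame e₀ e₁ w₀ h = record
      { n-cell = trans e₀ n-cell
      ; k-cell = trans e₁ k-cell
      ; d-cell = λ u v → trans (w₀ _) (d-cell u v) }
      where open HoldsInput h

    contraction-frame : ∀ {H} → (∀ i → nat m′ 1 i ≡ nat m 1 i) → (∀ i → nat m′ 2 i ≡ nat m 2 i) →
      (∀ i → weight m′ 1 i ≡ weight m 1 i) → HoldsContraction H m → HoldsContraction H m′
    contraction-frame e₁ e₂ w₁ h = record
      { alive = λ v v∈ → trans (e₁ _) (alive v v∈)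
      ; dead  = λ v v∉ → trans (e₁ _) (dead v v∉)
      ; homes = λ v → trans (e₂ _) (homes v)
      ; dists = λ u v u∈ v∈ → trans (w₁ _) (dists u v u∈ v∈) }
      where open HoldsContraction h

    edges-frame : ∀ {L} → nat m′ 0 2 ≡ nat m 0 2 → nat m′ 0 3 ≡ nat m 0 3 →
      (∀ i → nat m′ 3 i ≡ nat m 3 i) → (∀ i → nat m′ 4 i ≡ nat m 4 i) → HoldsEdges L m → HoldsEdges L m′
    edges-frame e₂ e₃ a₃ a₄ h = record
      { size  = trans e₃ size
      ; ends₁ = λ i → trans (a₃ _) (trans (cong (λ r → nat m 3 (r + toℕ i)) e₂) (ends₁ i))
      ; ends₂ = λ i → trans (a₄ _) (trans (cong (λ r → nat m 4 (r + toℕ i)) e₂) (ends₂ i)) }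
      where open HoldsEdges h

    cost-frame : ∀ κ → nat m′ 0 4 ≡ nat m 0 4 → weight m′ 2 2 ≡ weight m 2 2 → HoldsCost κ m →
        HoldsCost κ m′
    cost-frame [ x ] e w (h , h′) = trans e h , trans w h′
    cost-frame ⊤⁺    e w (lift h) = lift (trans e h)

    solution-frame : ∀ P → nat m′ 0 5 ≡ nat m 0 5 → (∀ i → nat m′ 7 i ≡ nat m 7 i) →
        HoldsSolution P m → HoldsSolution P m′
    solution-frame nothing  e _  h        = trans e h
    solution-frame (just P) e e₇ (h , h′) = trans e h , λ v → trans (e₇ _) (h′ v)

  -- In weight array 2 only the cost is protected, because cell 1 of that array receives the split.
  KeepsState : Prog → Set
  KeepsState p = ∀ i →
    sparesᴺ p 0 i ≡ true × sparesᴺ p 1 i ≡ true × sparesᴺ p 2 i ≡ true ×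
    sparesᴺ p 3 i ≡ true × sparesᴺ p 4 i ≡ true × sparesᴺ p 7 i ≡ true ×
    sparesᵂ p 0 i ≡ true × sparesᵂ p 1 i ≡ true × sparesᵂ p 2 2 ≡ true

  state-frame : ∀ {p m m′ σ} → Agrees p m m′ → KeepsState p → HoldsState σ m → HoldsState σ m′
  state-frame {p} {m} {m′} {σ} A keeps h = record
    { inputs      = input-frame (a₀ 0) (a₀ 1) w₀ inputs
    ; contraction = contraction-frame a₁ a₂ w₁ contraction
    ; edges       = edges-frame (a₀ 2) (a₀ 3) a₃ a₄ edges
    ; costs       = cost-frame (State.cost σ) (a₀ 4) w₂ costs
    ; solutions   = solution-frame (State.solution σ) (a₀ 5) a₇ solutions
    }
    where
    open HoldsState h
    open Agrees A
    a₀ : ∀ i → nat m′ 0 i ≡ nat m 0 i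
    a₀ i = let s , _ = keeps i in onᴺ 0 i s
    a₁ : ∀ i → nat m′ 1 i ≡ nat m 1 i
    a₁ i = let _ , s , _ = keeps i in onᴺ 1 i s
    a₂ : ∀ i → nat m′ 2 i ≡ nat m 2 i
    a₂ i = let _ , _ , s , _ = keeps i in onᴺ 2 i s
    a₃ : ∀ i → nat m′ 3 i ≡ nat m 3 i
    a₃ i = let _ , _ , _ , s , _ = keeps i in onᴺ 3 i s
    a₄ : ∀ i → nat m′ 4 i ≡ nat m 4 i
    a₄ i = let _ , _ , _ , _ , s , _ = keeps i in onᴺ 4 i s
    a₇ : ∀ i → nat m′ 7 i ≡ nat m 7 i
    a₇ i = let _ , _ , _ , _ , _ , s , _ = keeps i in onᴺ 7 i s
    w₀ : ∀ i → weight m′ 0 i ≡ weight m 0 i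
    w₀ i = let _ , _ , _ , _ , _ , _ , s , _ = keeps i in onᵂ 0 i s
    w₁ : ∀ i → weight m′ 1 i ≡ weight m 1 i
    w₁ i = let _ , _ , _ , _ , _ , _ , _ , s , _ = keeps i in onᵂ 1 i s
    w₂ : weight m′ 2 2 ≡ weight m 2 2
    w₂ = let _ , _ , _ , _ , _ , _ , _ , _ , s = keeps 0 in onᵂ 2 2 s

  alive⇒∈ : ∀ {H m} → HoldsContraction H m → ∀ v → nat m 1 (toℕ v) ≡ 1 → v ∈ˢ verts H
  alive⇒∈ {H} h v eq with v Subsetₚ.∈? verts H
  ... | yes v∈ = v∈
  ... | no  v∉ = contradiction (trans (sym eq) (HoldsContraction.dead h v v∉)) λ ()

-- Step (1)

gap : WeightExp
gap = at 1 (entry (cell 12) (cell 10))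

selectable : Test
selectable = (at 1 (cell 12) ≡ᴺ con 1) andᵗ (at 15 (cell 12) ≡ᴺ con 0)

relax updateGap : Prog
relax = 4 ⟨ cell 12 ⟩≔ᵂ gap
updateGap = if (cell 11 ≡ᴺ con 0) relax (if (gap ≤ᵂ at 4 (cell 12)) relax skip)

-- The centre of round t goes to cell k - 1 - t, as `FarthestFirst` lists the latest centre first.
storeCentre addCentre selectCode : Prog
storeCentre =
  5 ⟨ at 0 (con 1) ⊖ (cell 11 ⊕ con 1) ⟩≔ᴺ cell 10 ⨾
  15 ⟨ cell 10 ⟩≔ᴺ con 1
addCentre =
  8 ⟨ con 0 ⟩≔ᴺ con 0 ⨾
  scanRow largest selectable (at 4 (cell 12)) ⨾
  storeCentre ⨾
  for 12 updateGap
selectCode =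
  for 11 (15 ⟨ cell 11 ⟩≔ᴺ con 0) ⨾
  for 11 (if (notᵗ (at 0 (con 1) ≤ᴺ cell 11)) addCentre skip)

module Select {c ℓ} (𝔽 : OrderedField c ℓ) {n : ℕ} (k : ℕ) (G : MRSD.WeightedCompleteGraph 𝔽 n) where
  open OrderedField 𝔽
  open Ordered 𝔽
  open RAM 𝔽
  open Programs 𝔽
  open Loops 𝔽
  open MRSD 𝔽
  open Algorithm k G
  open Contraction
  open Layout 𝔽 k G

  module _ (H : Contraction n) where

    -- Nothing is known before the first centre: the stored distances are arbitrary, so the first
    -- scan yields an arbitrary vertex of G′, as the algorithm allows. `closer` then overwrites
    -- these distances without reading them.
    Picked : ∀ {t} → Vec (Fin n) t → Set (c ⊔ˡ ℓ)
    Picked []        = ⊤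
    Picked S@(_ ∷ _) = FarthestFirst H S

    Distance : ∀ {t} → Vec (Fin n) t → Fin n → Carrier → Set (c ⊔ˡ ℓ)
    Distance []        _ _ = ⊤
    Distance S@(_ ∷ _) v x = DistanceTo H S v x

    -- Like `Best`, it refers to the arrays instead of the memory, so that it survives the increment
    -- of the loop counter by computation.
    record Chosen (t : ℕ) (mark : ℕ → ℕ) (dist : ℕ → Carrier) (centre : ℕ → ℕ) : Set (c ⊔ˡ ℓ) where
      field
        {S}      : Vec (Fin n) t
        picked   : Picked S
        marked   : ∀ v → v ∈ⱽ S → mark (toℕ v) ≡ 1
        unmarked : ∀ v → v ∉ⱽ S → mark (toℕ v) ≡ 0
        distance : ∀ v → v ∈ˢ verts H → Distance S v (dist (toℕ v))
        centres  : ∀ j → centre (k ∸ t + toℕ j) ≡ toℕ (lookup S j)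

    ChosenIn : ℕ → Memory → Set (c ⊔ˡ ℓ)
    ChosenIn t m = Chosen t (nat m 15) (weight m 4) (nat m 5)

    closer : ℕ → Carrier → Carrier → Carrier
    closer zero    x y = x
    closer (suc _) x y with x ≤ᶠ? y
    ... | yes _ = x
    ... | no  _ = y

    closer-distance : ∀ {t} (S : Vec (Fin n) t) p v {y} → Distance S v y → Distance (p ∷ S) v
        (closer t (w H v p) y)
    closer-distance []      p v _ = (p , here refl , refl) , λ { _ (_ , here refl , refl) → ≤ᶠ-refl }
    closer-distance (_ ∷ S) p v {y} ((q , q∈ , y≡) , least) with w H v p ≤ᶠ? y
    ... | yes le = (p , here refl , refl) , λ
      { _ (_ , here refl , refl) → ≤ᶠ-refl ; z (r , there r∈ , z≡) → ≤ᶠ-trans le (least z (r , r∈ , z≡)) }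
    ... | no nle = (q , there q∈ , y≡) , λ
      { _ (_ , here refl , refl) → ≰⇒≥ᶠ nle ; z (r , there r∈ , z≡) → least z (r , r∈ , z≡) }

    updateGap-spec : ∀ m t p {j x} → nat m 11 0 ≡ t → nat m 12 0 ≡ j → nat m 0 0 ≡ n → nat m 10 0 ≡ p →
      weight m 1 (j * n + p) ≡ x →
      weight (⟦ updateGap ⟧ m) 4 j ≡ closer t x (weight m 4 j) ×
      (∀ d → d ≢ j → weight (⟦ updateGap ⟧ m) 4 d ≡ weight m 4 d)
    updateGap-spec m t p {j} {x} t≡ refl refl refl refl =
      if-rule (λ m′ → weight m′ 4 j ≡ closer t x (weight m 4 j) ×
          (∀ d → d ≢ j → weight m′ 4 d ≡ weight m 4 d))
        (cell 11 ≡ᴺ con 0) relax (if (gap ≤ᵂ at 4 (cell 12)) relax skip) m (nat m 11 0 ≟ 0) refl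
        (λ eq → trans (write-≡ (weight m) 4 x refl) (sym (closer-0 {t} (trans (sym t≡) eq))) ,
            λ d d≢ → write-≢ (weight m) 4 x (d≢ ∘ sym))
        (λ neq → if-rule (λ m′ → weight m′ 4 j ≡ closer t x (weight m 4 j) ×
            (∀ d → d ≢ j → weight m′ 4 d ≡ weight m 4 d))
          (gap ≤ᵂ at 4 (cell 12)) relax skip m (x ≤ᶠ? weight m 4 j) refl
          (λ le → trans (write-≡ (weight m) 4 x refl) (sym (closer-≤ {t} le)) , λ d d≢ → write-≢
              (weight m) 4 x (d≢ ∘ sym))
          (λ nle → sym (closer-≰ {t} (neq ∘ trans t≡) nle) , λ _ _ → refl))
      where
      closer-0 : ∀ {t y} → t ≡ 0 → closer t x y ≡ x
      closer-0 refl = refl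
      closer-≤ : ∀ {t y} → x ≤ᶠ y → closer t x y ≡ x
      closer-≤ {zero} le = refl
      closer-≤ {suc t} {y} le with x ≤ᶠ? y
      ... | yes _ = refl
      ... | no nle = contradiction le nle
      closer-≰ : ∀ {t y} → t ≢ 0 → ¬ (x ≤ᶠ y) → closer t x y ≡ y
      closer-≰ {zero} t≢0 _ = contradiction refl t≢0
      closer-≰ {suc t} {y} _ nle with x ≤ᶠ? y
      ... | yes le = contradiction le nle
      ... | no _ = refl

    module AddCentre {m : Memory} {t : ℕ} (n≡ : nat m 0 0 ≡ n) (k≡ : nat m 0 1 ≡ k) (hc : HoldsContraction H m)
                  (t≡ : nat m 11 0 ≡ t) (t<k : t < k) (enough : t < ∣ verts H ∣) (ch : ChosenIn t m) where
      open HoldsContraction hc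
      open Chosen ch

      Cand : ℕ → ℕ → Set
      Cand _ j = nat m 1 j ≡ 1 × nat m 15 j ≡ 0

      cand? : ∀ i j → Dec (Cand i j)
      cand? _ j = (nat m 1 j ≟ 1) ×-dec (nat m 15 j ≟ 0)

      open Scan largest selectable (at 4 (cell 12)) cand? (λ _ j → weight m 4 j) using
          (BestIn; none; some; scanRow-best)

      m₁ m₂ m₃ m₄ : Memory
      m₁ = storeᴺ 8 0 0 m
      m₂ = ⟦ scanRow largest selectable (at 4 (cell 12)) ⟧ m₁
      m₃ = ⟦ 5 ⟨ at 0 (con 1) ⊖ (cell 11 ⊕ con 1) ⟩≔ᴺ cell 10 ⟧ m₂
      m₄ = ⟦ storeCentre ⟧ m₂

      best : BestIn (λ i j → ⊥ ⊎ (i ≡ t × j < n)) m₂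
      best = scanRow-best m₁ n≡ t≡
        (λ j m′ _ A j≡ →
            cong₂ _∧_ (cong (λ x → does (x ≟ 1)) (readᴺ A 1 j≡ refl))
                (cong (λ x → does (x ≟ 0)) (readᴺ A 15 j≡ refl))
          , readᵂ A 4 j≡ refl)
        (none refl (λ ()))

      A₂ : Agrees (scanRow largest selectable (at 4 (cell 12))) m₁ m₂
      A₂ = agrees (scanRow largest selectable (at 4 (cell 12))) m₁

      module Extend (p : Fin n) (p≡ : nat m₂ 10 0 ≡ toℕ p) (p∈ : p ∈ˢ verts H) (p∉S : p ∉ⱽ S)
                    (farthest : ∀ v → v ∈ˢ verts H → v ∉ⱽ S → weight m 4 (toℕ v) ≤ᶠ weight m 4
                        (toℕ p)) where

        new : ℕ → Carrier
        new i = weight m 1 (i * n + toℕ p)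

        updated : (∀ i → i < n → weight (⟦ addCentre ⟧ m) 4 i ≡ closer t (new i) (weight m 4 i)) × _
        updated = update-loop 12 updateGap refl (λ m → weight m 4) (λ _ _ _ → refl) m₄ id
          (λ i → closer t (new i) (weight m 4 i)) n≡₄ (λ _ _ eq → eq)
          λ i m′ _ A i≡ old _ →
            let here≡ , there≡ = updateGap-spec m′ t (toℕ p) (trans (readᴺ A 11 refl refl) t≡₄) i≡
                  (trans (readᴺ A 0 refl refl) n≡₄) (trans (readᴺ A 10 refl refl) p≡)
                  (trans (readᵂ A 1 refl refl) (readᵂ A₂ 1 refl refl))
            in trans here≡ (cong (closer t (new i)) (trans old (readᵂ A₂ 4 refl refl))) , there≡
          where
          n≡₄ : nat m₄ 0 0 ≡ n
          n≡₄ = trans (readᴺ A₂ 0 refl refl) n≡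
          t≡₄ : nat m₄ 11 0 ≡ t
          t≡₄ = trans (readᴺ A₂ 11 refl refl) t≡

        A₅ : Agrees (for 12 updateGap) m₄ (⟦ addCentre ⟧ m)
        A₅ = agrees (for 12 updateGap) m₄

        mark-p : nat (⟦ addCentre ⟧ m) 15 (toℕ p) ≡ 1
        mark-p = trans (readᴺ A₅ 15 refl refl) (write-≡ (nat m₃) 15 1 p≡)

        mark-other : ∀ v → v ≢ p → nat (⟦ addCentre ⟧ m) 15 (toℕ v) ≡ nat m 15 (toℕ v)
        mark-other v v≢p = trans (readᴺ A₅ 15 refl refl)
          (trans (write-≢ (nat m₃) 15 1 (λ eq → v≢p (Finₚ.toℕ-injective (trans (sym eq) p≡))))
              (readᴺ A₂ 15 refl refl))

        slot : nat m₂ 0 1 ∸ (nat m₂ 11 0 + 1) ≡ k ∸ suc t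
        slot = cong₂ _∸_ (trans (readᴺ A₂ 0 refl refl) k≡)
                         (trans (ℕₚ.+-comm _ 1) (cong suc (trans (readᴺ A₂ 11 refl refl) t≡)))

        centre-p : nat (⟦ addCentre ⟧ m) 5 (k ∸ suc t) ≡ toℕ p
        centre-p = trans (readᴺ A₅ 5 refl refl) (trans (write-≡ (nat m₂) 5 (nat m₂ 10 0) slot) p≡)

        centre-other : ∀ {i} → k ∸ suc t ≢ i → nat (⟦ addCentre ⟧ m) 5 i ≡ nat m 5 i
        centre-other {i} neq = trans (readᴺ A₅ 5 refl refl)
          (trans (write-≢ (nat m₂) 5 (nat m₂ 10 0) (neq ∘ trans (sym slot))) (readᴺ A₂ 5 refl refl))

        k∸t : k ∸ t ≡ suc (k ∸ suc t)
        k∸t = ℕₚ.+-∸-assoc 1 t<k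

        -- The alternative `t ≡ 0` stands for the first centre, for which there are no distances to
        -- compare.
        picked′ : ∀ {t} {S : Vec (Fin n) t} {x} → Picked S → p ∉ⱽ S → Distance S p x →
                  (∀ q y → q ∈ˢ verts H → q ∉ⱽ S → Distance S q y → y ≤ᶠ x ⊎ t ≡ 0) → Picked (p ∷ S)
        picked′ {S = []}    _  _  _  _   = start p∈
        picked′ {S = _ ∷ _} pk p∉ ds far = add pk p∈ p∉ ds
          (λ q y q∈ q∉ dy → [ id , (λ ()) ]′ (far q y q∈ q∉ dy))

        distance-unique : ∀ {t} {S : Vec (Fin n) t} q {x y} → Distance S q x → Distance S q y →
            y ≤ᶠ x ⊎ t ≡ 0
        distance-unique {S = []}    q _        _              = inj₂ refl
        distance-unique {S = _ ∷ _} q (is , _) (_ , lower) = inj₁ (lower _ is)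

        extended : ChosenIn (suc t) (⟦ addCentre ⟧ m)
        extended = record
          { S        = p ∷ S
          ; picked   = picked′ picked p∉S (distance p p∈)
              (λ q y q∈ q∉S dy → [ (λ le → inj₁ (≤ᶠ-trans le (farthest q q∈ q∉S))) , inj₂ ]′
                (distance-unique q (distance q q∈) dy))
          ; marked   = marked′
          ; unmarked = λ v v∉ → trans (mark-other v (v∉ ∘ here)) (unmarked v (v∉ ∘ there))
          ; distance = λ v v∈ → subst (Distance (p ∷ S) v)
              (sym (trans (proj₁ updated (toℕ v) (Finₚ.toℕ<n v))
                (cong (λ x → closer t x (weight m 4 (toℕ v))) (dists v p v∈ p∈))))
              (closer-distance S p v (distance v v∈))
          ; centres  = centres′
          }
          where
          marked′ : ∀ v → v ∈ⱽ p ∷ S → nat (⟦ addCentre ⟧ m) 15 (toℕ v) ≡ 1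
          marked′ v v∈ with v Fin.≟ p | v∈
          ... | yes refl | _          = mark-p
          ... | no  v≢p  | here v≡p   = contradiction v≡p v≢p
          ... | no  v≢p  | there v∈S  = trans (mark-other v v≢p) (marked v v∈S)

          centres′ : ∀ j → nat (⟦ addCentre ⟧ m) 5 (k ∸ suc t + toℕ j) ≡ toℕ (lookup (p ∷ S) j)
          centres′ Fin.zero    = trans (cong (nat (⟦ addCentre ⟧ m) 5) (ℕₚ.+-identityʳ _)) centre-p
          centres′ (Fin.suc j) = trans (cong (nat (⟦ addCentre ⟧ m) 5) moved)
            (trans (centre-other (λ eq → ℕₚ.m≢1+m+n _ (trans eq (cong (_+ toℕ j) k∸t)))) (centres j))
            where
            moved : k ∸ suc t + suc (toℕ j) ≡ k ∸ t + toℕ j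
            moved = trans (ℕₚ.+-suc _ (toℕ j)) (cong (_+ toℕ j) (sym k∸t))

      result : ChosenIn (suc t) (⟦ addCentre ⟧ m)
      result with best
      -- There are more vertices in G′ than centres chosen, so the scan cannot come back empty.
      ... | none _ ∄ = let v , v∈ , v∉S = ∃-outside S (verts H) enough in
        contradiction (alive v v∈ , unmarked v v∉S) (∄ (inj₂ (refl , Finₚ.toℕ<n v)))
      ... | some _ _ (inj₂ (_ , j<n)) cd opt with bounded j<n
      ... | p , p≡ = Extend.extended p (sym p≡)
        (alive⇒∈ hc p (trans (cong (nat m 1) p≡) (proj₁ cd)))
        (λ p∈S → contradiction
            (trans (sym (proj₂ cd)) (trans (sym (cong (nat m 15) p≡)) (marked p p∈S))) λ ())
        (λ v v∈ v∉S → subst (weight m 4 (toℕ v) ≤ᶠ_) (cong (weight m 4) (sym p≡))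
          (opt (inj₂ (refl , Finₚ.toℕ<n v)) (alive v v∈ , unmarked v v∉S)))

  select-correct : ∀ {σ m} → HoldsState σ m → 1 ≤ k → k ≤ n → k ≤ ∣ verts (State.G′ σ) ∣ →
    ∃[ S ] FarthestFirst (State.G′ σ) S × Holds (selected σ S) (⟦ selectCode ⟧ m)
  select-correct {σ} {m} h 1≤k k≤n enough = finish k 1≤k final (λ j → cong (λ i → i + toℕ j) (ℕₚ.n∸n≡0 k))
    where
    H = State.G′ σ
    clear main : Prog
    clear = for 11 (15 ⟨ cell 11 ⟩≔ᴺ con 0)
    main = for 11 (if (notᵗ (at 0 (con 1) ≤ᴺ cell 11)) addCentre skip)
    m₁ : Memory
    m₁ = ⟦ clear ⟧ m
    n≡ : nat m 0 0 ≡ n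
    n≡ = HoldsInput.n-cell (HoldsState.inputs h)

    frame : ∀ {m m′} → Agrees main m m′ → HoldsState σ m → HoldsState σ m′
    frame A = state-frame A (λ _ → refl , refl , refl , refl , refl , refl , refl , refl , refl)

    h₁ : HoldsState σ m₁
    h₁ = state-frame (agrees clear m) (λ _ → refl , refl , refl , refl , refl , refl , refl , refl , refl) h

    cleared : ∀ i → i < n → nat m₁ 15 i ≡ 0
    cleared = proj₁ (update-loop 11 (15 ⟨ cell 11 ⟩≔ᴺ con 0) refl (λ m → nat m 15)
        (λ _ _ _ → refl) m id (λ _ → 0) n≡
      (λ _ _ eq → eq) λ { i m′ _ _ refl _ _ → write-≡ (nat m′) 15 0 refl , λ d d≢ → write-≢
          (nat m′) 15 0 (d≢ ∘ sym) })

    -- The loop has `n` rounds because every loop has; those from `k` on do nothing.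
    I : ℕ → Memory → Set (c ⊔ˡ ℓ)
    I i m = (i ≤ k × ChosenIn H i m) ⊎ (k ≤ i × ChosenIn H k m)

    looped : I n (⟦ main ⟧ m₁)
    looped = for-rule 11 (if (notᵗ (at 0 (con 1) ≤ᴺ cell 11)) addCentre skip) refl m₁ I
      (HoldsInput.n-cell (HoldsState.inputs h₁))
      (inj₁ (z≤n , record { S = [] ; picked = tt ; marked =
          λ _ () ; unmarked = λ v _ → cleared (toℕ v) (Finₚ.toℕ<n v)
                          ; distance = λ _ _ → tt ; centres = λ () }))
      body-step
      where
      body-step : ∀ i m′ → i < n → Agrees main m₁ m′ → nat m′ 11 0 ≡ i → I i m′ →
             I (suc i) (round 11 (if (notᵗ (at 0 (con 1) ≤ᴺ cell 11)) addCentre skip) m′)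
      body-step i m′ i<n A i≡ inv = if-rule (I (suc i)) (notᵗ (at 0 (con 1) ≤ᴺ cell 11)) addCentre skip m′
        (¬? (nat m′ 0 1 ≤? nat m′ 11 0)) refl
        (λ nle → let i<k = ℕₚ.≰⇒> (λ k≤i → nle (subst₂ _≤_ (sym k≡) (sym i≡) k≤i)) in
          inj₁ (i<k , AddCentre.result H {t = i} (HoldsInput.n-cell hi) k≡
              (HoldsState.contraction h′) i≡ i<k
            (ℕₚ.≤-trans i<k enough) (current i<k inv)))
        (λ nn → let k≤i = subst₂ _≤_ k≡ i≡ (decidable-stable (nat m′ 0 1 ≤? nat m′ 11 0) nn) in
          inj₂ (ℕₚ.m≤n⇒m≤1+n k≤i , complete k≤i inv))
        where
        h′ : HoldsState σ m′
        h′ = frame A h₁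
        hi : HoldsInput m′
        hi = HoldsState.inputs h′
        k≡ : nat m′ 0 1 ≡ k
        k≡ = HoldsInput.k-cell hi
        current : i < k → I i m′ → ChosenIn H i m′
        current i<k (inj₁ (_ , ch)) = ch
        current i<k (inj₂ (k≤i , _)) = contradiction k≤i (ℕₚ.<⇒≱ i<k)
        complete : k ≤ i → I i m′ → ChosenIn H k m′
        complete k≤i (inj₁ (i≤k , ch)) with ℕₚ.≤-antisym k≤i i≤k
        ... | refl = ch
        complete k≤i (inj₂ (_ , ch)) = ch

    final : ChosenIn H k (⟦ main ⟧ m₁)
    final = [ (λ { (n≤k , ch) → subst (λ t → ChosenIn H t (⟦ main ⟧ m₁))
        (ℕₚ.≤-antisym n≤k k≤n) ch }) , proj₂ ]′ looped

    -- Generalised from `k` to `t` so that `t` can be matched as a successor, where `Picked` amounts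
    -- to `FarthestFirst`.
    finish : ∀ t → 1 ≤ t → ChosenIn H t (⟦ main ⟧ m₁) → (∀ (j : Fin t) → k ∸ t + toℕ j ≡ toℕ j) →
      ∃[ S ] FarthestFirst H {t} S × HoldsState σ (⟦ main ⟧ m₁) ×
          (∀ j → nat (⟦ main ⟧ m₁) 5 (toℕ j) ≡ toℕ (lookup S j))
    finish (suc t) _ ch shift =
        Chosen.S ch , first (Chosen.S ch) (Chosen.picked ch) , frame (agrees main m₁) h₁
      , λ j → trans (cong (nat (⟦ main ⟧ m₁) 5) (sym (shift j))) (Chosen.centres ch j)
      where
      first : (S : Vec (Fin n) (suc t)) → Picked H S → FarthestFirst H S
      first (_ ∷ _) p = p

-- Step (2)

-- Centres have to be assigned to themselves. The weights of G′ are only tracked to be nonnegative,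
-- which does not settle ties in the scan, so `recentre` overwrites the labels of the centres. The
-- last loop passes from G′ to V through `home`.
nearestOf recentre assignCode : Prog
nearestOf =
  8 ⟨ con 0 ⟩≔ᴺ con 0 ⨾
  scanRow smallest (notᵗ (at 0 (con 1) ≤ᴺ cell 12)) (at 1 (entry (cell 11) (at 5 (cell 12)))) ⨾
  16 ⟨ cell 11 ⟩≔ᴺ cell 10
recentre = if (notᵗ (at 0 (con 1) ≤ᴺ cell 11)) (16 ⟨ at 5 (cell 11) ⟩≔ᴺ cell 11) skip
assignCode =
  for 11 nearestOf ⨾
  for 11 recentre ⨾
  for 11 (6 ⟨ cell 11 ⟩≔ᴺ at 16 (at 2 (cell 11)))

module Assign {c ℓ} (𝔽 : OrderedField c ℓ) {n : ℕ} (k : ℕ) (G : MRSD.WeightedCompleteGraph 𝔽 n) where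
  open OrderedField 𝔽
  open Ordered 𝔽
  open RAM 𝔽
  open Programs 𝔽
  open Loops 𝔽
  open MRSD 𝔽
  open Algorithm k G
  open Contraction
  open Layout 𝔽 k G

  centres-alive : ∀ {H : Contraction n} {t} {S : Vec (Fin n) t} → FarthestFirst H S → ∀ j →
      lookup S j ∈ˢ verts H
  centres-alive (start v∈)       Fin.zero    = v∈
  centres-alive (add _ p∈ _ _ _) Fin.zero    = p∈
  centres-alive (add f _ _ _ _)  (Fin.suc j) = centres-alive f j

  -- Prevents `recentre` from overwriting the label of one centre by that of another.
  centres-distinct : ∀ {H : Contraction n} {t} {S : Vec (Fin n) t} → FarthestFirst H S →
                     ∀ i j → lookup S i ≡ lookup S j → i ≡ j
  centres-distinct (start _)        Fin.zero    Fin.zero    _  = refl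
  centres-distinct (add _ _ _ _ _)  Fin.zero    Fin.zero    _  = refl
  centres-distinct (add {S = S} _ _ p∉ _ _) Fin.zero (Fin.suc j) eq =
    contradiction (subst (_∈ⱽ S) (sym eq) (∈-lookup j S)) p∉
  centres-distinct (add {S = S} _ _ p∉ _ _) (Fin.suc i) Fin.zero eq =
    contradiction (subst (_∈ⱽ S) eq (∈-lookup i S)) p∉
  centres-distinct (add f _ _ _ _)  (Fin.suc i) (Fin.suc j) eq = cong Fin.suc (centres-distinct f i j eq)

  module _ {σ : State} {S : Vec (Fin n) k} {m : Memory} (h : HoldsState σ m)
           (stored : ∀ j → nat m 5 (toℕ j) ≡ toℕ (lookup S j)) (ff : FarthestFirst (State.G′ σ) S)
               (1≤k : 1 ≤ k)
           (w-refl : ∀ u → w (State.G′ σ) u u ≡ 0#) (w-nonneg : ∀ u v → 0# ≤ᶠ w (State.G′ σ) u v) where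

    private
      H = State.G′ σ
      spread : Prog
      spread = 6 ⟨ cell 11 ⟩≔ᴺ at 16 (at 2 (cell 11))
      m₁ m₂ m₃ : Memory
      m₁ = ⟦ for 11 nearestOf ⟧ m
      m₂ = ⟦ for 11 recentre ⟧ m₁
      m₃ = ⟦ for 11 spread ⟧ m₂
    open HoldsContraction (HoldsState.contraction h)
    open HoldsInput (HoldsState.inputs h)

    -- Phrased through raw cells, as the loop also treats vertices merged away; their weights mean
    -- nothing but still have a minimum.
    Near : ℕ → ℕ → Set ℓ
    Near u a = a < k × (∀ j → j < k → weight m 1 (u * n + nat m 5 a) ≤ᶠ weight m 1 (u * n + nat m 5 j))

    module NearestOf {m′ : Memory} {u : ℕ} (A : Agrees (for 11 nearestOf) m m′) (u≡ : nat m′ 11 0 ≡ u) where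

      row : Prog
      row = scanRow smallest (notᵗ (at 0 (con 1) ≤ᴺ cell 12)) (at 1 (entry (cell 11) (at 5 (cell 12))))

      open Scan smallest (notᵗ (at 0 (con 1) ≤ᴺ cell 12)) (at 1 (entry (cell 11) (at 5 (cell 12))))
        {λ _ j → ¬ (k ≤ j)} (λ _ j → ¬? (k ≤? j)) (λ _ j → weight m 1 (u * n + nat m 5 j))
        using (BestIn; none; some; scanRow-best)

      m″ : Memory
      m″ = ⟦ row ⟧ (storeᴺ 8 0 0 m′)

      best : BestIn (λ i j → ⊥ ⊎ (i ≡ u × j < n)) m″
      best = scanRow-best (storeᴺ 8 0 0 m′) (trans (readᴺ A 0 refl refl) n-cell) u≡
        (λ j m‴ _ A′ j≡ →
            cong₂ (λ x y → not (does (x ≤? y)))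
                (trans (readᴺ A′ 0 refl refl) (trans (readᴺ A 0 refl refl) k-cell)) j≡
          , trans (readᵂ A′ 1
              (cong₂ _+_ (cong₂ _*_ (trans (readᴺ A′ 11 refl refl) u≡)
                  (trans (readᴺ A′ 0 refl refl) (trans (readᴺ A 0 refl refl) n-cell)))
                         (trans (readᴺ A′ 5 j≡ refl) (readᴺ A 5 refl refl))) refl) (readᵂ A 1 refl refl))
        (none refl (λ ()))

      near : k ≤ n → Near u (nat m″ 10 0)
      near k≤n with best
      ... | none _ ∄ = contradiction (ℕₚ.<⇒≱ 1≤k) (∄ (inj₂ (refl , ℕₚ.≤-trans 1≤k k≤n)))
      ... | some _ _ _ cd opt = ℕₚ.≰⇒> cd , λ j j<k → opt (inj₂ (refl , ℕₚ.≤-trans j<k k≤n)) (ℕₚ.<⇒≱ j<k)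

    module _ (k≤n : k ≤ n) where

      nearest-loop : ∀ u → u < n → Near u (nat m₁ 16 u)
      nearest-loop = for-rule 11 nearestOf refl m
          (λ i m′ → ∀ u → u < i → Near u (nat m′ 16 u)) n-cell (λ _ ())
        λ i m′ i<n A i≡ inv u u<1+i → extend i m′ A i≡ inv u (ℕₚ.m≤n⇒m<n∨m≡n (ℕₚ.≤-pred u<1+i))
        where
        extend : ∀ i m′ → Agrees (for 11 nearestOf) m m′ → nat m′ 11 0 ≡ i →
            (∀ u → u < i → Near u (nat m′ 16 u)) →
                 ∀ u → u < i ⊎ u ≡ i → Near u (nat (⟦ nearestOf ⟧ m′) 16 u)
        extend i m′ A i≡ inv u (inj₁ u<i) = subst (Near u)
          (sym (trans (write-≢ (nat m″) 16 (nat m″ 10 0) (λ eq → ℕₚ.<⇒≢ u<i (trans (sym eq) at-i)))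
              (frameᴺ row (storeᴺ 8 0 0 m′) 16 u refl))) (inv u u<i)
          where
          open NearestOf A i≡
          at-i : nat m″ 11 0 ≡ i
          at-i = trans (frameᴺ row (storeᴺ 8 0 0 m′) 11 0 refl) i≡
        extend i m′ A i≡ inv u (inj₂ refl) = subst (Near u)
          (sym (write-≡ (nat m″) 16 (nat m″ 10 0)
              (trans (frameᴺ row (storeᴺ 8 0 0 m′) 11 0 refl) i≡))) (near k≤n)
          where open NearestOf A i≡

      recentre-loop : (∀ j → toℕ j < n → nat m₂ 16 (toℕ (lookup S j)) ≡ toℕ j) ×
                      (∀ v → (∀ j → lookup S j ≢ v) → nat m₂ 16 (toℕ v) ≡ nat m₁ 16 (toℕ v))
      recentre-loop = for-rule 11 recentre refl m₁ I (trans (frameᴺ (for 11 nearestOf) m 0 0 refl) n-cell)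
        ((λ _ ()) , λ _ _ → refl)
        λ i m′ i<n A i≡ inv → if-rule (I (suc i)) (notᵗ (at 0 (con 1) ≤ᴺ cell 11))
            (16 ⟨ at 5 (cell 11) ⟩≔ᴺ cell 11) skip m′
          (¬? (nat m′ 0 1 ≤? nat m′ 11 0)) refl
          (λ nle → centre i m′ A i≡ (ℕₚ.≰⇒> (nle ∘ subst₂ _≤_ (sym (k≡ A)) (sym i≡))) inv)
          (λ nn → (λ j j<1+i → proj₁ inv j (ℕₚ.≤-trans (Finₚ.toℕ<n j)
              (subst₂ _≤_ (k≡ A) i≡ (decidable-stable (nat m′ 0 1 ≤? nat m′ 11 0) nn))))
            , proj₂ inv)
        where
        I : ℕ → Memory → Set
        I i m′ = (∀ j → toℕ j < i → nat m′ 16 (toℕ (lookup S j)) ≡ toℕ j) ×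
                 (∀ v → (∀ j → lookup S j ≢ v) → nat m′ 16 (toℕ v) ≡ nat m₁ 16 (toℕ v))
        k≡ : ∀ {m′} → Agrees (for 11 recentre) m₁ m′ → nat m′ 0 1 ≡ k
        k≡ A = trans (readᴺ A 0 refl refl) (trans (frameᴺ (for 11 nearestOf) m 0 1 refl) k-cell)
        centre : ∀ i m′ → Agrees (for 11 recentre) m₁ m′ → nat m′ 11 0 ≡ i → i < k → I i m′ →
                 I (suc i) (⟦ 16 ⟨ at 5 (cell 11) ⟩≔ᴺ cell 11 ⟧ m′)
        centre i m′ A i≡ i<k (set , apart) with fromℕ< i<k | Finₚ.toℕ-fromℕ< i<k
        ... | jᵢ | toℕ≡i = (λ j j<1+i → written j (ℕₚ.m≤n⇒m<n∨m≡n (ℕₚ.≤-pred j<1+i)))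
          , λ v v∉ → trans (write-≢ (nat m′) 16 (nat m′ 11 0)
              (λ eq → v∉ jᵢ (Finₚ.toℕ-injective (trans (sym target) eq)))) (apart v v∉)
          where
          target : nat m′ 5 (nat m′ 11 0) ≡ toℕ (lookup S jᵢ)
          target = trans (readᴺ A 5 (trans i≡ (sym toℕ≡i)) refl)
            (trans (frameᴺ (for 11 nearestOf) m 5 (toℕ jᵢ) refl) (stored jᵢ))
          written : ∀ j → toℕ j < i ⊎ toℕ j ≡ i → write (nat m′) 16 (nat m′ 5 (nat m′ 11 0))
              (nat m′ 11 0) 16 (toℕ (lookup S j)) ≡ toℕ j
          written j (inj₁ j<i) = trans (write-≢ (nat m′) 16 (nat m′ 11 0)
            (λ eq → ℕₚ.<⇒≢ j<i (trans
                (cong toℕ (centres-distinct ff j jᵢ (Finₚ.toℕ-injective (trans (sym eq) target))))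
                toℕ≡i))) (set j j<i)
          written j (inj₂ j≡i) = trans (write-≡ (nat m′) 16 (nat m′ 11 0)
            (trans target (cong (toℕ ∘ lookup S) (Finₚ.toℕ-injective (trans toℕ≡i (sym j≡i))))))
                (trans i≡ (sym j≡i))

      -- A centre has distance 0 from itself and no distance is negative, so its forced label is a
      -- nearest one. All other vertices keep the label found by the scan.
      assignment : ∀ v → ∃[ a ] nat m₂ 16 (toℕ v) ≡ toℕ {k} a ×
                   (v ∈ˢ verts H → ∀ j → w H v (lookup S a) ≤ᶠ w H v (lookup S j))
      assignment v with Finₚ.any? (λ j → lookup S j Fin.≟ v)
      ... | yes (a , refl) = a , proj₁ recentre-loop a (ℕₚ.≤-trans (Finₚ.toℕ<n a) k≤n)
        , λ _ j → subst (_≤ᶠ w H v (lookup S j)) (sym (w-refl v)) (w-nonneg v _)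
      ... | no ∄ with nearest-loop (toℕ v) (Finₚ.toℕ<n v)
      ...   | a<k , near = fromℕ< a<k
        , trans (proj₂ recentre-loop v (λ j eq → ∄ (j , eq))) (sym (Finₚ.toℕ-fromℕ< a<k))
        , λ v∈ j → subst₂ _≤ᶠ_
            (trans (cong (λ x → weight m 1 (toℕ v * n + nat m 5 x)) (sym (Finₚ.toℕ-fromℕ< a<k)))
                (distance v∈ _))
            (distance v∈ j) (near (toℕ j) (Finₚ.toℕ<n j))
        where
        distance : v ∈ˢ verts H → ∀ j → weight m 1 (toℕ v * n + nat m 5 (toℕ j)) ≡ w H v (lookup S j)
        distance v∈ j = trans (cong (λ x → weight m 1 (toℕ v * n + x)) (stored j))
            (dists v (lookup S j) v∈ (centres-alive ff j))

      assign-correct : ∃[ a ] NearestAssignment H S a × Holds (assigned σ (a ∘ home H)) (⟦ assignCode ⟧ m)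
      assign-correct = (λ v → proj₁ (assignment v))
        , record { centre  = λ j → Finₚ.toℕ-injective (trans (sym (proj₁ (proj₂ (assignment (lookup S j)))))
                                     (proj₁ recentre-loop j (ℕₚ.≤-trans (Finₚ.toℕ<n j) k≤n)))
                 ; nearest = λ v → proj₂ (proj₂ (assignment v)) }
        , state-frame (agrees assignCode m)
            (λ _ → refl , refl , refl , refl , refl , refl , refl , refl , refl) h
        , λ v → trans (spread-loop (toℕ v) (Finₚ.toℕ<n v))
            (trans (cong (nat m₂ 16) (homes v)) (proj₁ (proj₂ (assignment (home H v)))))
        where
        m₂-n : nat m₂ 0 0 ≡ n
        m₂-n = trans (frameᴺ (for 11 recentre) m₁ 0 0 refl)
            (trans (frameᴺ (for 11 nearestOf) m 0 0 refl) n-cell)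
        spread-loop : ∀ i → i < n → nat m₃ 6 i ≡ nat m₂ 16 (nat m 2 i)
        spread-loop = proj₁ (update-loop 11 spread refl (λ m → nat m 6) (λ _ _ _ → refl) m₂ id
          (λ i → nat m₂ 16 (nat m 2 i)) m₂-n (λ _ _ eq → eq)
          λ { i m′ _ A refl _ _ →
              trans (write-≡ (nat m′) 6 (nat m′ 16 (nat m′ 2 i)) refl)
                (readᴺ A 16 (trans (readᴺ A 2 refl refl)
                    (trans (frameᴺ (for 11 recentre) m₁ 2 i refl)
                    (frameᴺ (for 11 nearestOf) m 2 i refl))) refl)
            , λ d d≢ → write-≢ (nat m′) 6 (nat m′ 16 (nat m′ 2 i)) (d≢ ∘ sym) })

-- Step (3)

-- Weights can only be compared by `≤ᵂ`, so vanishing of the diameter is tested by two inequalities.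
apart together infinite : Test
apart    = notᵗ (at 6 (cell 11) ≡ᴺ at 6 (cell 12))
together = at 6 (cell 11) ≡ᴺ at 6 (cell 12)
infinite = (at 5 (con 0) ≤ᵂ zeroʷ) andᵗ (zeroʷ ≤ᵂ at 5 (con 0))

distance quotient : WeightExp
distance = at 0 (entry (cell 11) (cell 12))
quotient = at 2 (con 1) ⊘ at 5 (con 0)

-- Once the cost is +∞ no ratio exceeds it strictly, so `update` then stops at the flag.
measure recordSolution becomeInfinite becomeFinite update evaluateCode : Prog
measure =
  scan smallest apart distance ⨾
  2 ⟨ con 1 ⟩≔ᵂ at 3 (con 0) ⨾
  scan largest together distance ⨾
  5 ⟨ con 0 ⟩≔ᵂ at 3 (con 0)
recordSolution = 0 ⟨ con 5 ⟩≔ᴺ con 1 ⨾ for 11 (7 ⟨ cell 11 ⟩≔ᴺ at 6 (cell 11))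
becomeInfinite = recordSolution ⨾ 0 ⟨ con 4 ⟩≔ᴺ con 1
becomeFinite   = recordSolution ⨾ 2 ⟨ con 2 ⟩≔ᵂ quotient
update =
  if (at 0 (con 4) ≡ᴺ con 0)
    (if infinite becomeInfinite (if (quotient ≤ᵂ at 2 (con 2)) skip becomeFinite))
    skip
evaluateCode = measure ⨾ update

module Evaluate {c ℓ} (𝔽 : OrderedField c ℓ) {n : ℕ} (k : ℕ) (G : MRSD.WeightedCompleteGraph 𝔽 n) where
  open OrderedField 𝔽
  open Ordered 𝔽
  open RAM 𝔽
  open Programs 𝔽
  open Loops 𝔽
  open MRSD 𝔽
  open WeightedCompleteGraph G
  open Algorithm k G
  open Layout 𝔽 k G

  -- A closest pair among all separated pairs attains the split of the cluster of its first vertex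
  -- and bounds those of the others, so the minimum of minima takes a single scan. `diameter-of` is
  -- the dual.
  split-of : ∀ {P : Partition n k} {p q s} → P p ≢ P q → s ≡ d p q →
             (∀ p q → P p ≢ P q → s ≤ᶠ d p q) → IsSplit P s
  split-of {P} {p} {q} {s} sep s≡ bound =
      (P p , (p , q , refl , sep ∘ sym , s≡) ,
          λ { y (p′ , q′ , P≡ , P≢ , refl) → bound p′ q′ (λ eq → P≢ (trans (sym eq) P≡)) })
    , λ { i x ((p′ , q′ , P≡ , P≢ , refl) , _) → bound p′ q′ (λ eq → P≢ (trans (sym eq) P≡)) }

  diameter-of : ∀ {P : Partition n k} {p q δ} → P p ≡ P q → δ ≡ d p q →
                (∀ p q → P p ≡ P q → d p q ≤ᶠ δ) → IsDiameter P δ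
  diameter-of {P} {p} {q} {δ} tog δ≡ bound =
      (P p , (p , q , refl , sym tog , δ≡) ,
          λ { y (p′ , q′ , P≡ , P≡′ , refl) → bound p′ q′ (trans P≡ (sym P≡′)) })
    , λ { i x ((p′ , q′ , P≡ , P≡′ , refl) , _) → bound p′ q′ (trans P≡ (sym P≡′)) }

  ratio-infinite : ∀ {s δ} → δ ≡ 0# → ratio s δ ≡ ⊤⁺
  ratio-infinite {s} {δ} δ≡0 with δ ≟ᶠ 0#
  ... | yes _   = refl
  ... | no  δ≢0 = contradiction δ≡0 δ≢0

  ratio-finite : ∀ {s δ} → δ ≢ 0# → ratio s δ ≡ [ s /ᶠ δ ]
  ratio-finite {s} {δ} δ≢0 with δ ≟ᶠ 0#
  ... | yes δ≡0 = contradiction δ≡0 δ≢0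
  ... | no  _   = refl

  module _ {P : Partition n k} {m : Memory} (hi : HoldsInput m) (hp : HoldsPartition 6 P m) where
    open HoldsInput hi

    private
      m₁ m₂ m₃ : Memory
      m₁ = ⟦ scan smallest apart distance ⟧ m
      m₂ = storeᵂ 2 1 (weight m₁ 3 0) m₁
      m₃ = ⟦ scan largest together distance ⟧ m₂

      key : ℕ → ℕ → Carrier
      key i j = weight m 0 (i * n + j)

      same? : ∀ i j → Dec (nat m 6 i ≡ nat m 6 j)
      same? i j = nat m 6 i ≟ nat m 6 j

      module Closest = Scan smallest apart distance {λ i j → ¬ (nat m 6 i ≡ nat m 6 j)} (λ i j → ¬? (same? i j)) key
      module Furthest = Scan largest together distance same? key

    ≢-cells : ∀ p q → P p ≢ P q → nat m 6 (toℕ p) ≢ nat m 6 (toℕ q)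
    ≢-cells p q neq eq = neq (Finₚ.toℕ-injective (trans (sym (hp p)) (trans eq (hp q))))

    ≡-cells : ∀ p q → P p ≡ P q → nat m 6 (toℕ p) ≡ nat m 6 (toℕ q)
    ≡-cells p q eq = trans (hp p) (trans (cong toℕ eq) (sym (hp q)))

    split-scan : Closest.BestIn (λ i j → i < n × j < n) m₁
    split-scan = Closest.scan-best m n-cell λ i j m′ _ _ A i≡ j≡ →
        cong₂ (λ x y → not (does (x ≟ y))) (readᴺ A 6 i≡ refl) (readᴺ A 6 j≡ refl)
      , readᵂ A 0 (cong₂ _+_ (cong₂ _*_ i≡ (trans (readᴺ A 0 refl refl) n-cell)) j≡) refl

    split-correct : (∃[ p ] ∃[ q ] P p ≢ P q) → IsSplit P (weight m₁ 3 0)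
    split-correct (p , q , P≢) = from split-scan
      where
      from : Closest.BestIn (λ i j → i < n × j < n) m₁ → IsSplit P (weight m₁ 3 0)
      from (Closest.none _ ∄) = contradiction (≢-cells p q P≢) (∄ (Finₚ.toℕ<n p , Finₚ.toℕ<n q))
      from (Closest.some _ x≡ (i< , j<) cd opt) =
        let p′ , p≡ = bounded i<
            q′ , q≡ = bounded j<
        in split-of {p = p′} {q = q′}
             (λ eq → cd (subst₂ (λ i j → nat m 6 i ≡ nat m 6 j) p≡ q≡ (≡-cells p′ q′ eq)))
             (trans x≡ (trans (sym (cong₂ key p≡ q≡)) (d-cell p′ q′)))
             (λ u v neq → subst₂ _≤ᶠ_ (sym x≡) (d-cell u v)
               (opt (Finₚ.toℕ<n u , Finₚ.toℕ<n v) (≢-cells u v neq)))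

    A₂ : ∀ a {j} → sparesᴺ (scan smallest apart distance) a j ≡ true → nat m₂ a j ≡ nat m a j
    A₂ a {j} sp = frameᴺ (scan smallest apart distance) m a j sp

    diameter-scan : Furthest.BestIn (λ i j → i < n × j < n) m₃
    diameter-scan = Furthest.scan-best m₂ (trans (A₂ 0 refl) n-cell) λ i j m′ _ _ A i≡ j≡ →
        cong₂ (λ x y → does (x ≟ y)) (trans (readᴺ A 6 i≡ refl) (A₂ 6 refl))
            (trans (readᴺ A 6 j≡ refl) (A₂ 6 refl))
      , trans (readᵂ A 0 (cong₂ _+_
          (cong₂ _*_ i≡ (trans (readᴺ A 0 refl refl) (trans (A₂ 0 refl) n-cell))) j≡) refl)
          (frameᵂ (scan smallest apart distance) m 0 (i * n + j) refl)

    diameter-correct : Fin n → IsDiameter P (weight m₃ 3 0)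
    diameter-correct v = from diameter-scan
      where
      from : Furthest.BestIn (λ i j → i < n × j < n) m₃ → IsDiameter P (weight m₃ 3 0)
      from (Furthest.none _ ∄) = contradiction refl (∄ (Finₚ.toℕ<n v , Finₚ.toℕ<n v))
      from (Furthest.some _ x≡ (i< , j<) cd opt) =
        let p′ , p≡ = bounded i<
            q′ , q≡ = bounded j<
        in diameter-of {p = p′} {q = q′}
             (Finₚ.toℕ-injective (trans (sym (trans (cong (nat m 6) (sym p≡)) (hp p′)))
               (trans cd (trans (cong (nat m 6) (sym q≡)) (hp q′)))))
             (trans x≡ (trans (sym (cong₂ key p≡ q≡)) (d-cell p′ q′)))
             (λ u v eq → subst₂ _≤ᶠ_ (d-cell u v) (sym x≡)
               (opt (Finₚ.toℕ<n u , Finₚ.toℕ<n v) (≡-cells u v eq)))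

    measured : (∃[ p ] ∃[ q ] P p ≢ P q) →
               IsSplit P (weight (⟦ measure ⟧ m) 2 1) × IsDiameter P (weight (⟦ measure ⟧ m) 5 0)
    measured sep = subst (IsSplit P) (sym (frameᵂ (scan largest together distance) m₂ 2 1 refl))
        (split-correct sep)
                 , diameter-correct (proj₁ sep)

  recorded : ∀ m → nat m 0 0 ≡ n → ∀ i → i < n → nat (⟦ recordSolution ⟧ m) 7 i ≡ nat m 6 i
  recorded m n≡ = proj₁
      (update-loop 11 (7 ⟨ cell 11 ⟩≔ᴺ at 6 (cell 11)) refl (λ m → nat m 7) (λ _ _ _ → refl)
    (storeᴺ 0 5 1 m) id (nat m 6) n≡ (λ _ _ eq → eq)
    λ { i m′ _ A refl _ _ → trans (write-≡ (nat m′) 7 (nat m′ 6 i) refl) (readᴺ A 6 refl refl)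
                          , λ d d≢ → write-≢ (nat m′) 7 (nat m′ 6 i) (d≢ ∘ sym) })

  module _ {σ : State} {P : Partition n k} {m : Memory} {s δ : Carrier}
           (h : HoldsState σ m) (hp : HoldsPartition 6 P m) (s≡ : weight m 2 1 ≡ s) (δ≡ : weight m 5 0 ≡ δ)
           (isS : IsSplit P s) (isD : IsDiameter P δ) where
    open HoldsState h
    open State σ

    Outcome : Memory → Set (c ⊔ˡ ℓ)
    Outcome m′ = ∃[ σ′ ] (assigned σ P ⟶ evaluated σ′ s) × HoldsState σ′ m′ × weight m′ 2 1 ≡ s

    private
      n≡ : nat m 0 0 ≡ n
      n≡ = HoldsInput.n-cell inputs
      solution′ : ∀ v → nat (⟦ recordSolution ⟧ m) 7 (toℕ v) ≡ toℕ (P v)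
      solution′ v = trans (recorded m n≡ (toℕ v) (Finₚ.toℕ<n v)) (hp v)

    keeping : ¬ (cost <⁺ ratio s δ) → Outcome m
    keeping ≮ = σ , keep isS isD ≮ , h , s≡

    infinite-case : ∀ x → cost ≡ [ x ] → δ ≡ 0# → Outcome (⟦ becomeInfinite ⟧ m)
    infinite-case x eq δ≡0 = record σ { cost = ratio s δ ; solution = just P }
      , improve isS isD (subst₂ _<⁺_ (sym eq) (sym (ratio-infinite δ≡0)) [ x ]<⊤⁺)
      , record
        { inputs      = input-frame (frameᴺ becomeInfinite m 0 0 refl) (frameᴺ becomeInfinite m 0 1 refl)
                          (λ i → frameᵂ becomeInfinite m 0 i refl) inputs
        ; contraction = contraction-frame (λ i → frameᴺ becomeInfinite m 1 i refl)
            (λ i → frameᴺ becomeInfinite m 2 i refl)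
                          (λ i → frameᵂ becomeInfinite m 1 i refl) contraction
        ; edges       = edges-frame (frameᴺ becomeInfinite m 0 2 refl) (frameᴺ becomeInfinite m 0 3 refl)
                          (λ i → frameᴺ becomeInfinite m 3 i refl)
                              (λ i → frameᴺ becomeInfinite m 4 i refl) edges
        ; costs       = subst (λ κ → HoldsCost κ (⟦ becomeInfinite ⟧ m)) (sym (ratio-infinite δ≡0))
            (lift refl)
        ; solutions   = frameᴺ (for 11 (7 ⟨ cell 11 ⟩≔ᴺ at 6 (cell 11))) (storeᴺ 0 5 1 m) 0 5 refl ,
            solution′
        }
      , trans (frameᵂ becomeInfinite m 2 1 refl) s≡

    finite-case : ∀ x → cost ≡ [ x ] → δ ≢ 0# → x <ᶠ s /ᶠ δ → Outcome (⟦ becomeFinite ⟧ m)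
    finite-case x eq δ≢0 x< = record σ { cost = ratio s δ ; solution = just P }
      , improve isS isD (subst₂ _<⁺_ (sym eq) (sym (ratio-finite δ≢0)) [ x< ])
      , record
        { inputs      = input-frame (frameᴺ becomeFinite m 0 0 refl) (frameᴺ becomeFinite m 0 1 refl)
                          (λ i → frameᵂ becomeFinite m 0 i refl) inputs
        ; contraction = contraction-frame (λ i → frameᴺ becomeFinite m 1 i refl)
            (λ i → frameᴺ becomeFinite m 2 i refl)
                          (λ i → frameᵂ becomeFinite m 1 i refl) contraction
        ; edges       = edges-frame (frameᴺ becomeFinite m 0 2 refl) (frameᴺ becomeFinite m 0 3 refl)
                          (λ i → frameᴺ becomeFinite m 3 i refl)
                              (λ i → frameᴺ becomeFinite m 4 i refl) edges
        ; costs       = subst (λ κ → HoldsCost κ (⟦ becomeFinite ⟧ m)) (sym (ratio-finite δ≢0))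
                          (trans (frameᴺ becomeFinite m 0 4 refl) (flag eq costs) ,
                           cong₂ _/ᶠ_ (trans (frameᵂ recordSolution m 2 1 refl) s≡)
                               (trans (frameᵂ recordSolution m 5 0 refl) δ≡))
        ; solutions   = frameᴺ (for 11 (7 ⟨ cell 11 ⟩≔ᴺ at 6 (cell 11))) (storeᴺ 0 5 1 m) 0 5 refl ,
            solution′
        }
      , trans (frameᵂ becomeFinite m 2 1 refl) s≡
      where
      flag : ∀ {κ} → κ ≡ [ x ] → HoldsCost κ m → nat m 0 4 ≡ 0
      flag refl (f , _) = f

    updated : Outcome (⟦ update ⟧ m)
    updated = if-rule Outcome (at 0 (con 4) ≡ᴺ con 0) test skip m (nat m 0 4 ≟ 0) refl
      (λ flag≡0 → finite flag≡0 cost refl costs) (λ flag≢0 → keeping (full flag≢0 cost costs))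
      where
      inner test : Prog
      inner = if (quotient ≤ᵂ at 2 (con 2)) skip becomeFinite
      test = if infinite becomeInfinite inner
      full : nat m 0 4 ≢ 0 → ∀ κ → HoldsCost κ m → ∀ {ρ} → ¬ (κ <⁺ ρ)
      full f≢0 [ x ] (f≡0 , _) _ = f≢0 f≡0
      full f≢0 ⊤⁺    _         ()
      finite : nat m 0 4 ≡ 0 → ∀ κ → cost ≡ κ → HoldsCost κ m → Outcome (⟦ test ⟧ m)
      finite f≡0 ⊤⁺    _  (lift f≡1) = contradiction (trans (sym f≡0) f≡1) λ ()
      finite _   [ x ] eq (_ , x≡) = if-rule Outcome infinite becomeInfinite inner m
        ((weight m 5 0 ≤ᶠ? 0#) ×-dec (0# ≤ᶠ? weight m 5 0)) refl
        (λ (le , ge) → infinite-case x eq (trans (sym δ≡) (≤ᶠ-antisym le ge)))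
        (λ nle → let δ≢0 = λ δ≡0 → nle (≤ᶠ-reflexive (trans δ≡ δ≡0) , ≤ᶠ-reflexive (sym (trans δ≡ δ≡0))) in
          if-rule Outcome (quotient ≤ᵂ at 2 (con 2)) skip becomeFinite m
              ((weight m 2 1 /ᶠ weight m 5 0) ≤ᶠ? weight m 2 2) refl
          (λ le → keeping (λ lt → smaller le (subst₂ _<⁺_ eq (ratio-finite δ≢0) lt)))
          (λ nle′ → finite-case x eq δ≢0
            (≰⇒≥ᶠ (nle′ ∘ value≤) , λ x≡q → nle′ (value≤ (≤ᶠ-reflexive (sym x≡q))))))
        where
        value≤ : s /ᶠ δ ≤ᶠ x → weight m 2 1 /ᶠ weight m 5 0 ≤ᶠ weight m 2 2
        value≤ = subst₂ _≤ᶠ_ (sym (cong₂ _/ᶠ_ s≡ δ≡)) (sym x≡)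
        smaller : weight m 2 1 /ᶠ weight m 5 0 ≤ᶠ weight m 2 2 → ¬ ([ x ] <⁺ [ s /ᶠ δ ])
        smaller le [ x≤q , x≢q ] = x≢q (≤ᶠ-antisym x≤q (subst₂ _≤ᶠ_ (cong₂ _/ᶠ_ s≡ δ≡) x≡ le))

  evaluate-correct : ∀ {σ P m} → HoldsState σ m → HoldsPartition 6 P m → (∃[ p ] ∃[ q ] P p ≢ P q) →
    ∃[ σ′ ] ∃[ s ] (assigned σ P ⟶ evaluated σ′ s) × Holds (evaluated σ′ s) (⟦ evaluateCode ⟧ m)
  evaluate-correct {σ} {P} {m} h hp sep =
    let isS , isD          = measured {P} (HoldsState.inputs h) hp sep
        σ′ , go , hs , s≡ = updated {σ} {P} {⟦ measure ⟧ m} h′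
          (λ v → trans (frameᴺ measure m 6 (toℕ v) refl) (hp v)) refl refl isS isD
    in σ′ , _ , go , hs , s≡
    where
    h′ : HoldsState σ (⟦ measure ⟧ m)
    h′ = state-frame (agrees measure m)
      (λ _ → refl , refl , refl , refl , refl , refl , refl , refl , refl) h

-- Step (4)

removed : NatExp
removed = at 0 (con 2)

mergeable : Test
mergeable = ((at 0 (con 1) ⊖ con 1) ≤ᴺ at 0 (con 3)) andᵗ
            (at 0 (entry (at 3 removed) (at 4 removed)) ≤ᵂ at 2 (con 1))

raiseTo : NatExp → NatExp → Prog
raiseTo i j = if (at 1 i ≤ᵂ at 1 j) (1 ⟨ i ⟩≔ᵂ at 1 j) skip

-- Both the row and the column pass alter the diagonal entry of the merged vertex, which is
-- therefore reset to zero after them.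
mergeHomes mergeRows mergeColumns mergeFirst contractCode : Prog
mergeHomes   = 13 ⟨ con 0 ⟩≔ᴺ at 2 (at 3 removed) ⨾ 14 ⟨ con 0 ⟩≔ᴺ at 2 (at 4 removed)
mergeRows    = for 11 (raiseTo (entry (cell 13) (cell 11)) (entry (cell 14) (cell 11)))
mergeColumns = for 11 (raiseTo (entry (cell 11) (cell 13)) (entry (cell 11) (cell 14)))
mergeFirst =
  mergeHomes ⨾ mergeRows ⨾ mergeColumns ⨾
  1 ⟨ entry (cell 13) (cell 13) ⟩≔ᵂ zeroʷ ⨾
  1 ⟨ cell 14 ⟩≔ᴺ con 0 ⨾
  for 11 (relabelCode 2) ⨾
  0 ⟨ con 2 ⟩≔ᴺ (removed ⊕ con 1) ⨾
  0 ⟨ con 3 ⟩≔ᴺ (at 0 (con 3) ⊖ con 1)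
contractCode = for 17 (if mergeable mergeFirst skip)

module ContractStep {c ℓ} (𝔽 : OrderedField c ℓ) {n : ℕ} (k : ℕ) (G : MRSD.WeightedCompleteGraph 𝔽 n) where
  open OrderedField 𝔽
  open Ordered 𝔽
  open RAM 𝔽
  open Programs 𝔽
  open Loops 𝔽
  open MRSD 𝔽
  open WeightedCompleteGraph G
  open Algorithm k G
  open Contraction
  open Layout 𝔽 k G
  open Trees 𝔽 k G
  open Forests {n} using (Tracks)

  raiseTo-spec : ∀ e f m {i j} → evalᴺ e m ≡ i → evalᴺ f m ≡ j →
    weight (⟦ raiseTo e f ⟧ m) 1 i ≡ weight m 1 i ⊔ᶠ weight m 1 j ×
    (∀ d → d ≢ i → weight (⟦ raiseTo e f ⟧ m) 1 d ≡ weight m 1 d)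
  raiseTo-spec e f m {i} {j} refl refl = if-rule
    (λ m′ → weight m′ 1 i ≡ weight m 1 i ⊔ᶠ weight m 1 j × (∀ d → d ≢ i → weight m′ 1 d ≡ weight m 1 d))
    (at 1 e ≤ᵂ at 1 f) (1 ⟨ e ⟩≔ᵂ at 1 f) skip m (weight m 1 i ≤ᶠ? weight m 1 j) refl
    (λ le → trans (write-≡ (weight m) 1 (weight m 1 j) refl) (sym (⊔ᶠ-right le))
          , λ d d≢ → write-≢ (weight m) 1 (weight m 1 j) (d≢ ∘ sym))
    (λ nle → sym (⊔ᶠ-left (≰⇒≥ᶠ nle)) , λ _ _ → refl)

  module MergeFirst {σ : State} {m : Memory} (h : HoldsState σ m) {p q : Fin n} {L′ : List (Edge n)} (L≡ : State.L σ ≡ (p , q) ∷ L′)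
                    (C : Consistent (State.G′ σ) ((p , q) ∷ L′)) where
    open HoldsState h
    open HoldsInput inputs
    open HoldsContraction contraction
    H = State.G′ σ
    u v : Fin n
    u = home H p
    v = home H q
    uᴺ vᴺ : ℕ
    uᴺ = toℕ u
    vᴺ = toℕ v

    u≢v : u ≢ v
    u≢v = home-distinct C

    uᴺ≢vᴺ : uᴺ ≢ vᴺ
    uᴺ≢vᴺ = u≢v ∘ Finₚ.toℕ-injective

    σ′ : State
    σ′ = record σ { G′ = merge u v H ; L = L′ }

    held : HoldsEdges ((p , q) ∷ L′) m
    held = subst (λ L → HoldsEdges L m) L≡ edges
    open HoldsEdges held

    W : ℕ → ℕ → Carrier
    W i j = weight m 1 (i * n + j)

    rows columns : Prog
    rows    = raiseTo (entry (cell 13) (cell 11)) (entry (cell 14) (cell 11))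
    columns = raiseTo (entry (cell 11) (cell 13)) (entry (cell 11) (cell 14))

    m₁ m₂ m₃ m₄ m₅ m₆ m₇ : Memory
    m₁ = ⟦ mergeHomes ⟧ m
    m₂ = ⟦ mergeRows ⟧ m₁
    m₃ = ⟦ mergeColumns ⟧ m₂
    m₄ = ⟦ 1 ⟨ entry (cell 13) (cell 13) ⟩≔ᵂ zeroʷ ⟧ m₃
    m₅ = ⟦ 1 ⟨ cell 14 ⟩≔ᴺ con 0 ⟧ m₄
    m₆ = ⟦ for 11 (relabelCode 2) ⟧ m₅
    m₇ = ⟦ mergeFirst ⟧ m

    u≡₁ : nat m₁ 13 0 ≡ uᴺ
    u≡₁ = trans (cong (nat m 2) (trans (cong (nat m 3) (sym (ℕₚ.+-identityʳ _))) (ends₁ Fin.zero)))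
        (homes p)
    v≡₁ : nat m₁ 14 0 ≡ vᴺ
    v≡₁ = trans (cong (nat m 2) (trans (cong (nat m 4) (sym (ℕₚ.+-identityʳ _))) (ends₂ Fin.zero)))
        (homes q)
    n≡₂ : nat m₂ 0 0 ≡ n
    n≡₂ = trans (frameᴺ mergeRows m₁ 0 0 refl) n-cell
    u≡₂ : nat m₂ 13 0 ≡ uᴺ
    u≡₂ = trans (frameᴺ mergeRows m₁ 13 0 refl) u≡₁
    v≡₂ : nat m₂ 14 0 ≡ vᴺ
    v≡₂ = trans (frameᴺ mergeRows m₁ 14 0 refl) v≡₁
    n≡₃ : nat m₃ 0 0 ≡ n
    n≡₃ = trans (frameᴺ mergeColumns m₂ 0 0 refl) n≡₂
    u≡₃ : nat m₃ 13 0 ≡ uᴺ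
    u≡₃ = trans (frameᴺ mergeColumns m₂ 13 0 refl) u≡₂
    v≡₃ : nat m₃ 14 0 ≡ vᴺ
    v≡₃ = trans (frameᴺ mergeColumns m₂ 14 0 refl) v≡₂

    row-loop : (∀ i → i < n → weight m₂ 1 (uᴺ * n + i) ≡ W uᴺ i ⊔ᶠ W vᴺ i) ×
               (∀ d → (∀ j → j < n → uᴺ * n + j ≢ d) → weight m₂ 1 d ≡ weight m 1 d)
    row-loop = update-loop 11 rows refl (λ m → weight m 1) (λ _ _ _ → refl) m₁ (λ i → uᴺ * n + i)
      (λ i → W uᴺ i ⊔ᶠ W vᴺ i) n-cell
      (λ i<n j<n eq → proj₂ (index-injective uᴺ uᴺ i<n j<n eq))
      λ i m′ i<n A i≡ old apart →
        let n′ = trans (readᴺ A 0 refl refl) n-cell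
            here≡ , there≡ = raiseTo-spec (entry (cell 13) (cell 11)) (entry (cell 14) (cell 11)) m′
              (cong₂ _+_ (cong₂ _*_ (trans (readᴺ A 13 refl refl) u≡₁) n′) i≡)
              (cong₂ _+_ (cong₂ _*_ (trans (readᴺ A 14 refl refl) v≡₁) n′) i≡)
        in trans here≡ (cong₂ _⊔ᶠ_ old
            (apart (vᴺ * n + i) (λ j j<n eq → uᴺ≢vᴺ (proj₁ (index-injective uᴺ vᴺ j<n i<n eq))))) , there≡

    column-loop : (∀ i → i < n → weight m₃ 1 (i * n + uᴺ) ≡ weight m₂ 1 (i * n + uᴺ) ⊔ᶠ weight m₂ 1
        (i * n + vᴺ)) ×
                  (∀ d → (∀ j → j < n → j * n + uᴺ ≢ d) → weight m₃ 1 d ≡ weight m₂ 1 d)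
    column-loop = update-loop 11 columns refl (λ m → weight m 1) (λ _ _ _ → refl) m₂ (λ i → i * n + uᴺ)
      (λ i → weight m₂ 1 (i * n + uᴺ) ⊔ᶠ weight m₂ 1 (i * n + vᴺ)) n≡₂
      (λ {i} {j} _ _ eq → proj₁ (index-injective i j (Finₚ.toℕ<n u) (Finₚ.toℕ<n u) eq))
      λ i m′ i<n A i≡ old apart →
        let n′ = trans (readᴺ A 0 refl refl) n≡₂
            here≡ , there≡ = raiseTo-spec (entry (cell 11) (cell 13)) (entry (cell 11) (cell 14)) m′
              (cong₂ _+_ (cong₂ _*_ i≡ n′) (trans (readᴺ A 13 refl refl) u≡₂))
              (cong₂ _+_ (cong₂ _*_ i≡ n′) (trans (readᴺ A 14 refl refl) v≡₂))
        in trans here≡ (cong₂ _⊔ᶠ_ old (apart (i * n + vᴺ) (λ j j<n eq →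
             uᴺ≢vᴺ (proj₂ (index-injective j i (Finₚ.toℕ<n u) (Finₚ.toℕ<n v) eq))))) , there≡

    off-row : ∀ (x y : Fin n) → x ≢ u → weight m₂ 1 (toℕ x * n + toℕ y) ≡ W (toℕ x) (toℕ y)
    off-row x y x≢u = proj₂ row-loop _ λ j j<n eq →
      x≢u (Finₚ.toℕ-injective (sym (proj₁ (index-injective uᴺ (toℕ x) j<n (Finₚ.toℕ<n y) eq))))

    off-column : ∀ (x y : Fin n) → y ≢ u → weight m₃ 1 (toℕ x * n + toℕ y) ≡ weight m₂ 1 (toℕ x * n + toℕ y)
    off-column x y y≢u = proj₂ column-loop _ λ j j<n eq →
      y≢u (Finₚ.toℕ-injective (sym (proj₂ (index-injective j (toℕ x) (Finₚ.toℕ<n u) (Finₚ.toℕ<n y) eq))))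

    corner : nat m₃ 13 0 * nat m₃ 0 0 + nat m₃ 13 0 ≡ uᴺ * n + uᴺ
    corner = cong₂ _+_ (cong₂ _*_ u≡₃ n≡₃) u≡₃

    off-corner : ∀ (x y : Fin n) → ¬ (x ≡ u × y ≡ u) → weight m₄ 1 (toℕ x * n + toℕ y) ≡ weight m₃ 1
        (toℕ x * n + toℕ y)
    off-corner x y neq = write-≢ (weight m₃) 1 0# λ eq →
      let a , b = index-injective uᴺ (toℕ x) (Finₚ.toℕ<n u) (Finₚ.toℕ<n y) (trans (sym corner) eq)
      in neq (Finₚ.toℕ-injective (sym a) , Finₚ.toℕ-injective (sym b))

    ∈-rest : ∀ {x} → x ∈ˢ verts H - v → x ∈ˢ verts H × x ≢ v
    ∈-rest x∈ = Subsetₚ.p─q⊆p (verts H) _ x∈ , λ { refl → x∉p-x (verts H) v x∈ }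

    dists₄ : ∀ x y → x ∈ˢ verts H - v → y ∈ˢ verts H - v →
             weight m₄ 1 (toℕ x * n + toℕ y) ≡ w (merge u v H) x y
    dists₄ x y x∈ y∈ with x Fin.≟ u | y Fin.≟ u
    ... | yes refl | yes refl = write-≡ (weight m₃) 1 0# corner
    ... | yes refl | no  y≢u  = trans (off-corner x y (y≢u ∘ proj₂)) (trans (off-column x y y≢u)
      (trans (proj₁ row-loop (toℕ y) (Finₚ.toℕ<n y))
        (cong₂ _⊔ᶠ_ (dists u y (proj₁ (∈-rest x∈)) (proj₁ (∈-rest y∈)))
                    (dists v y (Tracks.home∈ (Consistent.tracks C) q) (proj₁ (∈-rest y∈))))))
    -- The row pass changed only row u, so in row x the column pass still meets the original
    -- weights.
    ... | no  x≢u  | yes refl =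
        trans (off-corner x y (x≢u ∘ proj₁)) (trans (proj₁ column-loop (toℕ x) (Finₚ.toℕ<n x))
      (cong₂ _⊔ᶠ_ (trans (off-row x y x≢u) (dists x y (proj₁ (∈-rest x∈)) (proj₁ (∈-rest y∈))))
                  (trans (off-row x v x≢u)
                      (dists x v (proj₁ (∈-rest x∈)) (Tracks.home∈ (Consistent.tracks C) q)))))
    ... | no  x≢u  | no  y≢u  = trans (off-corner x y (x≢u ∘ proj₁)) (trans (off-column x y y≢u)
      (trans (off-row x y x≢u) (dists x y (proj₁ (∈-rest x∈)) (proj₁ (∈-rest y∈)))))

    to₄ : ∀ a i → sparesᴺ (mergeHomes ⨾ mergeRows ⨾ mergeColumns) a i ≡ true → nat m₄ a i ≡ nat m a i
    to₄ a i sp = frameᴺ (mergeHomes ⨾ mergeRows ⨾ mergeColumns) m a i sp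

    alive₅ : ∀ x → x ∈ˢ verts H - v → nat m₅ 1 (toℕ x) ≡ 1
    alive₅ x x∈ = trans (write-≢ (nat m₄) 1 0
        (λ eq → proj₂ (∈-rest x∈) (Finₚ.toℕ-injective (sym (trans (sym v≡₃) eq)))))
      (trans (to₄ 1 (toℕ x) refl) (alive x (proj₁ (∈-rest x∈))))

    dead₅ : ∀ x → x ∉ˢ verts H - v → nat m₅ 1 (toℕ x) ≡ 0
    dead₅ x x∉ with x Fin.≟ v
    ... | yes refl = write-≡ (nat m₄) 1 0 v≡₃
    ... | no  x≢v  = trans
        (write-≢ (nat m₄) 1 0 (λ eq → x≢v (Finₚ.toℕ-injective (sym (trans (sym v≡₃) eq)))))
      (trans (to₄ 1 (toℕ x) refl) (dead x (λ x∈ → x∉ (Subsetₚ.x∈p∧x≢y⇒x∈p-y x∈ x≢v))))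

    homes₆ : ∀ x → nat m₆ 2 (toℕ x) ≡ toℕ (home (merge u v H) x)
    homes₆ = relabel-loop 2 refl refl refl refl m₅ (trans (to₄ 0 0 refl) n-cell) u≡₃ v≡₃
      (λ x → trans (to₄ 2 (toℕ x) refl) (homes x)) (merge-relabels u v H)

    to₆ : ∀ i → nat m₆ 0 i ≡ nat m 0 i
    to₆ i = trans (frameᴺ (for 11 (relabelCode 2)) m₅ 0 i refl) (to₄ 0 i refl)

    shifted : ∀ i → nat m₇ 0 2 + i ≡ nat m 0 2 + suc i
    shifted i = trans (cong (_+ i) (trans (cong (_+ 1) (to₆ 2)) (ℕₚ.+-comm (nat m 0 2) 1)))
        (sym (ℕₚ.+-suc (nat m 0 2) i))

    merged : HoldsState σ′ m₇
    merged = record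
      { inputs      = input-frame (frameᴺ mergeFirst m 0 0 refl) (frameᴺ mergeFirst m 0 1 refl)
                        (λ i → frameᵂ mergeFirst m 0 i refl) inputs
      ; contraction = record
        { alive = λ x x∈ → trans (frameᴺ (for 11 (relabelCode 2)) m₅ 1 (toℕ x) refl) (alive₅ x x∈)
        ; dead  = λ x x∉ → trans (frameᴺ (for 11 (relabelCode 2)) m₅ 1 (toℕ x) refl) (dead₅ x x∉)
        ; homes = homes₆
        ; dists = λ x y x∈ y∈ → trans
            (frameᵂ (for 11 (relabelCode 2)) m₅ 1 (toℕ x * n + toℕ y) refl) (dists₄ x y x∈ y∈) }
      ; edges       = record
        { size  = cong (_∸ 1) (trans (to₆ 3) size)
        ; ends₁ = λ i → trans (frameᴺ mergeFirst m 3 _ refl)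
            (trans (cong (nat m 3) (shifted (toℕ i))) (ends₁ (Fin.suc i)))
        ; ends₂ = λ i → trans (frameᴺ mergeFirst m 4 _ refl)
            (trans (cong (nat m 4) (shifted (toℕ i))) (ends₂ (Fin.suc i))) }
      ; costs       = cost-frame (State.cost σ) (frameᴺ mergeFirst m 0 4 refl)
          (frameᵂ mergeFirst m 2 2 refl) costs
      ; solutions   = solution-frame (State.solution σ) (frameᴺ mergeFirst m 0 5 refl)
          (λ i → frameᴺ mergeFirst m 7 i refl) solutions
      }

  module _ (2≤k : 2 ≤ k) (σ₀ : State) (s : Carrier) where
    private
      withGraph : Contraction n → List (Edge n) → State
      withGraph H L = record σ₀ { G′ = H ; L = L }

    -- Covers both ways for step (4) to stop: for a list that is empty or too short the condition is
    -- vacuous, otherwise the first edge is too heavy.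
    Stuck : List (Edge n) → Set ℓ
    Stuck L = ∀ {p q L′} → L ≡ (p , q) ∷ L′ → Long L → ¬ (d p q ≤ᶠ s)

    ¬Long-[] : ¬ Long []
    ¬Long-[] long = ℕₚ.<⇒≱ (ℕₚ.∸-monoˡ-≤ 1 2≤k) long

    stuck-contract : ∀ {H} L → Stuck L → Contract s H L H L
    stuck-contract []            st = short ¬Long-[]
    stuck-contract ((p , q) ∷ L) st with (k ∸ 1) ≤? suc (length L)
    ... | no ¬long = short ¬long
    ... | yes long = heavy long (st refl long)

    -- A derivation of `Contract` is built from its end, whereas the loop performs the merges from
    -- the beginning; the merges made so far are therefore held as a function that prepends them.
    -- The last component shows that `n` rounds suffice: as long as the list is not stuck, each
    -- round has shortened it.
    Invariant : ℕ → Memory → Set (c ⊔ˡ ℓ)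
    Invariant i m = ∃[ H ] ∃[ L ] HoldsState (withGraph H L) m × weight m 2 1 ≡ s × Consistent H L ×
      (∀ {H′ L′} → Contract s H L H′ L′ → Contract s (State.G′ σ₀) (State.L σ₀) H′ L′) ×
      (length L + i ≤ length (State.L σ₀) ⊎ Stuck L)

    first-weight : ∀ {H L p q L′ m} → HoldsState (withGraph H L) m → L ≡ (p , q) ∷ L′ →
      weight m 0 (nat m 3 (nat m 0 2) * nat m 0 0 + nat m 4 (nat m 0 2)) ≡ d p q
    first-weight {p = p} {q} {L′} {m} h refl = trans
      (cong (weight m 0) (cong₂ _+_
          (cong₂ _*_ (trans (cong (nat m 3) (sym (ℕₚ.+-identityʳ _))) (ends₁ Fin.zero)) n-cell)
        (trans (cong (nat m 4) (sym (ℕₚ.+-identityʳ _))) (ends₂ Fin.zero)))) (d-cell p q)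
      where
      open HoldsEdges (HoldsState.edges h)
      open HoldsInput (HoldsState.inputs h)

    contract-round : ∀ i m → Invariant i m → Invariant (suc i) (⟦ if mergeable mergeFirst skip ⟧ m)
    contract-round i m (H , L , h , s≡ , C , from , progress) =
      if-rule (Invariant (suc i)) mergeable mergeFirst skip m
        (((nat m 0 1 ∸ 1) ≤? nat m 0 3) ×-dec (first ≤ᶠ? weight m 2 1)) refl
        (λ (long , le) → merging L refl (subst₂ _≤_ (cong (_∸ 1) k-cell) size long) le h C from progress)
        (λ stop → H , L , h , s≡ , C , from , inj₂ λ eq long le →
          stop (subst₂ _≤_ (cong (_∸ 1) (sym k-cell)) (sym size) long ,
                subst₂ _≤ᶠ_ (sym (first-weight h eq)) (sym s≡) le))
      where
      open HoldsEdges (HoldsState.edges h)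
      open HoldsInput (HoldsState.inputs h)
      first : Carrier
      first = weight m 0 (nat m 3 (nat m 0 2) * nat m 0 0 + nat m 4 (nat m 0 2))

      merging : ∀ L₁ → L ≡ L₁ → Long L₁ → first ≤ᶠ weight m 2 1 → HoldsState (withGraph H L₁) m →
          Consistent H L₁ →
        (∀ {H′ L′} → Contract s H L₁ H′ L′ → Contract s (State.G′ σ₀) (State.L σ₀) H′ L′) →
        length L₁ + i ≤ length (State.L σ₀) ⊎ Stuck L₁ → Invariant (suc i) (⟦ mergeFirst ⟧ m)
      merging []             _ long _  _  _ _ _ = contradiction long ¬Long-[]
      merging ((p , q) ∷ L′) _ long le h₁ C₁ from₁ pr =
          merge (home H p) (home H q) H , L′
        , MergeFirst.merged h₁ refl C₁
        , trans (frameᵂ mergeFirst m 2 1 refl) s≡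
        , Consistent-merge C₁
        , from₁ ∘ step long d≤s
        , inj₁ (subst (_≤ length (State.L σ₀)) (sym (ℕₚ.+-suc (length L′) i))
            ([ id , (λ st → contradiction d≤s (st refl long)) ]′ pr))
        where
        d≤s : d p q ≤ᶠ s
        d≤s = subst₂ _≤ᶠ_ (first-weight h₁ refl) s≡ le

    contract-correct : ∀ {m} → Holds (evaluated σ₀ s) m → Consistent (State.G′ σ₀) (State.L σ₀) →
      length (State.L σ₀) < n →
      ∃[ H ] ∃[ L ] Contract s (State.G′ σ₀) (State.L σ₀) H L × HoldsState (withGraph H L)
          (⟦ contractCode ⟧ m)
    contract-correct {m} (h , s≡) C L<n
      with for-rule 17 (if mergeable mergeFirst skip) refl m Invariant
          (HoldsInput.n-cell (HoldsState.inputs h))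
        (_ , _ , start-frame h , s≡ , C , id , inj₁ (ℕₚ.≤-reflexive (ℕₚ.+-identityʳ _)))
        (λ i m′ _ _ _ inv → increment-frame _ (contract-round i m′ inv))
      where
      counter-frame : ∀ {σ m} x → HoldsState σ m → HoldsState σ (storeᴺ 17 0 x m)
      counter-frame {m = m} x = state-frame (agrees (17 ⟨ con 0 ⟩≔ᴺ con x) m)
        (λ _ → refl , refl , refl , refl , refl , refl , refl , refl , refl)
      start-frame : HoldsState σ₀ m → HoldsState σ₀ (storeᴺ 17 0 0 m)
      start-frame = counter-frame 0
      increment-frame : ∀ {i m} x → Invariant i m → Invariant i (storeᴺ 17 0 x m)
      increment-frame x (H , L , h , rest) = H , L , counter-frame x h , rest
    ... | H , L , h′ , _ , _ , from , inj₂ stuck = H , L , from (stuck-contract L stuck) , h′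
    ... | H , L , h′ , _ , _ , from , inj₁ le    =
        contradiction (ℕₚ.≤-trans (ℕₚ.m≤n+m n (length L)) le) (ℕₚ.<⇒≱ L<n)

-- Initialisation

crossing : Test
crossing = notᵗ (cell 12 ≤ᴺ cell 11) andᵗ notᵗ (at 18 (cell 11) ≡ᴺ at 18 (cell 12))

edgeWeight : WeightExp
edgeWeight = at 0 (entry (cell 11) (cell 12))

-- `appendEdge` saves the labels of both ends in cells 13 and 14, because the relabelling loop
-- overwrites label cells while it runs.
copyEntry copyWeights setUp appendEdge addEdge growTree initialiseCode : Prog
copyEntry   = 1 ⟨ entry (cell 11) (cell 12) ⟩≔ᵂ at 0 (entry (cell 11) (cell 12))
copyWeights = for 11 (for 12 copyEntry)
setUp =
  for 11 (1 ⟨ cell 11 ⟩≔ᴺ con 1) ⨾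
  for 11 (2 ⟨ cell 11 ⟩≔ᴺ cell 11) ⨾
  for 11 (18 ⟨ cell 11 ⟩≔ᴺ cell 11) ⨾
  copyWeights ⨾
  0 ⟨ con 2 ⟩≔ᴺ con 0 ⨾
  0 ⟨ con 3 ⟩≔ᴺ con 0 ⨾
  0 ⟨ con 4 ⟩≔ᴺ con 0 ⨾
  0 ⟨ con 5 ⟩≔ᴺ con 0 ⨾
  2 ⟨ con 2 ⟩≔ᵂ zeroʷ
appendEdge =
  3 ⟨ at 0 (con 3) ⟩≔ᴺ cell 9 ⨾
  4 ⟨ at 0 (con 3) ⟩≔ᴺ cell 10 ⨾
  0 ⟨ con 3 ⟩≔ᴺ (at 0 (con 3) ⊕ con 1) ⨾
  13 ⟨ con 0 ⟩≔ᴺ at 18 (cell 9) ⨾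
  14 ⟨ con 0 ⟩≔ᴺ at 18 (cell 10)
addEdge = appendEdge ⨾ for 11 (relabelCode 18)
growTree = scan smallest crossing edgeWeight ⨾ if (cell 8 ≡ᴺ con 1) addEdge skip
initialiseCode = setUp ⨾ for 17 growTree

lookup-∷ʳ : ∀ {a p} {A : Set a} (P : ℕ → A → Set p) xs {x} → (∀ i → P (toℕ i) (List.lookup xs i)) →
            P (length xs) x → ∀ i → P (toℕ i) (List.lookup (xs ∷ʳ x) i)
lookup-∷ʳ P []       _   last Fin.zero    = last
lookup-∷ʳ P (_ ∷ xs) all last Fin.zero    = all Fin.zero
lookup-∷ʳ P (_ ∷ xs) all last (Fin.suc i) = lookup-∷ʳ (P ∘ suc) xs (all ∘ Fin.suc) last i

module Initialise {c ℓ} (𝔽 : OrderedField c ℓ) {n : ℕ} (k : ℕ) (G : MRSD.WeightedCompleteGraph 𝔽 n) where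
  open OrderedField 𝔽
  open Ordered 𝔽
  open RAM 𝔽
  open Programs 𝔽
  open Loops 𝔽
  open MRSD 𝔽
  open WeightedCompleteGraph G
  open Algorithm k G
  open Layout 𝔽 k G
  open Trees 𝔽 k G
  open Forests {n}

  fill-loop : ∀ a (e : NatExp) (f : ℕ → ℕ) → wellFormed (for 11 (a ⟨ cell 11 ⟩≔ᴺ e)) ≡ true → does
      (11 ≟ a) ≡ false →
    (∀ m {i} → nat m 11 0 ≡ i → evalᴺ e m ≡ f i) →
    ∀ m → nat m 0 0 ≡ n → ∀ i → i < n → nat (⟦ for 11 (a ⟨ cell 11 ⟩≔ᴺ e) ⟧ m) a i ≡ f i
  fill-loop a e f wf apart value m n≡ = proj₁ (update-loop 11 (a ⟨ cell 11 ⟩≔ᴺ e) wf (λ m → nat m a)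
    (λ y m c → write-other (nat m) 11 0 y a c (cong (_∧ does (0 ≟ c)) apart)) m id f n≡ (λ _ _ eq → eq)
    λ i m′ _ _ i≡ _ _ → trans (write-≡ (nat m′) a (evalᴺ e m′) i≡) (value m′ i≡)
                      , λ d d≢ → write-≢ (nat m′) a (evalᴺ e m′) (λ eq → d≢ (trans (sym eq) i≡)))

  copy-loop : ∀ m → nat m 0 0 ≡ n → ∀ u v → u < n → v < n →
              weight (⟦ copyWeights ⟧ m) 1 (u * n + v) ≡ weight m 0 (u * n + v)
  copy-loop m n≡ = for-rule 11 (for 12 copyEntry) refl m
    (λ i m′ → ∀ u v → u < i → v < n → Copied m′ (u * n + v)) n≡ (λ _ _ ())
    λ i m′ _ A i≡ old u v u<1+i v<n → let rows , row = row-loop i m′ A i≡ old in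
      [ (λ u<i → rows u v u<i v<n) , (λ { refl → row v v<n }) ]′ (ℕₚ.m≤n⇒m<n∨m≡n (ℕₚ.≤-pred u<1+i))
    where
    Copied : Memory → ℕ → Set c
    Copied m′ j = weight m′ 1 j ≡ weight m 0 j

    row-loop : ∀ i m′ → Agrees copyWeights m m′ → nat m′ 11 0 ≡ i →
      (∀ u v → u < i → v < n → Copied m′ (u * n + v)) →
      (∀ u v → u < i → v < n → Copied (⟦ for 12 copyEntry ⟧ m′) (u * n + v)) ×
      (∀ v → v < n → Copied (⟦ for 12 copyEntry ⟧ m′) (i * n + v))
    row-loop i m′ A i≡ old = for-rule 12 copyEntry refl m′
      (λ j m″ → (∀ u v → u < i → v < n → Copied m″ (u * n + v)) × (∀ v → v < j → Copied m″ (i * n + v)))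
      (trans (readᴺ A 0 refl refl) n≡) (old , λ _ ())
      λ j m″ j<n A′ j≡ (rows , row) →
        let target = cong₂ _+_
                (cong₂ _*_ (trans (readᴺ A′ 11 refl refl) i≡)
                (trans (readᴺ A′ 0 refl refl) (trans (readᴺ A 0 refl refl) n≡))) j≡
            written = λ {d} (keep : i * n + j ≢ d → Copied m″ d) →
              trans (cong₂ (λ x y → write (weight m″) 1 x y 1 d) target
                      (trans (cong (weight m″ 0) target)
                          (trans (readᵂ A′ 0 refl refl) (readᵂ A 0 refl refl))))
                (write-copy (weight m″) 1 (weight m 0) keep)
        in (λ u v u<i v<n → written (λ _ → rows u v u<i v<n))
         , (λ v v<1+j → written (λ neq → row v (ℕₚ.≤∧≢⇒< (ℕₚ.≤-pred v<1+j) (λ { refl → neq refl }))))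

  Stores : List (Edge n) → Memory → Set
  Stores L m = nat m 0 3 ≡ length L × (∀ i → nat m 3 (toℕ i) ≡ toℕ (proj₁ (List.lookup L i))) ×
               (∀ i → nat m 4 (toℕ i) ≡ toℕ (proj₂ (List.lookup L i)))

  -- The component `bound` is what makes the list sorted: a chosen edge is at most as heavy as any
  -- pair still unconnected, in particular as the edge chosen next.
  record Partial (L : List (Edge n)) (h : Fin n → Fin n) : Set (c ⊔ˡ ℓ) where
    field
      same      : ∀ x y → h x ≡ h y → Conn L x y
      conn      : ∀ x y → Conn L x y → h x ≡ h y
      oriented  : Oriented L
      forest    : Forest L
      sorted    : Sorted L
      promising : Promising L
      bound     : All (λ f → ∀ u v → u Fin.< v → ¬ Conn L u v → length-of f ≤ᶠ d u v) L

  -- Memory stores a new edge at the end, while `Forest`, `Conn` and `Promising-step` add it at the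
  -- front; the permutation `π` mediates.
  Partial-∷ʳ : ∀ {L h p q} → Partial L h → p Fin.< q → ¬ Conn L p q →
    (∀ u v → u Fin.< v → ¬ Conn L u v → d p q ≤ᶠ d u v) → ∀ {h′} → Relabels (h p) (h q) h h′ →
        Partial (L ∷ʳ (p , q)) h′
  Partial-∷ʳ {L} {h} {p} {q} P p<q ¬pq min rel = record
    { same      = λ x y eq → Conn-↭ π (relabel-same rel same conn x y eq)
    ; conn      = λ x y c → relabel-conn rel same conn x y (Conn-↭ (↭-sym π) c)
    ; oriented  = Allₚ.∷ʳ⁺ oriented p<q
    ; forest    = Forest-↭ π (¬pq , forest)
    ; sorted    = Sorted-∷ʳ L sorted (All.map (λ b → b p q p<q ¬pq) bound)
    ; promising = Promising-↭ π (Promising-step promising ¬pq min)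
    ; bound     = Allₚ.∷ʳ⁺ (All.map (λ b u v u<v ¬uv → b u v u<v (¬uv ∘ Conn-↭ π ∘ inj₁)) bound)
                    (λ u v u<v ¬uv → min u v u<v (¬uv ∘ Conn-↭ π ∘ inj₁))
    }
    where
    open Partial P
    π : (p , q) ∷ L ↭ L ∷ʳ (p , q)
    π = ↭-sym (↭ₚ.++-comm L ((p , q) ∷ []))

  -- After `n` rounds the first alternative would be a forest with `n` edges, impossible by
  -- `Forest-size`, so the tree spans.
  Invariant : ℕ → Memory → Set (c ⊔ˡ ℓ)
  Invariant i m = ∃[ L ] ∃[ h ] Partial L h × Stores L m × (∀ x → nat m 18 (toℕ x) ≡ toℕ (h x)) ×
                  (length L ≡ i ⊎ (∀ x y → Conn L x y))

  module Round {m : Memory} (hi : HoldsInput m) {i : ℕ} {L : List (Edge n)} {h : Fin n → Fin n} (P : Partial L h) (stores : Stores L m)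
               (labels : ∀ x → nat m 18 (toℕ x) ≡ toℕ (h x))
               (progress : length L ≡ i ⊎ (∀ x y → Conn L x y)) where
    open HoldsInput hi
    open Partial P

    Cand : ℕ → ℕ → Set
    Cand u v = ¬ (v ≤ u) × ¬ (nat m 18 u ≡ nat m 18 v)

    cand? : ∀ u v → Dec (Cand u v)
    cand? u v = ¬? (v ≤? u) ×-dec ¬? (nat m 18 u ≟ nat m 18 v)

    open Scan smallest crossing edgeWeight cand? (λ u v → weight m 0 (u * n + v)) using
        (BestIn; none; some; scan-best)

    m₁ m₂ : Memory
    m₁ = ⟦ scan smallest crossing edgeWeight ⟧ m
    m₂ = ⟦ appendEdge ⟧ m₁

    to₁ : ∀ a {j} → sparesᴺ (scan smallest crossing edgeWeight) a j ≡ true → nat m₁ a j ≡ nat m a j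
    to₁ a sp = frameᴺ (scan smallest crossing edgeWeight) m a _ sp

    best : BestIn (λ u v → u < n × v < n) m₁
    best = scan-best m n-cell λ u v m′ _ _ A u≡ v≡ →
        cong₂ _∧_ (cong₂ (λ x y → not (does (x ≤? y))) v≡ u≡)
                  (cong₂ (λ x y → not (does (x ≟ y))) (readᴺ A 18 u≡ refl) (readᴺ A 18 v≡ refl))
      , readᵂ A 0 (cong₂ _+_ (cong₂ _*_ u≡ (trans (readᴺ A 0 refl refl) n-cell)) v≡) refl

    candidate : ∀ u v → u Fin.< v → ¬ Conn L u v → Cand (toℕ u) (toℕ v)
    candidate u v u<v ¬uv = ℕₚ.<⇒≱ u<v , λ eq →
      ¬uv (same u v (Finₚ.toℕ-injective (trans (sym (labels u)) (trans eq (labels v)))))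

    -- Two unconnected vertices would be a candidate; as `Conn` is decidable, excluding this yields
    -- a connection.
    all-connected : (∀ {u v} → u < n × v < n → ¬ Cand u v) → ∀ x y → Conn L x y
    all-connected ∄ x y with Finₚ.<-cmp x y
    ... | tri< x<y _ _  =
        decidable-stable (Conn? L x y) (λ ¬xy → ∄ (Finₚ.toℕ<n x , Finₚ.toℕ<n y) (candidate x y x<y ¬xy))
    ... | tri≈ _ refl _ = Conn-refl L
    ... | tri> _ _ y<x  =
        Conn-sym L (decidable-stable (Conn? L y x)
        (λ ¬yx → ∄ (Finₚ.toℕ<n y , Finₚ.toℕ<n x) (candidate y x y<x ¬yx)))

    stores₁ : Stores L m₁
    stores₁ = trans (to₁ 0 refl) (proj₁ stores) , (λ i → trans (to₁ 3 refl) (proj₁ (proj₂ stores) i))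
            , (λ i → trans (to₁ 4 refl) (proj₂ (proj₂ stores) i))

    module Append (p q : Fin n) (p≡ : toℕ p ≡ nat m₁ 9 0) (q≡ : toℕ q ≡ nat m₁ 10 0) (p<q : p Fin.< q) (¬pq : ¬ Conn L p q)
                  (min : ∀ u v → u Fin.< v → ¬ Conn L u v → d p q ≤ᶠ d u v) where

      h′ : Fin n → Fin n
      h′ = proj₁ (relabel (h p) (h q) h)

      length-∷ʳ : length (L ∷ʳ (p , q)) ≡ suc (length L)
      length-∷ʳ = trans (Listₚ.length-++ L) (ℕₚ.+-comm (length L) 1)

      end-spec : ∀ {i x y} → i ≡ length L → x ≡ toℕ y →
        (f : ℕ → ℕ → ℕ) (a : ℕ) (end : Edge n → Fin n) → y ≡ end (p , q) →
        (∀ j → f a (toℕ j) ≡ toℕ (end (List.lookup L j))) →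
        ∀ j → write f a i x a (toℕ j) ≡ toℕ (end (List.lookup (L ∷ʳ (p , q)) j))
      end-spec refl refl f a end refl old =
          lookup-∷ʳ (λ j e → write f a (length L) (toℕ (end (p , q))) a j ≡ toℕ (end e)) L
        (λ j → trans (write-≢ f a _ (λ eq → ℕₚ.<⇒≢ (Finₚ.toℕ<n j) (sym eq))) (old j)) (write-≡ f a _ refl)

      labels₁ : ∀ x → nat m₁ 18 (toℕ x) ≡ toℕ (h x)
      labels₁ x = trans (to₁ 18 refl) (labels x)

      labels₃ : ∀ x → nat (⟦ for 11 (relabelCode 18) ⟧ m₂) 18 (toℕ x) ≡ toℕ (h′ x)
      labels₃ = relabel-loop 18 refl refl refl refl m₂ (trans (to₁ 0 refl) n-cell)
        (trans (cong (nat m₁ 18) (sym p≡)) (labels₁ p)) (trans (cong (nat m₁ 18) (sym q≡)) (labels₁ q))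
        labels₁ (proj₂ (relabel (h p) (h q) h))

      appended : Invariant (suc i) (⟦ addEdge ⟧ m₁)
      appended = L ∷ʳ (p , q) , h′ , Partial-∷ʳ P p<q ¬pq min (proj₂ (relabel (h p) (h q) h))
        , ( trans (to₃ 0 3 refl)
            (trans (ℕₚ.+-comm (nat m₁ 0 3) 1) (trans (cong suc (proj₁ stores₁)) (sym length-∷ʳ)))
          , (λ j → trans (to₃ 3 (toℕ j) refl)
              (end-spec (proj₁ stores₁) (sym p≡) (nat m₁) 3 proj₁ refl (proj₁ (proj₂ stores₁)) j))
          , (λ j → trans (to₃ 4 (toℕ j) refl) (end-spec (proj₁ stores₁) (sym q≡)
                     (nat (⟦ 3 ⟨ at 0 (con 3) ⟩≔ᴺ cell 9 ⟧ m₁)) 4 proj₂ refl (proj₂ (proj₂ stores₁)) j)))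
        , labels₃
        , inj₁ (trans length-∷ʳ ([ cong suc , (λ all → contradiction (all p q) ¬pq) ]′ progress))
        where
        to₃ : ∀ a j → sparesᴺ (for 11 (relabelCode 18)) a j ≡ true → nat
            (⟦ for 11 (relabelCode 18) ⟧ m₂) a j ≡ nat m₂ a j
        to₃ a j sp = frameᴺ (for 11 (relabelCode 18)) m₂ a j sp

    grown : Invariant (suc i) (⟦ growTree ⟧ m)
    grown = if-rule (Invariant (suc i)) (cell 8 ≡ᴺ con 1) addEdge skip m₁ (nat m₁ 8 0 ≟ 1) refl
        (found best) (finished best)
      where
      found : BestIn (λ u v → u < n × v < n) m₁ → nat m₁ 8 0 ≡ 1 → Invariant (suc i) (⟦ addEdge ⟧ m₁)
      found (none f≡0 _) f≡1 = contradiction (trans (sym f≡0) f≡1) λ ()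
      found (some _ _ (p< , q<) cd opt) _ with bounded p< | bounded q<
      ... | p , p≡ | q , q≡ = Append.appended p q p≡ q≡
        (ℕₚ.≰⇒> (λ le → proj₁ cd (subst₂ _≤_ q≡ p≡ le)))
        (λ c → proj₂ cd (subst₂ (λ u v → nat m 18 u ≡ nat m 18 v) p≡ q≡
          (trans (labels p) (trans (cong toℕ (conn p q c)) (sym (labels q))))))
        (λ u v u<v ¬uv → subst₂ _≤ᶠ_
            (trans (sym (cong₂ (λ x y → weight m 0 (x * n + y)) p≡ q≡)) (d-cell p q)) (d-cell u v)
          (opt (Finₚ.toℕ<n u , Finₚ.toℕ<n v) (candidate u v u<v ¬uv)))
      finished : BestIn (λ u v → u < n × v < n) m₁ → nat m₁ 8 0 ≢ 1 → Invariant (suc i) m₁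
      finished (some f≡1 _ _ _ _) f≢1 = contradiction f≡1 f≢1
      finished (none _ ∄) _ =
          L , h , P , stores₁ , (λ x → trans (to₁ 18 refl) (labels x)) , inj₂ (all-connected ∄)

  initialise-correct : ∀ {m} → HoldsInput m → Fin n →
    ∃[ L ] (input ⟶ loop ⟪ uncontracted G , L , [ 0# ] , nothing ⟫) ×
           HoldsState ⟪ uncontracted G , L , [ 0# ] , nothing ⟫ (⟦ initialiseCode ⟧ m)
  initialise-correct {m} hi v₀ = finish looped
    where
    open HoldsInput hi
    fill₁ fill₂ fill₁₈ clear : Prog
    fill₁ = for 11 (1 ⟨ cell 11 ⟩≔ᴺ con 1)
    fill₂ = for 11 (2 ⟨ cell 11 ⟩≔ᴺ cell 11)
    fill₁₈ = for 11 (18 ⟨ cell 11 ⟩≔ᴺ cell 11)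
    clear = copyWeights ⨾ 0 ⟨ con 2 ⟩≔ᴺ con 0 ⨾ 0 ⟨ con 3 ⟩≔ᴺ con 0 ⨾ 0 ⟨ con 4 ⟩≔ᴺ con 0 ⨾
            0 ⟨ con 5 ⟩≔ᴺ con 0 ⨾ 2 ⟨ con 2 ⟩≔ᵂ zeroʷ
    m₁ m₂ m₃ m₄ m₅ : Memory
    m₁ = ⟦ fill₁ ⟧ m
    m₂ = ⟦ fill₂ ⟧ m₁
    m₃ = ⟦ fill₁₈ ⟧ m₂
    m₄ = ⟦ setUp ⟧ m
    m₅ = ⟦ initialiseCode ⟧ m

    hi₄ : HoldsInput m₄
    hi₄ = input-frame (frameᴺ setUp m 0 0 refl) (frameᴺ setUp m 0 1 refl) (λ i → frameᵂ setUp m 0 i refl) hi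

    looped : Invariant n m₅
    looped = for-rule 17 growTree refl m₄ Invariant (HoldsInput.n-cell hi₄)
      ( [] , id
      , record { same = λ _ _ → id ; conn = λ _ _ → id ; oriented = [] ; forest = _ ; sorted =
          [] ; promising = Promising-[] ; bound = [] }
      , (refl , (λ ()) , (λ ()))
      , (λ x → trans (frameᴺ clear m₃ 18 (toℕ x) refl)
          (fill-loop 18 (cell 11) id refl refl (λ _ eq → eq) m₂
              (trans (frameᴺ fill₂ m₁ 0 0 refl) (trans (frameᴺ fill₁ m 0 0 refl) n-cell)) (toℕ x)
              (Finₚ.toℕ<n x)))
      , inj₁ refl )
      λ i m′ _ A _ (L , h , P , st , lb , pr) → Round.grown {m = m′}
        (input-frame (Agrees.onᴺ A 0 0 refl) (Agrees.onᴺ A 0 1 refl)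
            (λ i → Agrees.onᵂ A 0 i refl) hi₄) P st lb pr

    rest : ∀ a j → sparesᴺ (for 17 growTree) a j ≡ true → nat m₅ a j ≡ nat m₄ a j
    rest a j sp = frameᴺ (for 17 growTree) m₄ a j sp

    finish : Invariant n m₅ → ∃[ L ] (input ⟶ loop ⟪ uncontracted G , L , [ 0# ] , nothing ⟫) ×
             HoldsState ⟪ uncontracted G , L , [ 0# ] , nothing ⟫ m₅
    finish (L , h , P , _ , _ , inj₁ full) =
        contradiction full (ℕₚ.<⇒≢ (Forest-size L (Partial.forest P) v₀))
    finish (L , h , P , (size , e₁ , e₂) , _ , inj₂ all) = L
      , initialise (Promising-final (Partial.oriented P) (Partial.forest P , all)
          (Partial.promising P)) ↭-refl (Partial.sorted P)
      , record
        { inputs      = input-frame (rest 0 0 refl) (rest 0 1 refl)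
            (λ i → frameᵂ (for 17 growTree) m₄ 0 i refl) hi₄
        ; contraction = record
          { alive = λ v _ → trans (rest 1 (toℕ v) refl) (trans (frameᴺ clear m₃ 1 (toℕ v) refl)
              (trans (frameᴺ (fill₂ ⨾ fill₁₈) m₁ 1 (toℕ v) refl)
                (fill-loop 1 (con 1) (λ _ → 1) refl refl (λ _ _ → refl) m n-cell (toℕ v) (Finₚ.toℕ<n v))))
          ; dead  = λ v v∉ → contradiction Subsetₚ.∈⊤ v∉
          ; homes = λ v → trans (rest 2 (toℕ v) refl) (trans (frameᴺ clear m₃ 2 (toℕ v) refl)
              (trans (frameᴺ fill₁₈ m₂ 2 (toℕ v) refl)
                (fill-loop 2 (cell 11) id refl refl (λ _ eq → eq) m₁
                    (trans (frameᴺ fill₁ m 0 0 refl) n-cell) (toℕ v) (Finₚ.toℕ<n v))))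
          ; dists = λ u v _ _ → trans (frameᵂ (for 17 growTree) m₄ 1 (toℕ u * n + toℕ v) refl)
              (trans (copy-loop m₃ (trans (frameᴺ (fill₁ ⨾ fill₂ ⨾ fill₁₈) m 0 0 refl) n-cell)
                  (toℕ u) (toℕ v) (Finₚ.toℕ<n u) (Finₚ.toℕ<n v))
                (trans (frameᵂ (fill₁ ⨾ fill₂ ⨾ fill₁₈) m 0 (toℕ u * n + toℕ v) refl) (d-cell u v))) }
        ; edges       = record
          { size  = size
          ; ends₁ = λ i → trans (cong (λ r → nat m₅ 3 (r + toℕ i)) (rest 0 2 refl)) (e₁ i)
          ; ends₂ = λ i → trans (cong (λ r → nat m₅ 4 (r + toℕ i)) (rest 0 2 refl)) (e₂ i) }
        ; costs       = rest 0 4 refl , frameᵂ (for 17 growTree) m₄ 2 2 refl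
        ; solutions   = rest 0 5 refl
        }

-- The implementation and its constant

implementation : Implementation
implementation = record
  { initialise = compile initialiseCode
  ; continue   = (at 0 (con 1) ⊖ con 1) ≤ᴺ at 0 (con 3)
  ; select     = compile selectCode
  ; assign     = compile assignCode
  ; evaluate   = compile evaluateCode
  ; contract   = compile contractCode
  }

testCost roundFactor totalFactor : ℕ
testCost    = 1 + costᵗ (Implementation.continue implementation)
roundFactor = testCost + factor selectCode + factor assignCode + factor evaluateCode + factor contractCode
totalFactor = factor initialiseCode + roundFactor

round-cost : ∀ e s a v r N rest → 1 ≤ N →
  e + (s * N + (a * N + (v * N + (r * N + rest)))) ≤ (e + s + a + v + r) * N + rest
round-cost e s a v r N rest 1≤N = begin
  e + (s * N + (a * N + (v * N + (r * N + rest))))     ≤⟨ ℕₚ.+-monoˡ-≤ _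
      (ℕₚ.m≤m*n e N {{ℕ.>-nonZero 1≤N}}) ⟩
  e * N + (s * N + (a * N + (v * N + (r * N + rest)))) ≡⟨ arith e s a v r N rest ⟩
  (e + s + a + v + r) * N + rest                       ∎
  where
  open ℕₚ.≤-Reasoning
  arith : ∀ e s a v r N rest → e * N + (s * N + (a * N + (v * N + (r * N + rest)))) ≡
      (e + s + a + v + r) * N + rest
  arith = solve-∀

-- Total running time

module Analysis {c ℓ} (𝔽 : OrderedField c ℓ) {n : ℕ} (k : ℕ) (G : MRSD.WeightedCompleteGraph 𝔽 n)
                (3≤k : 3 ≤ k) (k≤n : k ≤ n) where
  open RAM 𝔽
  open Programs 𝔽
  open MRSD 𝔽
  open WeightedCompleteGraph G
  open Algorithm k G
  open Contraction
  open Trees 𝔽 k G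
  open Consistent
  private
    I = implementation
    module I = Implementation I

    1≤k : 1 ≤ k
    1≤k = ℕₚ.≤-trans (s≤s z≤n) 3≤k
    2≤k : 2 ≤ k
    2≤k = ℕₚ.≤-trans (s≤s (s≤s z≤n)) 3≤k
    1≤n : 1 ≤ n
    1≤n = ℕₚ.≤-trans 1≤k k≤n
    v₀ : Fin n
    v₀ = fromℕ< 1≤n
    instance
      nonZero : NonZero n
      nonZero = ℕ.>-nonZero 1≤n

  n-of : ∀ {σ m} → HoldsState σ m → nat m 0 0 ≡ n
  n-of h = HoldsInput.n-cell (HoldsState.inputs h)

  initialise-step : StepWithin I input (factor initialiseCode * n ^ 3)
  initialise-step m h =
    let u , run , le = time initialiseCode refl m (HoldsInput.n-cell h)
        L , go , h′  = Initialise.initialise-correct 𝔽 k G h v₀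
    in _ , _ , u , go , initialise run , h′ , le

  continue-value : ∀ {σ m} → HoldsState σ m → (nat m 0 1 ∸ 1) ≡ k ∸ 1 × nat m 0 3 ≡ length (State.L σ)
  continue-value h = cong (_∸ 1) (HoldsInput.k-cell (HoldsState.inputs h)) , HoldsEdges.size
      (HoldsState.edges h)

  enter-step : ∀ σ → Long (State.L σ) → StepWithin I (loop σ) testCost
  enter-step σ long m h = body σ , m , testCost , enter long
    , enter (dec-true (nat m 0 1 ∸ 1 ≤? nat m 0 3)
        (subst₂ _≤_ (sym (proj₁ (continue-value h))) (sym (proj₂ (continue-value h))) long))
    , h , ℕₚ.≤-refl

  exit-step : ∀ σ → ¬ Long (State.L σ) → StepWithin I (loop σ) testCost
  exit-step σ ¬long m h = output (State.solution σ) , m , testCost , exit ¬long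
    , exit (dec-false (nat m 0 1 ∸ 1 ≤? nat m 0 3)
        (¬long ∘ subst₂ _≤_ (proj₁ (continue-value h)) (proj₂ (continue-value h))))
    , lift (HoldsState.solutions h) , ℕₚ.≤-refl

  select-step : ∀ σ → Consistent (State.G′ σ) (State.L σ) → Long (State.L σ) →
                StepWithin I (body σ) (factor selectCode * n ^ 2)
  select-step σ C long m h =
    let u , run , le = time selectCode refl m (n-of h)
        S , ff , h′  = Select.select-correct 𝔽 k G h 1≤k k≤n many
    in _ , _ , u , select ff , select run , h′ , le
    where
    many : k ≤ ∣ verts (State.G′ σ) ∣
    many = ℕₚ.≤-trans (ℕₚ.m≤n+m∸n k 1) (ℕₚ.≤-trans (s≤s long) (enough C v₀))

  assign-step : ∀ σ {S} → Consistent (State.G′ σ) (State.L σ) → FarthestFirst (State.G′ σ) S →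
                StepWithin I (selected σ S) (factor assignCode * n ^ 2)
  assign-step σ C ff m (h , stored) =
    let u , run , le = time assignCode refl m (n-of h)
        a , na , h′  = Assign.assign-correct 𝔽 k G h stored ff 1≤k (w-refl C) (w-nonneg C) k≤n
    in _ , _ , u , assign na , assign run , h′ , le

  evaluate-step : ∀ σ {P} → (∃[ p ] ∃[ q ] P p ≢ P q) →
                  StepWithin I (assigned σ P) (factor evaluateCode * n ^ 2)
  evaluate-step σ apart m (h , hp) =
    let u , run , le     = time evaluateCode refl m (n-of h)
        σ′ , s , go , h′ = Evaluate.evaluate-correct 𝔽 k G h hp apart
    in _ , _ , u , go , evaluate run , h′ , le

  edges<n : ∀ {H L} → Consistent H L → length L < n
  edges<n {L = L} C = ℕₚ.≤-trans
      (s≤s (ℕₚ.≤-trans (ℕₚ.m≤m+n (length L) _) (ℕₚ.≤-reflexive (sym (Listₚ.length-++ L)))))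
    (Forests.Forest-size (L ++ R C) (forest C) v₀)

  contract-step : ∀ σ s → Consistent (State.G′ σ) (State.L σ) → StepWithin I (evaluated σ s)
      (factor contractCode * n ^ 2)
  contract-step σ s C m h =
    let u , run , le   = time contractCode refl m (n-of (proj₁ h))
        H , L , ct , h′ = ContractStep.contract-correct 𝔽 k G 2≤k σ s h C (edges<n C)
    in _ , _ , u , contract ct , contract run , h′ , le

  contract-consistent : ∀ {s H L H′ L′} → Contract s H L H′ L′ → Consistent H L →
                        Consistent H′ L′ × length L′ ≤ length L
  contract-consistent (short _)      C = C , ℕₚ.≤-refl
  contract-consistent (heavy _ _)    C = C , ℕₚ.≤-refl
  contract-consistent (step _ _ ct)  C with contract-consistent ct (Consistent-merge C)
  ... | C′ , le = C′ , ℕₚ.m≤n⇒m≤1+n le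

  -- The split joins two vertices of G′, so the first edge of L, being at most
  -- as heavy, is contracted.
  contract-progress : ∀ {s p q H L H′ L′} → Contract s H L H′ L′ → Consistent H L → Long L →
    home H p ≢ home H q → s ≡ d p q → suc (length L′) ≤ length L
  contract-progress (short ¬long)   C long sep s≡ = contradiction long ¬long
  contract-progress (heavy _ ≰s)    C long sep refl = contradiction (first-cheapest C sep) ≰s
  contract-progress (step _ _ ct)   C long sep s≡ =
      s≤s (proj₂ (contract-consistent ct (Consistent-merge C)))

  -- Centres are fixed by `home` and labelled by their own position, so labels 0 and 1 both occur.
  -- This gives the scan for the split a candidate.
  assignment-separates : ∀ {H S a} {L : List (Edge n)} → Consistent H L → FarthestFirst H S →
      NearestAssignment {k = k} H S a →
                         ∃[ p ] ∃[ q ] a (home H p) ≢ a (home H q)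
  assignment-separates {H} {S} {a} C ff na = centreOf i₀ , centreOf i₁ , λ eq →
    ℕₚ.1+n≢0 (sym (trans (sym (Finₚ.toℕ-fromℕ< 1≤k))
        (trans (cong toℕ (trans (sym (own i₀)) (trans eq (own i₁)))) (Finₚ.toℕ-fromℕ< 2≤k))))
    where
    centreOf : Fin k → Fin n
    centreOf = lookup S
    i₀ i₁ : Fin k
    i₀ = fromℕ< 1≤k
    i₁ = fromℕ< 2≤k
    own : ∀ j → a (home H (centreOf j)) ≡ j
    own j = trans (cong a (fixed C (Assign.centres-alive 𝔽 k G ff j))) (NearestAssignment.centre na j)

  split-separates : ∀ {H : Contraction n} {a : Fin n → Fin k} {s} → IsSplit (a ∘ home H) s →
                    ∃[ p ] ∃[ q ] home H p ≢ home H q × s ≡ d p q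
  split-separates {a = a} ((i , (p , q , p∈ , q∉ , s≡) , _) , _) =
    p , q , (λ eq → q∉ (trans (cong a (sym eq)) p∈)) , s≡

  module _ {bound rest : ℕ} (continues : ∀ σ → Consistent (State.G′ σ) (State.L σ) → suc (length (State.L σ)) ≤ bound →
                               CompletesWithin I (loop σ) rest) where

    evaluated-completes : ∀ σ s {p q} → Consistent (State.G′ σ) (State.L σ) → Long (State.L σ) →
        length (State.L σ) ≤ bound →
      home (State.G′ σ) p ≢ home (State.G′ σ) q → s ≡ d p q →
      CompletesWithin I (evaluated σ s) (factor contractCode * n ^ 2 + rest)
    evaluated-completes σ s C long le sep s≡ = next (contract-step σ s C)
      (λ { _ (contract ct) → continues _ (proj₁ (contract-consistent ct C))
             (ℕₚ.≤-trans (contract-progress ct C long sep s≡) le) }) ℕₚ.≤-refl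

    assigned-completes : ∀ σ {S} {a : Fin n → Fin k} → Consistent (State.G′ σ) (State.L σ) → Long
        (State.L σ) → length (State.L σ) ≤ bound →
      FarthestFirst (State.G′ σ) S → NearestAssignment (State.G′ σ) S a →
      CompletesWithin I (assigned σ (a ∘ home (State.G′ σ)))
        (factor evaluateCode * n ^ 2 + (factor contractCode * n ^ 2 + rest))
    assigned-completes σ {a = a} C long le ff na = next (evaluate-step σ (assignment-separates C ff na))
      (λ { _ (improve isS _ _) → proceed isS ; _ (keep isS _ _) → proceed isS }) ℕₚ.≤-refl
      where
      proceed : ∀ {s κ P} → IsSplit (a ∘ home (State.G′ σ)) s →
        CompletesWithin I (evaluated (record σ { cost = κ ; solution = P }) s)
          (factor contractCode * n ^ 2 + rest)
      proceed isS = let _ , _ , sep , s≡ = split-separates {State.G′ σ} {a} isS in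
        evaluated-completes _ _ C long le sep s≡

    body-completes : ∀ σ → Consistent (State.G′ σ) (State.L σ) → Long (State.L σ) → length
        (State.L σ) ≤ bound →
      CompletesWithin I (body σ) (factor selectCode * n ^ 2 + (factor assignCode * n ^ 2 +
        (factor evaluateCode * n ^ 2 + (factor contractCode * n ^ 2 + rest))))
    body-completes σ C long le = next (select-step σ C long)
      (λ { _ (select ff) → next (assign-step σ C ff)
        (λ { _ (assign na) → assigned-completes σ C long le ff na }) ℕₚ.≤-refl }) ℕₚ.≤-refl

  -- `bound` limits the number of loop tests, including the one that fails, hence the successor. The
  -- final exit is charged as a full round.
  loop-completes : ∀ bound σ → Consistent (State.G′ σ) (State.L σ) → suc (length (State.L σ)) ≤ bound →
                   CompletesWithin I (loop σ) (bound * (roundFactor * n ^ 2))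
  loop-completes (suc bound) σ C (s≤s le) with (k ∸ 1) ≤? length (State.L σ)
  ... | yes long = next (enter-step σ long)
    (λ { _ (enter _) → body-completes (loop-completes bound) σ C long le
       ; _ (exit ¬long) → contradiction long ¬long })
    (round-cost testCost (factor selectCode) (factor assignCode) (factor evaluateCode) (factor contractCode)
      (n ^ 2) (bound * (roundFactor * n ^ 2)) (ℕₚ.m^n>0 n 2))
  ... | no ¬long = next {b = 0} (exit-step σ ¬long)
    (λ { _ (enter long) → contradiction long ¬long ; _ (exit _) → done })
    (ℕₚ.≤-trans (ℕₚ.+-monoʳ-≤ testCost z≤n)
      (round-cost testCost (factor selectCode) (factor assignCode) (factor evaluateCode)
          (factor contractCode)
        (n ^ 2) (bound * (roundFactor * n ^ 2)) (ℕₚ.m^n>0 n 2)))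

  completes : CompletesWithin I input (totalFactor * n ^ 3)
  completes = next initialise-step
    (λ { _ (initialise mst π sorted) → loop-completes n _ (Consistent-start mst π sorted)
           (edges<n (Consistent-start mst π sorted)) })
    (ℕₚ.≤-reflexive (arith n (factor initialiseCode) roundFactor (n ^ 2)))
    where
    arith : ∀ n A B N → A * (n * N) + n * (B * N) ≡ (A + B) * (n * N)
    arith = solve-∀

  iteration : Com
  iteration = while I.continue (I.select ⨾ I.assign ⨾ I.evaluate ⨾ I.contract)

  -- Finishes γ m t m′: the code remaining at γ takes m to m′ in t time units.
  Finishes : Config → Memory → ℕ → Memory → Set c
  -- The rest of the body and the later iterations are kept apart because `while-true` takes them as
  -- separate premises.
  Unfinished : Com → Memory → ℕ → Memory → Set c
  Unfinished p m t m′ =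
      ∃[ m₁ ] ∃[ t₁ ] ∃[ t₂ ] (p / m ⇓ m₁ [ t₁ ]) × (iteration / m₁ ⇓ m′ [ t₂ ]) × t₁ + t₂ ≡ t
  Finishes input           m t m′ = I.program / m ⇓ m′ [ t ]
  Finishes (loop _)        m t m′ = iteration / m ⇓ m′ [ t ]
  Finishes (body _)        m t m′ = Unfinished (I.select ⨾ I.assign ⨾ I.evaluate ⨾ I.contract) m t m′
  Finishes (selected _ _)  m t m′ = Unfinished (I.assign ⨾ I.evaluate ⨾ I.contract) m t m′
  Finishes (assigned _ _)  m t m′ = Unfinished (I.evaluate ⨾ I.contract) m t m′
  Finishes (evaluated _ _) m t m′ = Unfinished I.contract m t m′
  Finishes (output _)      m t m′ = m ≡ m′ × t ≡ 0

  prepend : ∀ {p q m m₁ m′ u t} → p / m ⇓ m₁ [ u ] → Unfinished q m₁ t m′ → Unfinished (p ⨾ q) m (u + t) m′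
  prepend {u = u} r (m₂ , t₁ , t₂ , r₁ , r₂ , refl) = m₂ , u + t₁ , t₂ , seq r r₁ , r₂ , ℕₚ.+-assoc u t₁ t₂

  execute : ∀ {γ m γ′ m₁ u m′ t} → Execute I γ m γ′ m₁ u → Finishes γ′ m₁ t m′ → Finishes γ m (u + t) m′
  execute (initialise r) fin           = seq r fin
  execute (enter eq)     (_ , _ , _ , r , r′ , refl) = while-true eq r r′
  execute {m = m} (exit eq) (refl , refl) =
      subst (iteration / m ⇓ m [_]) (sym (ℕₚ.+-identityʳ _)) (while-false eq)
  execute (select r)     fin           = prepend r fin
  execute (assign r)     fin           = prepend r fin
  execute (evaluate r)   fin           = prepend r fin
  execute (contract r)   fin           = _ , _ , _ , r , fin , refl

  -- A bound on all successors covers the one that the code itself selects. Following that one gives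
  -- an actual run, ended by the induction on `CompletesWithin`, and `execute` assembles its pieces
  -- into a single big-step derivation.
  runs : ∀ {γ b} → CompletesWithin I γ b → ∀ m → Holds γ m →
    ∃[ P ] ∃[ m′ ] ∃[ t ] Star _⟶_ γ (output P) × Finishes γ m t m′ × HoldsSolution P m′ × t ≤ b
  runs done m (lift h) = _ , m , 0 , ε , (refl , refl) , h , z≤n
  runs (next st succ le) m h with st m h
  ... | γ′ , m₁ , u , go , ex , h₁ , u≤t with runs (succ γ′ go) m₁ h₁
  ... | P , m′ , t′ , star , fin , sol , t′≤b =
    P , m′ , u + t′ , go ◅ star , execute ex fin , sol , ℕₚ.≤-trans (ℕₚ.+-mono-≤ u≤t t′≤b) le

  runsWithin : RunsWithin I (totalFactor * n ^ 3)
  runsWithin = record { steps = completes ; whole = runs completes }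

theorem4p5 : ∀ {c ℓ} (𝔽 : OrderedField c ℓ) → let open MRSD 𝔽 in
    ∃[ I ] ∃[ C ] (∀ (n k : ℕ) (G : WeightedCompleteGraph n) →
    TriangleInequality G → 3 ≤ k → k ≤ n →
    Algorithm.RunsWithin k G I (C * n ^ 3))
theorem4p5 𝔽 = implementation , totalFactor , λ n k G _ 3≤k k≤n → Analysis.runsWithin 𝔽 k G 3≤k k≤n
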